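{- Let $\mathsf{R}$ be a principal ideal domain and let $\mathsf{k}$ be its field of fractions. Then there is an isomorphism of PROPs $\mathbb{IH}_{\mathsf{R}} \cong \mathbb{SV}_{\mathsf{k}}$, where $\mathbb{IH}_{\mathsf{R}}$ is the PROP of interacting Hopf algebras over $\mathsf{R}$ and $\mathbb{SV}_{\mathsf{k}}$ is the PROP of linear relations over $\mathsf{k}$.
   Context: A PROP is a strict symmetric monoidal category whose objects are the natural numbers and whose monoidal product $\oplus$ on objects is addition. Morphisms of PROPs are identity-on-objects strict symmetric monoidal functors. Composition is written in diagrammatic order: $f;g$ means first $f$, then $g$. The PROP presented by generators $\Sigma$ (each with arity and coarity) and equations $E$ has as arrows the terms built from $\Sigma$, $\mathrm{id}_1$ and the symmetry $\sigma:=\sigma_{1,1}$ using $;$ and $\oplus$, modulo the laws of symmetric monoidal categories and the smallest congruence containing $E$. The PROP $\mathbb{HA}_{\mathsf{R}}$ has generators $\Delta_\bullet:1\to2$, $\varepsilon_\bullet:1\to0$, $\mu_\circ:2\to1$, $\eta_\circ:0\to1$ and $s_k:1\to1$ for each $k\in\mathsf{R}$, and equations (for all $k,k_1,k_2\in\mathsf{R}$): (A1) $(\eta_\circ\oplus\mathrm{id}_1);\mu_\circ=\mathrm{id}_1$; (A2) $\sigma;\mu_\circ=\mu_\circ$; (A3) $(\mu_\circ\oplus\mathrm{id}_1);\mu_\circ=(\mathrm{id}_1\oplus\mu_\circ);\mu_\circ$; (A4) $\Delta_\bullet;(\varepsilon_\bullet\oplus\mathrm{id}_1)=\mathrm{id}_1$;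 (A5) $\Delta_\bullet;\sigma=\Delta_\bullet$; (A6) $\Delta_\bullet;(\Delta_\bullet\oplus\mathrm{id}_1)=\Delta_\bullet;(\mathrm{id}_1\oplus\Delta_\bullet)$; (A7) $\mu_\circ;\varepsilon_\bullet=\varepsilon_\bullet\oplus\varepsilon_\bullet$; (A8) $\mu_\circ;\Delta_\bullet=(\Delta_\bullet\oplus\Delta_\bullet);(\mathrm{id}_1\oplus\sigma\oplus\mathrm{id}_1);(\mu_\circ\oplus\mu_\circ)$; (A9) $\eta_\circ;\Delta_\bullet=\eta_\circ\oplus\eta_\circ$; (A10) $\eta_\circ;\varepsilon_\bullet=\mathrm{id}_0$; (A11) $s_1=\mathrm{id}_1$; (A12) $s_{k_1};s_{k_2}=s_{k_1k_2}$; (A13) $\mu_\circ;s_k=(s_k\oplus s_k);\mu_\circ$; (A14) $\eta_\circ;s_k=\eta_\circ$; (A15) $s_k;\Delta_\bullet=\Delta_\bullet;(s_k\oplus s_k)$; (A16) $s_k;\varepsilon_\bullet=\varepsilon_\bullet$; (A17) $s_0=\varepsilon_\bullet;\eta_\circ$; (A18) $\Delta_\bullet;(s_{k_1}\oplus s_{k_2});\mu_\circ=s_{k_1+k_2}$. The opposite PROP $\mathbb{HA}_{\mathsf{R}}^{op}$ is presented by generators $\mu_\bullet:2\to1$, $\eta_\bullet:0\to1$, $\Delta_\circ:1\to2$, $\varepsilon_\circ:1\to0$, $\bar s_k:1\to1$ ($k\in\mathsf{R}$), which are the opposites of $\Delta_\bullet,\varepsilon_\bullet,\mu_\circ,\eta_\circ,s_k$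 respectively, and the reversed equations (A1)$^{op}$–(A18)$^{op}$. The coproduct $\mathbb{HA}_{\mathsf{R}}+\mathbb{HA}_{\mathsf{R}}^{op}$ in PROPs is presented by the disjoint union of the generators and of the equations. $\mathbb{IH}_{\mathsf{R}}$ is the quotient of $\mathbb{HA}_{\mathsf{R}}+\mathbb{HA}_{\mathsf{R}}^{op}$ by the following equations, for all non-zero $l\in\mathsf{R}$: (I1) $s_l;\bar s_l=\mathrm{id}_1$; (I2) $\bar s_l;s_l=\mathrm{id}_1$; (I3) $(\Delta_\circ\oplus\mathrm{id}_1);(\mathrm{id}_1\oplus\mu_\circ)=\mu_\circ;\Delta_\circ=(\mathrm{id}_1\oplus\Delta_\circ);(\mu_\circ\oplus\mathrm{id}_1)$; (I4) $(\Delta_\bullet\oplus\mathrm{id}_1);(\mathrm{id}_1\oplus\mu_\bullet)=\mu_\bullet;\Delta_\bullet=(\mathrm{id}_1\oplus\Delta_\bullet);(\mu_\bullet\oplus\mathrm{id}_1)$; (I5) $\eta_\circ;\Delta_\circ=\eta_\bullet;\Delta_\bullet;(\mathrm{id}_1\oplus s_{ -1})$; (I6) $\mu_\circ;\varepsilon_\circ=(\mathrm{id}_1\oplus s_{ -1});\mu_\bullet;\varepsilon_\bullet$; (I7) $\Delta_\circ;\mu_\circ=\mathrm{id}_1$; (I8) $\Delta_\bullet;\mu_\bullet=\mathrm{id}_1$. The PROP $\mathbb{SV}_{\mathsf{k}}$ over a field $\mathsf{k}$: arrows $n\to m$ are the $\mathsf{k}$-linear subspaces of $\mathsf{k}^n\times\mathsf{k}^m$;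 composition is relational, i.e. for $V:n\to z$, $W:z\to m$, $(\mathbf{x},\mathbf{z})\in V;W$ iff there is $\mathbf{y}$ with $(\mathbf{x},\mathbf{y})\in V$ and $(\mathbf{y},\mathbf{z})\in W$; the monoidal product is direct sum; the symmetry $n+m\to m+n$ is $\{(\binom{\mathbf{x}}{\mathbf{y}},\binom{\mathbf{y}}{\mathbf{x}}):\mathbf{x}\in\mathsf{k}^n,\mathbf{y}\in\mathsf{k}^m\}$. -}

module Defs where

open import Algebra.Bundles using (CommutativeRing)
import Algebra.Solver.Ring.NaturalCoefficients.Default as NatCoeffSolver
open import Data.Fin.Base as Fin using (Fin; toℕ; _↑ˡ_; _↑ʳ_)
open import Data.Fin.Properties
  using (toℕ-injective; toℕ-↑ˡ; toℕ-↑ʳ; splitAt-↑ˡ; splitAt-↑ʳ; join-splitAt)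
open import Data.Nat.Base using (ℕ; zero; suc)
open import Data.Nat.Properties using (+-assoc; +-identityʳ)
open import Data.Product.Base using (∃; _×_; _,_)
open import Data.Sum.Base using (_⊎_; inj₁; inj₂; [_,_]′)
open import Data.Vec.Functional using (Vector; take; drop; _++_; zipWith; map; replicate)
open import Function.Base using (_∘_)
open import Function.Bundles using (_⇔_)
open import Level using (_⊔_; Lift; lift; lower) renaming (suc to lsuc)
open import Relation.Binary.Bundles using (Setoid)
open import Relation.Binary.Core using (Rel)
open import Relation.Binary.PropositionalEquality as ≡ using (_≡_; subst; subst₂)
open import Relation.Binary.Structures using (IsEquivalence)
open import Relation.Nullary.Negation.Core using (¬_; contradiction)

------------------------------------------------------------------------
-- Principal ideal domains, fields and fields of fractions

record IsIntegralDomain {c ℓ} (R : CommutativeRing c ℓ) : Set (c ⊔ ℓ) where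
  open CommutativeRing R
  field
    1≉0            : ¬ (1# ≈ 0#)
    noZeroDivisors : ∀ x y → x * y ≈ 0# → x ≈ 0# ⊎ y ≈ 0#

record Ideal {c ℓ} (R : CommutativeRing c ℓ) : Set (lsuc (c ⊔ ℓ)) where
  open CommutativeRing R
  field
    member : Carrier → Set (c ⊔ ℓ)
    resp   : ∀ {x y} → x ≈ y → member x → member y
    0∈     : member 0#
    +∈     : ∀ {x y} → member x → member y → member (x + y)
    *∈     : ∀ r {x} → member x → member (r * x)

IsPrincipal : ∀ {c ℓ} (R : CommutativeRing c ℓ) → Ideal R → Set (c ⊔ ℓ)
IsPrincipal R I = ∃ λ g → ∀ x → Ideal.member I x ⇔ g ∣ x
  where open CommutativeRing R using (semiring)
        open import Algebra.Properties.Semiring.Divisibility semiring using (_∣_)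

-- Ideals are arbitrary predicates, as in classical mathematics.  For a
-- proposition P, a generator of the ideal { x | x ≈ 0 or P } decides P, so
-- this definition entails excluded middle at level c ⊔ ℓ.
record IsPID {c ℓ} (R : CommutativeRing c ℓ) : Set (lsuc (c ⊔ ℓ)) where
  field
    isIntegralDomain : IsIntegralDomain R
    principal        : ∀ (I : Ideal R) → IsPrincipal R I

record Field c ℓ : Set (lsuc (c ⊔ ℓ)) where
  field
    commutativeRing : CommutativeRing c ℓ
  open CommutativeRing commutativeRing public
  field
    1≉0     : ¬ (1# ≈ 0#)
    inverse : ∀ x → ¬ (x ≈ 0#) → ∃ λ y → x * y ≈ 1#

module _ {c ℓ} (R : CommutativeRing c ℓ) where
  open CommutativeRing R

  record Fraction : Set (c ⊔ ℓ) where
    constructor mkFraction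
    field
      num   : Carrier
      den   : Carrier
      den≉0 : ¬ (den ≈ 0#)

module _ {c ℓ} (R : CommutativeRing c ℓ) (isIntegralDomain : IsIntegralDomain R) where
  open CommutativeRing R
  open IsIntegralDomain isIntegralDomain
  open Fraction
  open import Relation.Binary.Reasoning.Setoid setoid
  open import Algebra.Properties.Ring ring using (-‿distribˡ-*; [y-z]x≈yx-zx)
  open import Algebra.Properties.Group +-group using (inverseˡ-unique; ⁻¹-involutive)
  open NatCoeffSolver commutativeSemiring

  private
    *-nonzero : ∀ {x y} → ¬ (x ≈ 0#) → ¬ (y ≈ 0#) → ¬ (x * y ≈ 0#)
    *-nonzero x≉0 y≉0 xy≈0 = [ x≉0 , y≉0 ]′ (noZeroDivisors _ _ xy≈0)

    *-cancelʳ-nonzero : ∀ {x y} z → ¬ (z ≈ 0#) → x * z ≈ y * z → x ≈ y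
    *-cancelʳ-nonzero {x} {y} z z≉0 xz≈yz =
      [ (λ x-y≈0 → trans (inverseˡ-unique x (- y) x-y≈0) (⁻¹-involutive y))
      , (λ z≈0 → contradiction z≈0 z≉0) ]′
        (noZeroDivisors (x - y) z (begin
          (x - y) * z     ≈⟨ [y-z]x≈yx-zx z x y ⟩
          x * z - y * z   ≈⟨ +-congʳ xz≈yz ⟩
          y * z - y * z   ≈⟨ -‿inverseʳ (y * z) ⟩
          0#              ∎))

    F : Set (c ⊔ ℓ)
    F = Fraction R

    infix 4 _≈ᶠ_
    _≈ᶠ_ : Rel F ℓ
    p ≈ᶠ q = num p * den q ≈ num q * den p

    infixl 6 _+ᶠ_
    infixl 7 _*ᶠ_

    _+ᶠ_ _*ᶠ_ : F → F → F
    p +ᶠ q = mkFraction (num p * den q + num q * den p) (den p * den q)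
                        (*-nonzero (den≉0 p) (den≉0 q))
    p *ᶠ q = mkFraction (num p * num q) (den p * den q)
                        (*-nonzero (den≉0 p) (den≉0 q))

    -ᶠ_ : F → F
    -ᶠ p = mkFraction (- num p) (den p) (den≉0 p)

    0ᶠ 1ᶠ : F
    0ᶠ = mkFraction 0# 1# 1≉0
    1ᶠ = mkFraction 1# 1# 1≉0

    ≈ᶠ-trans : ∀ {p q r} → p ≈ᶠ q → q ≈ᶠ r → p ≈ᶠ r
    ≈ᶠ-trans {mkFraction a b _} {mkFraction x y y≉0} {mkFraction u v _} e f =
      *-cancelʳ-nonzero y y≉0 (begin
        (a * v) * y   ≈⟨ solve 3 (λ a v y → (a :* v) :* y := (a :* y) :* v) refl a v y ⟩
        (a * y) * v   ≈⟨ *-congʳ e ⟩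
        (x * b) * v   ≈⟨ solve 3 (λ x b v → (x :* b) :* v := (x :* v) :* b) refl x b v ⟩
        (x * v) * b   ≈⟨ *-congʳ f ⟩
        (u * y) * b   ≈⟨ solve 3 (λ u y b → (u :* y) :* b := (u :* b) :* y) refl u y b ⟩
        (u * b) * y   ∎)

    +ᶠ-cong : ∀ {p q r s} → p ≈ᶠ q → r ≈ᶠ s → p +ᶠ r ≈ᶠ q +ᶠ s
    +ᶠ-cong {mkFraction a b _} {mkFraction a′ b′ _} {mkFraction x y _} {mkFraction x′ y′ _} e f = begin
      (a * y + x * b) * (b′ * y′)
        ≈⟨ solve 6 (λ a b b′ x y y′ →
             (a :* y :+ x :* b) :* (b′ :* y′) := (a :* b′) :* (y :* y′) :+ (x :* y′) :* (b :* b′))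
             refl a b b′ x y y′ ⟩
      (a * b′) * (y * y′) + (x * y′) * (b * b′)
        ≈⟨ +-cong (*-congʳ e) (*-congʳ f) ⟩
      (a′ * b) * (y * y′) + (x′ * y) * (b * b′)
        ≈⟨ solve 6 (λ a′ b b′ x′ y y′ →
             (a′ :* b) :* (y :* y′) :+ (x′ :* y) :* (b :* b′) := (a′ :* y′ :+ x′ :* b′) :* (b :* y))
             refl a′ b b′ x′ y y′ ⟩
      (a′ * y′ + x′ * b′) * (b * y) ∎

    *ᶠ-cong : ∀ {p q r s} → p ≈ᶠ q → r ≈ᶠ s → p *ᶠ r ≈ᶠ q *ᶠ s
    *ᶠ-cong {mkFraction a b _} {mkFraction a′ b′ _} {mkFraction x y _} {mkFraction x′ y′ _} e f = begin
      (a * x) * (b′ * y′)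
        ≈⟨ solve 4 (λ a x b′ y′ → (a :* x) :* (b′ :* y′) := (a :* b′) :* (x :* y′)) refl a x b′ y′ ⟩
      (a * b′) * (x * y′)
        ≈⟨ *-cong e f ⟩
      (a′ * b) * (x′ * y)
        ≈⟨ solve 4 (λ a x b′ y′ → (a :* b′) :* (x :* y′) := (a :* x) :* (b′ :* y′)) refl a′ x′ b y ⟩
      (a′ * x′) * (b * y) ∎

    -ᶠ-cong : ∀ {p q} → p ≈ᶠ q → -ᶠ p ≈ᶠ -ᶠ q
    -ᶠ-cong {mkFraction a b _} {mkFraction a′ b′ _} e = begin
      (- a) * b′    ≈⟨ -‿distribˡ-* a b′ ⟨
      - (a * b′)    ≈⟨ -‿cong e ⟩
      - (a′ * b)    ≈⟨ -‿distribˡ-* a′ b ⟩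
      (- a′) * b    ∎

    +ᶠ-assoc : ∀ p q r → (p +ᶠ q) +ᶠ r ≈ᶠ p +ᶠ (q +ᶠ r)
    +ᶠ-assoc (mkFraction a b _) (mkFraction x y _) (mkFraction u v _) =
      solve 6 (λ a b x y u v →
        ((a :* y :+ x :* b) :* v :+ u :* (b :* y)) :* (b :* (y :* v))
          := (a :* (y :* v) :+ (x :* v :+ u :* y) :* b) :* ((b :* y) :* v))
        refl a b x y u v

    +ᶠ-comm : ∀ p q → p +ᶠ q ≈ᶠ q +ᶠ p
    +ᶠ-comm (mkFraction a b _) (mkFraction x y _) =
      solve 4 (λ a b x y →
        (a :* y :+ x :* b) :* (y :* b) := (x :* b :+ a :* y) :* (b :* y)) refl a b x y

    +ᶠ-identityˡ : ∀ p → 0ᶠ +ᶠ p ≈ᶠ p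
    +ᶠ-identityˡ (mkFraction a b _) = begin
      (0# * b + a * 1#) * b   ≈⟨ *-congʳ (+-cong (zeroˡ b) (*-identityʳ a)) ⟩
      (0# + a) * b            ≈⟨ *-congʳ (+-identityˡ a) ⟩
      a * b                   ≈⟨ *-congˡ (*-identityˡ b) ⟨
      a * (1# * b)            ∎

    +ᶠ-inverseˡ : ∀ p → (-ᶠ p) +ᶠ p ≈ᶠ 0ᶠ
    +ᶠ-inverseˡ (mkFraction a b _) = begin
      ((- a) * b + a * b) * 1#   ≈⟨ *-congʳ (distribʳ b (- a) a) ⟨
      ((- a + a) * b) * 1#       ≈⟨ *-congʳ (*-congʳ (-‿inverseˡ a)) ⟩
      (0# * b) * 1#              ≈⟨ *-congʳ (zeroˡ b) ⟩
      0# * 1#                    ≈⟨ zeroˡ 1# ⟩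
      0#                         ≈⟨ zeroˡ (b * b) ⟨
      0# * (b * b)               ∎

    *ᶠ-assoc : ∀ p q r → (p *ᶠ q) *ᶠ r ≈ᶠ p *ᶠ (q *ᶠ r)
    *ᶠ-assoc (mkFraction a b _) (mkFraction x y _) (mkFraction u v _) =
      solve 6 (λ a b x y u v →
        ((a :* x) :* u) :* (b :* (y :* v)) := (a :* (x :* u)) :* ((b :* y) :* v))
        refl a b x y u v

    *ᶠ-comm : ∀ p q → p *ᶠ q ≈ᶠ q *ᶠ p
    *ᶠ-comm (mkFraction a b _) (mkFraction x y _) =
      solve 4 (λ a b x y → (a :* x) :* (y :* b) := (x :* a) :* (b :* y)) refl a b x y

    *ᶠ-identityˡ : ∀ p → 1ᶠ *ᶠ p ≈ᶠ p
    *ᶠ-identityˡ (mkFraction a b _) = begin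
      (1# * a) * b   ≈⟨ *-congʳ (*-identityˡ a) ⟩
      a * b          ≈⟨ *-congˡ (*-identityˡ b) ⟨
      a * (1# * b)   ∎

    distribᶠˡ : ∀ p q r → p *ᶠ (q +ᶠ r) ≈ᶠ p *ᶠ q +ᶠ p *ᶠ r
    distribᶠˡ (mkFraction a b _) (mkFraction x y _) (mkFraction u v _) =
      solve 6 (λ a b x y u v →
        (a :* (x :* v :+ u :* y)) :* ((b :* y) :* (b :* v))
          := ((a :* x) :* (b :* v) :+ (a :* u) :* (b :* y)) :* (b :* (y :* v)))
        refl a b x y u v

  fractionRing : CommutativeRing (c ⊔ ℓ) ℓ
  fractionRing = record
    { Carrier = F ; _≈_ = _≈ᶠ_ ; _+_ = _+ᶠ_ ; _*_ = _*ᶠ_ ; -_ = -ᶠ_ ; 0# = 0ᶠ ; 1# = 1ᶠ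
    ; isCommutativeRing = record
      { isRing = record
        { +-isAbelianGroup = record
          { isGroup = record
            { isMonoid = record
              { isSemigroup = record
                { isMagma = record
                  { isEquivalence = isEquivalenceᶠ
                  ; ∙-cong = λ {p q r s} → +ᶠ-cong {p} {q} {r} {s} }
                ; assoc = +ᶠ-assoc }
              ; identity = comm∧idˡ⇒id {_+ᶠ_} +ᶠ-comm {0ᶠ} +ᶠ-identityˡ }
            ; inverse = comm∧invˡ⇒inv {_+ᶠ_} { -ᶠ_} {0ᶠ} +ᶠ-comm +ᶠ-inverseˡ
            ; ⁻¹-cong = λ {p q} → -ᶠ-cong {p} {q} }
          ; comm = +ᶠ-comm }
        ; *-cong = λ {p q r s} → *ᶠ-cong {p} {q} {r} {s}
        ; *-assoc = *ᶠ-assoc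
        ; *-identity = comm∧idˡ⇒id {_*ᶠ_} *ᶠ-comm {1ᶠ} *ᶠ-identityˡ
        ; distrib = comm∧distrˡ⇒distr {_*ᶠ_} {_+ᶠ_} (λ {p q r s} → +ᶠ-cong {p} {q} {r} {s}) *ᶠ-comm distribᶠˡ }
      ; *-comm = *ᶠ-comm } }
    where
    isEquivalenceᶠ : IsEquivalence _≈ᶠ_
    isEquivalenceᶠ = record
      { refl = refl ; sym = sym ; trans = λ {p q r} → ≈ᶠ-trans {p} {q} {r} }
    setoidᶠ : Setoid (c ⊔ ℓ) ℓ
    setoidᶠ = record { isEquivalence = isEquivalenceᶠ }
    open import Algebra.Consequences.Setoid setoidᶠ using (comm∧idˡ⇒id; comm∧invˡ⇒inv; comm∧distrˡ⇒distr)

  fractionField : Field (c ⊔ ℓ) ℓ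
  fractionField = record
    { commutativeRing = fractionRing
    ; 1≉0 = λ e → 1≉0 (begin
        1#        ≈⟨ *-identityˡ 1# ⟨
        1# * 1#   ≈⟨ e ⟩
        0# * 1#   ≈⟨ zeroˡ 1# ⟩
        0#        ∎)
    ; inverse = λ p p≉0 →
          mkFraction (den p) (num p) (λ n≈0 → p≉0 (begin
            num p * 1#   ≈⟨ *-identityʳ (num p) ⟩
            num p        ≈⟨ n≈0 ⟩
            0#           ≈⟨ zeroˡ (den p) ⟨
            0# * den p   ∎))
        , (begin
            (num p * den p) * 1#   ≈⟨ *-identityʳ _ ⟩
            num p * den p          ≈⟨ *-comm _ _ ⟩
            den p * num p          ≈⟨ *-identityˡ _ ⟨
            1# * (den p * num p)   ∎)
    }

------------------------------------------------------------------------
-- PROPs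

open import Data.Nat.Base using (_+_)

-- n ⊕ m is n + m, which is associative and unital only up to _≡_, so the
-- strictness laws and the hexagon are stated after transporting arrows along
-- the proofs of associativity and unitality.  The other hexagon, and the
-- triviality of σ 0 n and σ n 0, follow from the fields below.
record PROP h e : Set (lsuc (h ⊔ e)) where
  infix  4 _≈_
  infixl 5 _⨾_
  infixr 6 _⊕_
  field
    Hom : ℕ → ℕ → Set h
    _≈_ : ∀ {n m} → Rel (Hom n m) e
    id  : ∀ n → Hom n n
    _⨾_ : ∀ {n m l} → Hom n m → Hom m l → Hom n l
    _⊕_ : ∀ {n m n′ m′} → Hom n m → Hom n′ m′ → Hom (n + n′) (m + m′)
    σ   : ∀ n m → Hom (n + m) (m + n)

    isEquivalence : ∀ {n m} → IsEquivalence (_≈_ {n} {m})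
    ⨾-cong : ∀ {n m l} {f f′ : Hom n m} {g g′ : Hom m l} →
             f ≈ f′ → g ≈ g′ → f ⨾ g ≈ f′ ⨾ g′
    ⊕-cong : ∀ {n m n′ m′} {f f′ : Hom n m} {g g′ : Hom n′ m′} →
             f ≈ f′ → g ≈ g′ → f ⊕ g ≈ f′ ⊕ g′

    ⨾-assoc     : ∀ {n m l k} (f : Hom n m) (g : Hom m l) (h : Hom l k) →
                  (f ⨾ g) ⨾ h ≈ f ⨾ (g ⨾ h)
    ⨾-identityˡ : ∀ {n m} (f : Hom n m) → id n ⨾ f ≈ f
    ⨾-identityʳ : ∀ {n m} (f : Hom n m) → f ⨾ id m ≈ f

    ⊕-id : ∀ n m → id n ⊕ id m ≈ id (n + m)
    ⊕-⨾  : ∀ {n m l n′ m′ l′}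
           (f : Hom n m) (g : Hom m l) (f′ : Hom n′ m′) (g′ : Hom m′ l′) →
           (f ⨾ g) ⊕ (f′ ⨾ g′) ≈ (f ⊕ f′) ⨾ (g ⊕ g′)

    ⊕-assoc     : ∀ {a b c a′ b′ c′} (f : Hom a a′) (g : Hom b b′) (h : Hom c c′) →
                  subst₂ Hom (+-assoc a b c) (+-assoc a′ b′ c′) ((f ⊕ g) ⊕ h) ≈ f ⊕ (g ⊕ h)
    ⊕-identityˡ : ∀ {n m} (f : Hom n m) → id 0 ⊕ f ≈ f
    ⊕-identityʳ : ∀ {n m} (f : Hom n m) →
                  subst₂ Hom (+-identityʳ n) (+-identityʳ m) (f ⊕ id 0) ≈ f

    σ-natural    : ∀ {n m n′ m′} (f : Hom n m) (g : Hom n′ m′) →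
                   (f ⊕ g) ⨾ σ m m′ ≈ σ n n′ ⨾ (g ⊕ f)
    σ-involutive : ∀ n m → σ n m ⨾ σ m n ≈ id (n + m)
    σ-hexagon    : ∀ a b c →
                   subst₂ Hom (+-assoc a b c) (≡.sym (+-assoc c a b)) (σ (a + b) c)
                     ≈ (id a ⊕ σ b c) ⨾ subst₂ Hom (+-assoc a c b) ≡.refl (σ a c ⊕ id b)

record Morphism {h₁ e₁ h₂ e₂} (A : PROP h₁ e₁) (B : PROP h₂ e₂) : Set (h₁ ⊔ e₁ ⊔ h₂ ⊔ e₂) where
  private
    module A = PROP A
    module B = PROP B
  field
    ⟦_⟧    : ∀ {n m} → A.Hom n m → B.Hom n m
    ⟦⟧-cong : ∀ {n m} {f g : A.Hom n m} → f A.≈ g → ⟦ f ⟧ B.≈ ⟦ g ⟧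
    ⟦id⟧   : ∀ n → ⟦ A.id n ⟧ B.≈ B.id n
    ⟦⨾⟧    : ∀ {n m l} (f : A.Hom n m) (g : A.Hom m l) → ⟦ f A.⨾ g ⟧ B.≈ ⟦ f ⟧ B.⨾ ⟦ g ⟧
    ⟦⊕⟧    : ∀ {n m n′ m′} (f : A.Hom n m) (g : A.Hom n′ m′) →
             ⟦ f A.⊕ g ⟧ B.≈ ⟦ f ⟧ B.⊕ ⟦ g ⟧
    ⟦σ⟧    : ∀ n m → ⟦ A.σ n m ⟧ B.≈ B.σ n m

infix 4 _≅_
record _≅_ {h₁ e₁ h₂ e₂} (A : PROP h₁ e₁) (B : PROP h₂ e₂) : Set (h₁ ⊔ e₁ ⊔ h₂ ⊔ e₂) where
  private
    module A = PROP A
    module B = PROP B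
  field
    to      : Morphism A B
    from    : Morphism B A
    from∘to : ∀ {n m} (f : A.Hom n m) → Morphism.⟦_⟧ from (Morphism.⟦_⟧ to f) A.≈ f
    to∘from : ∀ {n m} (g : B.Hom n m) → Morphism.⟦_⟧ to (Morphism.⟦_⟧ from g) B.≈ g

------------------------------------------------------------------------
-- PROPs presented by generators and equations

Signature : ∀ s → Set (lsuc s)
Signature s = ℕ → ℕ → Set s

infixl 5 _⨾_
infixr 6 _⊕_
data Term {s} (S : Signature s) : ℕ → ℕ → Set s where
  gen : ∀ {n m} → S n m → Term S n m
  id₀ : Term S 0 0
  id₁ : Term S 1 1
  σ₁₁ : Term S 2 2
  _⨾_ : ∀ {n m l} → Term S n m → Term S m l → Term S n l
  _⊕_ : ∀ {n m n′ m′} → Term S n m → Term S n′ m′ → Term S (n + n′) (m + m′)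

module _ {s} {S : Signature s} where

  idₜ : ∀ n → Term S n n
  idₜ zero    = id₀
  idₜ (suc n) = id₁ ⊕ idₜ n

  -- The first wire crosses the other m wires.
  σ₁ : ∀ m → Term S (1 + m) (m + 1)
  σ₁ zero    = id₁
  σ₁ (suc m) = (σ₁₁ ⊕ idₜ m) ⨾ (id₁ ⊕ σ₁ m)

  σₜ : ∀ n m → Term S (n + m) (m + n)
  σₜ zero    m = subst (Term S m) (≡.sym (+-identityʳ m)) (idₜ m)
  σₜ (suc n) m = (id₁ ⊕ σₜ n m) ⨾ subst (Term S (suc m + n)) (+-assoc m 1 n) (σ₁ m ⊕ idₜ n)

mapTerm : ∀ {s s′} {S : Signature s} {S′ : Signature s′} →
          (∀ {n m} → S n m → S′ n m) → ∀ {n m} → Term S n m → Term S′ n m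
mapTerm φ (gen x) = gen (φ x)
mapTerm φ id₀     = id₀
mapTerm φ id₁     = id₁
mapTerm φ σ₁₁     = σ₁₁
mapTerm φ (t ⨾ u) = mapTerm φ t ⨾ mapTerm φ u
mapTerm φ (t ⊕ u) = mapTerm φ t ⊕ mapTerm φ u

record Presentation s e : Set (lsuc (s ⊔ e)) where
  field
    Sig : Signature s
    Eq  : ∀ {n m} → Rel (Term Sig n m) e

-- The smallest congruence containing the equations of P and the laws of
-- strict symmetric monoidal categories.
module _ {s e} (P : Presentation s e) where
  open Presentation P

  infix 4 _~_
  data _~_ : ∀ {n m} → Term Sig n m → Term Sig n m → Set (s ⊔ e) where
    ax    : ∀ {n m} {t u : Term Sig n m} → Eq t u → t ~ u
    ~refl  : ∀ {n m} {t : Term Sig n m} → t ~ t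
    ~sym   : ∀ {n m} {t u : Term Sig n m} → t ~ u → u ~ t
    ~trans : ∀ {n m} {t u v : Term Sig n m} → t ~ u → u ~ v → t ~ v
    ⨾-cong : ∀ {n m l} {t t′ : Term Sig n m} {u u′ : Term Sig m l} →
             t ~ t′ → u ~ u′ → t ⨾ u ~ t′ ⨾ u′
    ⊕-cong : ∀ {n m n′ m′} {t t′ : Term Sig n m} {u u′ : Term Sig n′ m′} →
             t ~ t′ → u ~ u′ → t ⊕ u ~ t′ ⊕ u′
    ⨾-assoc     : ∀ {n m l k} (t : Term Sig n m) (u : Term Sig m l) (v : Term Sig l k) →
                  (t ⨾ u) ⨾ v ~ t ⨾ (u ⨾ v)
    ⨾-identityˡ : ∀ {n m} (t : Term Sig n m) → idₜ n ⨾ t ~ t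
    ⨾-identityʳ : ∀ {n m} (t : Term Sig n m) → t ⨾ idₜ m ~ t
    ⊕-id : ∀ n m → idₜ n ⊕ idₜ m ~ idₜ (n + m)
    ⊕-⨾  : ∀ {n m l n′ m′ l′}
           (t : Term Sig n m) (u : Term Sig m l) (t′ : Term Sig n′ m′) (u′ : Term Sig m′ l′) →
           (t ⨾ u) ⊕ (t′ ⨾ u′) ~ (t ⊕ t′) ⨾ (u ⊕ u′)
    ⊕-assoc     : ∀ {a b c a′ b′ c′} (t : Term Sig a a′) (u : Term Sig b b′) (v : Term Sig c c′) →
                  subst₂ (Term Sig) (+-assoc a b c) (+-assoc a′ b′ c′) ((t ⊕ u) ⊕ v)
                    ~ t ⊕ (u ⊕ v)
    ⊕-identityˡ : ∀ {n m} (t : Term Sig n m) → id₀ ⊕ t ~ t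
    ⊕-identityʳ : ∀ {n m} (t : Term Sig n m) →
                  subst₂ (Term Sig) (+-identityʳ n) (+-identityʳ m) (t ⊕ id₀) ~ t
    σ-natural    : ∀ {n m n′ m′} (t : Term Sig n m) (u : Term Sig n′ m′) →
                   (t ⊕ u) ⨾ σₜ m m′ ~ σₜ n n′ ⨾ (u ⊕ t)
    σ-involutive : ∀ n m → σₜ n m ⨾ σₜ m n ~ idₜ (n + m)
    σ-hexagon    : ∀ a b c →
                   subst₂ (Term Sig) (+-assoc a b c) (≡.sym (+-assoc c a b)) (σₜ (a + b) c)
                     ~ (idₜ a ⊕ σₜ b c) ⨾ subst₂ (Term Sig) (+-assoc a c b) ≡.refl (σₜ a c ⊕ idₜ b)

  presented : PROP s (s ⊔ e)
  presented = record
    { Hom = Term Sig ; _≈_ = _~_ ; id = idₜ ; _⨾_ = _⨾_ ; _⊕_ = _⊕_ ; σ = σₜ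
    ; isEquivalence = record { refl = ~refl ; sym = ~sym ; trans = ~trans }
    ; ⨾-cong = ⨾-cong ; ⊕-cong = ⊕-cong
    ; ⨾-assoc = ⨾-assoc ; ⨾-identityˡ = ⨾-identityˡ ; ⨾-identityʳ = ⨾-identityʳ
    ; ⊕-id = ⊕-id ; ⊕-⨾ = ⊕-⨾
    ; ⊕-assoc = ⊕-assoc ; ⊕-identityˡ = ⊕-identityˡ ; ⊕-identityʳ = ⊕-identityʳ
    ; σ-natural = σ-natural ; σ-involutive = σ-involutive ; σ-hexagon = σ-hexagon
    }

Op : ∀ {s} → Signature s → Signature s
Op S n m = S m n

opTerm : ∀ {s} {S : Signature s} {n m} → Term S n m → Term (Op S) m n
opTerm (gen x) = gen x
opTerm id₀     = id₀
opTerm id₁     = id₁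
opTerm σ₁₁     = σ₁₁
opTerm (t ⨾ u) = opTerm u ⨾ opTerm t
opTerm (t ⊕ u) = opTerm t ⊕ opTerm u

module _ {s e} (P : Presentation s e) where
  open Presentation P

  data OpEq : ∀ {n m} → Term (Op Sig) n m → Term (Op Sig) n m → Set (s ⊔ e) where
    op : ∀ {n m} {t u : Term Sig n m} → Eq t u → OpEq (opTerm t) (opTerm u)

  opposite : Presentation s (s ⊔ e)
  opposite = record { Sig = Op Sig ; Eq = OpEq }

module _ {s₁ e₁ s₂ e₂} (P : Presentation s₁ e₁) (Q : Presentation s₂ e₂) where
  private
    module P = Presentation P
    module Q = Presentation Q

  SumSig : Signature (s₁ ⊔ s₂)
  SumSig n m = P.Sig n m ⊎ Q.Sig n m

  data SumEq : ∀ {n m} → Term SumSig n m → Term SumSig n m → Set (s₁ ⊔ e₁ ⊔ s₂ ⊔ e₂) where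
    inl : ∀ {n m} {t u : Term P.Sig n m} → P.Eq t u → SumEq (mapTerm inj₁ t) (mapTerm inj₁ u)
    inr : ∀ {n m} {t u : Term Q.Sig n m} → Q.Eq t u → SumEq (mapTerm inj₂ t) (mapTerm inj₂ u)

  coproduct : Presentation (s₁ ⊔ s₂) (s₁ ⊔ e₁ ⊔ s₂ ⊔ e₂)
  coproduct = record { Sig = SumSig ; Eq = SumEq }

------------------------------------------------------------------------
-- Interacting Hopf algebras

module _ {c ℓ} (R : CommutativeRing c ℓ) where
  private module R = CommutativeRing R
  open R using (0#; 1#)

  data HAGen : ℕ → ℕ → Set c where
    Δ : HAGen 1 2
    ε : HAGen 1 0
    μ : HAGen 2 1
    η : HAGen 0 1
    scale : R.Carrier → HAGen 1 1

  module _ where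
    private
      Δ• : Term HAGen 1 2
      Δ• = gen Δ
      ε• : Term HAGen 1 0
      ε• = gen ε
      μ∘ : Term HAGen 2 1
      μ∘ = gen μ
      η∘ : Term HAGen 0 1
      η∘ = gen η
      s⟨_⟩ : R.Carrier → Term HAGen 1 1
      s⟨ k ⟩ = gen (scale k)

    -- s-cong makes scalars that are equal in the setoid R name the same
    -- generator.
    data HAEq : ∀ {n m} → Term HAGen n m → Term HAGen n m → Set (c ⊔ ℓ) where
      s-cong : ∀ {k k′} → k R.≈ k′ → HAEq s⟨ k ⟩ s⟨ k′ ⟩
      A1  : HAEq ((η∘ ⊕ id₁) ⨾ μ∘) id₁
      A2  : HAEq (σ₁₁ ⨾ μ∘) μ∘
      A3  : HAEq ((μ∘ ⊕ id₁) ⨾ μ∘) ((id₁ ⊕ μ∘) ⨾ μ∘)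
      A4  : HAEq (Δ• ⨾ (ε• ⊕ id₁)) id₁
      A5  : HAEq (Δ• ⨾ σ₁₁) Δ•
      A6  : HAEq (Δ• ⨾ (Δ• ⊕ id₁)) (Δ• ⨾ (id₁ ⊕ Δ•))
      A7  : HAEq (μ∘ ⨾ ε•) (ε• ⊕ ε•)
      A8  : HAEq (μ∘ ⨾ Δ•) ((Δ• ⊕ Δ•) ⨾ (id₁ ⊕ σ₁₁ ⊕ id₁) ⨾ (μ∘ ⊕ μ∘))
      A9  : HAEq (η∘ ⨾ Δ•) (η∘ ⊕ η∘)
      A10 : HAEq (η∘ ⨾ ε•) id₀
      A11 : HAEq s⟨ 1# ⟩ id₁
      A12 : ∀ k₁ k₂ → HAEq (s⟨ k₁ ⟩ ⨾ s⟨ k₂ ⟩) s⟨ k₁ R.* k₂ ⟩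
      A13 : ∀ k → HAEq (μ∘ ⨾ s⟨ k ⟩) ((s⟨ k ⟩ ⊕ s⟨ k ⟩) ⨾ μ∘)
      A14 : ∀ k → HAEq (η∘ ⨾ s⟨ k ⟩) η∘
      A15 : ∀ k → HAEq (s⟨ k ⟩ ⨾ Δ•) (Δ• ⨾ (s⟨ k ⟩ ⊕ s⟨ k ⟩))
      A16 : ∀ k → HAEq (s⟨ k ⟩ ⨾ ε•) ε•
      A17 : HAEq s⟨ 0# ⟩ (ε• ⨾ η∘)
      A18 : ∀ k₁ k₂ → HAEq (Δ• ⨾ (s⟨ k₁ ⟩ ⊕ s⟨ k₂ ⟩) ⨾ μ∘) s⟨ k₁ R.+ k₂ ⟩

  HAPresentation : Presentation c (c ⊔ ℓ)
  HAPresentation = record { Sig = HAGen ; Eq = HAEq }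

  HA+HAᵒᵖ : Presentation c (c ⊔ ℓ)
  HA+HAᵒᵖ = coproduct HAPresentation (opposite HAPresentation)

  module _ where
    open Presentation HA+HAᵒᵖ
    -- The second summand has the generators of HA with arity and coarity
    -- exchanged, so black and white keep their meaning but Δ, μ and ε, η swap.
    private
      Δ• : Term Sig 1 2
      Δ• = gen (inj₁ Δ)
      ε• : Term Sig 1 0
      ε• = gen (inj₁ ε)
      μ∘ : Term Sig 2 1
      μ∘ = gen (inj₁ μ)
      η∘ : Term Sig 0 1
      η∘ = gen (inj₁ η)
      s⟨_⟩ : R.Carrier → Term Sig 1 1
      s⟨ k ⟩ = gen (inj₁ (scale k))
      μ• : Term Sig 2 1
      μ• = gen (inj₂ Δ)
      η• : Term Sig 0 1
      η• = gen (inj₂ ε)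
      Δ∘ : Term Sig 1 2
      Δ∘ = gen (inj₂ μ)
      ε∘ : Term Sig 1 0
      ε∘ = gen (inj₂ η)
      s̄⟨_⟩ : R.Carrier → Term Sig 1 1
      s̄⟨ k ⟩ = gen (inj₂ (scale k))

    data IHEq : ∀ {n m} → Term Sig n m → Term Sig n m → Set (c ⊔ ℓ) where
      I1  : ∀ l → ¬ (l R.≈ 0#) → IHEq (s⟨ l ⟩ ⨾ s̄⟨ l ⟩) id₁
      I2  : ∀ l → ¬ (l R.≈ 0#) → IHEq (s̄⟨ l ⟩ ⨾ s⟨ l ⟩) id₁
      I3ˡ : IHEq ((Δ∘ ⊕ id₁) ⨾ (id₁ ⊕ μ∘)) (μ∘ ⨾ Δ∘)
      I3ʳ : IHEq (μ∘ ⨾ Δ∘) ((id₁ ⊕ Δ∘) ⨾ (μ∘ ⊕ id₁))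
      I4ˡ : IHEq ((Δ• ⊕ id₁) ⨾ (id₁ ⊕ μ•)) (μ• ⨾ Δ•)
      I4ʳ : IHEq (μ• ⨾ Δ•) ((id₁ ⊕ Δ•) ⨾ (μ• ⊕ id₁))
      I5  : IHEq (η∘ ⨾ Δ∘) (η• ⨾ Δ• ⨾ (id₁ ⊕ s⟨ R.- 1# ⟩))
      I6  : IHEq (μ∘ ⨾ ε∘) ((id₁ ⊕ s⟨ R.- 1# ⟩) ⨾ μ• ⨾ ε•)
      I7  : IHEq (Δ∘ ⨾ μ∘) id₁
      I8  : IHEq (Δ• ⨾ μ•) id₁

    IHPresentation : Presentation c (c ⊔ ℓ)
    IHPresentation = record { Sig = Sig ; Eq = λ t u → Eq t u ⊎ IHEq t u }

  IH : PROP c (c ⊔ ℓ)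
  IH = presented IHPresentation

------------------------------------------------------------------------
-- Linear relations

module _ {a b} (K : Field a b) where
  private module K = Field K
  open import Data.Vec.Functional.Relation.Binary.Equality.Setoid K.setoid
    using (_≋_; ≋-refl; ≋-sym; ≋-trans)

  record Subspace (n m : ℕ) : Set (lsuc (a ⊔ b)) where
    field
      rel  : Vector K.Carrier n → Vector K.Carrier m → Set (a ⊔ b)
      resp : ∀ {x x′ y y′} → x ≋ x′ → y ≋ y′ → rel x y → rel x′ y′
      0∈   : rel (replicate n K.0#) (replicate m K.0#)
      +∈   : ∀ {x x′ y y′} → rel x y → rel x′ y′ → rel (zipWith K._+_ x x′) (zipWith K._+_ y y′)
      *∈   : ∀ k {x y} → rel x y → rel (map (k K.*_) x) (map (k K.*_) y)
  open Subspace

  infix 4 _≃_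
  record _≃_ {n m} (V W : Subspace n m) : Set (a ⊔ b) where
    field
      ⊆ : ∀ {x y} → rel V x y → rel W x y
      ⊇ : ∀ {x y} → rel W x y → rel V x y
  open _≃_

  private
    Vec : ℕ → Set a
    Vec = Vector K.Carrier

    variable
      n m l n′ m′ : ℕ

    reindex : (x : Vec m) {f g : Fin n → Fin m} → (∀ i → f i ≡ g i) → (x ∘ f) ≋ (x ∘ g)
    reindex x f≗g i = K.reflexive (≡.cong x (f≗g i))

    take-++ : (x : Vec n) (y : Vec m) → take n (x ++ y) ≋ x
    take-++ {n} {m} x y i = K.reflexive (≡.cong [ x , y ]′ (splitAt-↑ˡ n i m))

    drop-++ : (x : Vec n) (y : Vec m) → drop n (x ++ y) ≋ y
    drop-++ {n} {m} x y i = K.reflexive (≡.cong [ x , y ]′ (splitAt-↑ʳ n m i))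

    glue : ∀ n {m} {x y : Vec (n + m)} → take n x ≋ take n y → drop n x ≋ drop n y → x ≋ y
    glue n {m} {x} {y} p q i =
      ≡.subst (λ j → x j K.≈ y j) (join-splitAt n m i) (go (Fin.splitAt n i))
      where
      go : ∀ j → x (Fin.join n m j) K.≈ y (Fin.join n m j)
      go (inj₁ j) = p j
      go (inj₂ j) = q j

  idₛ : ∀ n → Subspace n n
  idₛ n = record
    { rel  = λ x y → Lift a (x ≋ y)
    ; resp = λ p q (lift r) → lift (≋-trans (≋-sym p) (≋-trans r q))
    ; 0∈   = lift ≋-refl
    ; +∈   = λ (lift p) (lift q) → lift λ i → K.+-cong (p i) (q i)
    ; *∈   = λ k (lift p) → lift λ i → K.*-congˡ (p i)
    }

  _⨾ₛ_ : ∀ {n m l} → Subspace n m → Subspace m l → Subspace n l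
  V ⨾ₛ W = record
    { rel  = λ x z → ∃ λ y → rel V x y × rel W y z
    ; resp = λ p q (y , v , w) → y , resp V p ≋-refl v , resp W ≋-refl q w
    ; 0∈   = _ , 0∈ V , 0∈ W
    ; +∈   = λ (_ , v , w) (_ , v′ , w′) → _ , +∈ V v v′ , +∈ W w w′
    ; *∈   = λ k (_ , v , w) → _ , *∈ V k v , *∈ W k w
    }

  -- The direct sum, with k^(n+n′) × k^(m+m′) read as (k^n × k^m) × (k^n′ × k^m′).
  _⊕ₛ_ : ∀ {n m n′ m′} → Subspace n m → Subspace n′ m′ → Subspace (n + n′) (m + m′)
  _⊕ₛ_ {n} {m} V W = record
    { rel  = λ x y → rel V (take n x) (take m y) × rel W (drop n x) (drop m y)
    ; resp = λ p q (v , w) → resp V (p ∘ (_↑ˡ _)) (q ∘ (_↑ˡ _)) v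
                           , resp W (p ∘ (n ↑ʳ_)) (q ∘ (m ↑ʳ_)) w
    ; 0∈   = 0∈ V , 0∈ W
    ; +∈   = λ (v , w) (v′ , w′) → +∈ V v v′ , +∈ W w w′
    ; *∈   = λ k (v , w) → *∈ V k v , *∈ W k w
    }

  σₛ : ∀ n m → Subspace (n + m) (m + n)
  σₛ n m = record
    { rel  = λ u v → Lift a (take n u ≋ drop m v × drop n u ≋ take m v)
    ; resp = λ p q (lift (r , s)) → lift
        ( ≋-trans (≋-sym (p ∘ (_↑ˡ m))) (≋-trans r (q ∘ (m ↑ʳ_)))
        , ≋-trans (≋-sym (p ∘ (n ↑ʳ_))) (≋-trans s (q ∘ (_↑ˡ n))) )
    ; 0∈   = lift (≋-refl , ≋-refl)
    ; +∈   = λ (lift (p , q)) (lift (p′ , q′)) →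
               lift ((λ i → K.+-cong (p i) (p′ i)) , (λ i → K.+-cong (q i) (q′ i)))
    ; *∈   = λ k (lift (p , q)) → lift ((λ i → K.*-congˡ (p i)) , (λ i → K.*-congˡ (q i)))
    }

  private
    toSubst : (p : n ≡ n′) (q : m ≡ m′) (V : Subspace n m) {x : Vec n′} {y : Vec m′} →
              rel (subst₂ Subspace p q V) x y → rel V (x ∘ subst Fin p) (y ∘ subst Fin q)
    toSubst ≡.refl ≡.refl V r = r

    fromSubst : (p : n ≡ n′) (q : m ≡ m′) (V : Subspace n m) {x : Vec n′} {y : Vec m′} →
                rel V (x ∘ subst Fin p) (y ∘ subst Fin q) → rel (subst₂ Subspace p q V) x y
    fromSubst ≡.refl ≡.refl V r = r

    toℕ-subst : (p : n ≡ m) (i : Fin n) → toℕ (subst Fin p i) ≡ toℕ i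
    toℕ-subst ≡.refl i = ≡.refl

    via-toℕ : (p : n ≡ m) {i : Fin n} {j : Fin m} → toℕ i ≡ toℕ j → subst Fin p i ≡ j
    via-toℕ p {i} e = toℕ-injective (≡.trans (toℕ-subst p i) e)

    module Assoc (a b c : ℕ) where
      private
        first : ∀ (i : Fin a) → toℕ ((i ↑ˡ b) ↑ˡ c) ≡ toℕ (i ↑ˡ (b + c))
        first i = ≡.trans (toℕ-↑ˡ (i ↑ˡ b) c) (≡.trans (toℕ-↑ˡ i b) (≡.sym (toℕ-↑ˡ i (b + c))))

        second : ∀ (i : Fin b) → toℕ ((a ↑ʳ i) ↑ˡ c) ≡ toℕ (a ↑ʳ (i ↑ˡ c))
        second i = ≡.trans (toℕ-↑ˡ (a ↑ʳ i) c) (≡.trans (toℕ-↑ʳ a i)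
                     (≡.sym (≡.trans (toℕ-↑ʳ a (i ↑ˡ c)) (≡.cong (a +_) (toℕ-↑ˡ i c)))))

        third : ∀ (i : Fin c) → toℕ ((a + b) ↑ʳ i) ≡ toℕ (a ↑ʳ (b ↑ʳ i))
        third i = ≡.trans (toℕ-↑ʳ (a + b) i) (≡.trans (+-assoc a b (toℕ i))
                    (≡.sym (≡.trans (toℕ-↑ʳ a (b ↑ʳ i)) (≡.cong (a +_) (toℕ-↑ʳ b i)))))

      module _ (x : Vec (a + (b + c))) where
        private x′ = x ∘ subst Fin (+-assoc a b c)

        r₁ : take a (take (a + b) x′) ≋ take a x
        r₁ = reindex x λ i → via-toℕ (+-assoc a b c) (first i)

        r₂ : drop a (take (a + b) x′) ≋ take b (drop a x)
        r₂ = reindex x λ i → via-toℕ (+-assoc a b c) (second i)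

        r₃ : drop (a + b) x′ ≋ drop b (drop a x)
        r₃ = reindex x λ i → via-toℕ (+-assoc a b c) (third i)

      module _ (z : Vec ((a + b) + c)) where
        private
          p : a + (b + c) ≡ (a + b) + c
          p = ≡.sym (+-assoc a b c)

          z′ = z ∘ subst Fin p

        l₁ : take a z′ ≋ take a (take (a + b) z)
        l₁ = reindex z λ i → via-toℕ p (≡.sym (first i))

        l₂ : take b (drop a z′) ≋ drop a (take (a + b) z)
        l₂ = reindex z λ i → via-toℕ p (≡.sym (second i))

        l₃ : drop b (drop a z′) ≋ drop (a + b) z
        l₃ = reindex z λ i → via-toℕ p (≡.sym (third i))

    ⊕-assocₛ : ∀ {a b c a′ b′ c′} (U : Subspace a a′) (V : Subspace b b′) (W : Subspace c c′) →
               subst₂ Subspace (+-assoc a b c) (+-assoc a′ b′ c′) ((U ⊕ₛ V) ⊕ₛ W) ≃ U ⊕ₛ (V ⊕ₛ W)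
    ⊕-assocₛ {a} {b} {c} {a′} {b′} {c′} U V W = record
      { ⊆ = λ {x} {y} r → let ((u , v) , w) = toSubst p q S r in
            resp U (D.r₁ x) (C.r₁ y) u , resp V (D.r₂ x) (C.r₂ y) v , resp W (D.r₃ x) (C.r₃ y) w
      ; ⊇ = λ {x} {y} (u , v , w) → fromSubst p q S
            ( ( resp U (≋-sym (D.r₁ x)) (≋-sym (C.r₁ y)) u
              , resp V (≋-sym (D.r₂ x)) (≋-sym (C.r₂ y)) v )
            , resp W (≋-sym (D.r₃ x)) (≋-sym (C.r₃ y)) w )
      }
      where
      p = +-assoc a b c
      q = +-assoc a′ b′ c′
      S = (U ⊕ₛ V) ⊕ₛ W
      module D = Assoc a b c
      module C = Assoc a′ b′ c′

    ⊕-identityʳₛ : (V : Subspace n m) →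
                   subst₂ Subspace (+-identityʳ n) (+-identityʳ m) (V ⊕ₛ idₛ 0) ≃ V
    ⊕-identityʳₛ {n} {m} V = record
      { ⊆ = λ {x} {y} r → let (v , _) = toSubst p q S r in resp V (e n x) (e m y) v
      ; ⊇ = λ {x} {y} v → fromSubst p q S
              (resp V (≋-sym (e n x)) (≋-sym (e m y)) v , lift λ ())
      }
      where
      p = +-identityʳ n
      q = +-identityʳ m
      S = V ⊕ₛ idₛ 0
      e : ∀ n (x : Vec n) → take n (x ∘ subst Fin (+-identityʳ n)) ≋ x
      e n x = reindex x λ i → via-toℕ (+-identityʳ n) (toℕ-↑ˡ i 0)

    σ-naturalₛ : (V : Subspace n m) (W : Subspace n′ m′) →
                 (V ⊕ₛ W) ⨾ₛ σₛ m m′ ≃ σₛ n n′ ⨾ₛ (W ⊕ₛ V)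
    σ-naturalₛ {n} {m} {n′} {m′} V W = record
      { ⊆ = λ {x} {z} (y , (v , w) , lift (p , q)) →
              let x₁ = take n x ; x₂ = drop n x in
              x₂ ++ x₁
              , lift (≋-sym (drop-++ x₂ x₁) , ≋-sym (take-++ x₂ x₁))
              , resp W (≋-sym (take-++ x₂ x₁)) q w , resp V (≋-sym (drop-++ x₂ x₁)) p v
      ; ⊇ = λ {x} {z} (y , lift (p , q) , (w , v)) →
              let z₁ = take m′ z ; z₂ = drop m′ z in
              z₂ ++ z₁
              , ( resp V (≋-sym p) (≋-sym (take-++ z₂ z₁)) v
                , resp W (≋-sym q) (≋-sym (drop-++ z₂ z₁)) w )
              , lift (take-++ z₂ z₁ , drop-++ z₂ z₁)
      }

    σ-involutiveₛ : ∀ n m → σₛ n m ⨾ₛ σₛ m n ≃ idₛ (n + m)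
    σ-involutiveₛ n m = record
      { ⊆ = λ (y , lift (p , q) , lift (p′ , q′)) →
              lift (glue n (≋-trans p q′) (≋-trans q p′))
      ; ⊇ = λ {x} {z} (lift p) →
              let x₁ = take n x ; x₂ = drop n x in
              x₂ ++ x₁
              , lift (≋-sym (drop-++ x₂ x₁) , ≋-sym (take-++ x₂ x₁))
              , lift ( ≋-trans (take-++ x₂ x₁) (p ∘ (n ↑ʳ_))
                     , ≋-trans (drop-++ x₂ x₁) (p ∘ (_↑ˡ m)) )
      }

    σ-hexagonₛ : ∀ a b c →
      subst₂ Subspace (+-assoc a b c) (≡.sym (+-assoc c a b)) (σₛ (a + b) c)
        ≃ (idₛ a ⊕ₛ σₛ b c) ⨾ₛ subst₂ Subspace (+-assoc a c b) ≡.refl (σₛ a c ⊕ₛ idₛ b)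
    σ-hexagonₛ a b c = record
      { ⊆ = λ {x} {z} r →
          let lift (r₁₂ , r₃) = toSubst p q S r
              x₁ = take a x ; x₂ = take b (drop a x) ; x₃ = drop b (drop a x)
              y₂₃ = x₃ ++ x₂
              y   = x₁ ++ y₂₃
              y₁≋ = take-++ x₁ y₂₃
              y₂≋ = ≋-trans ((drop-++ x₁ y₂₃) ∘ (_↑ˡ b)) (take-++ x₃ x₂)
              y₃≋ = ≋-trans ((drop-++ x₁ y₂₃) ∘ (c ↑ʳ_)) (drop-++ x₃ x₂)
          in y
           , ( lift (≋-sym y₁≋)
             , lift (≋-sym y₃≋ , ≋-sym y₂≋) )
           , fromSubst p′ ≡.refl T
               ( lift ( ≋-trans (M.r₁ y) (≋-trans y₁≋ (≋-trans (≋-sym (L.r₁ x))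
                          (≋-trans (r₁₂ ∘ (_↑ˡ b)) (N.l₂ z))))
                      , ≋-trans (M.r₂ y) (≋-trans y₂≋ (≋-trans (≋-sym (L.r₃ x))
                          (≋-trans r₃ (N.l₁ z)))) )
               , lift (≋-trans (M.r₃ y) (≋-trans y₃≋ (≋-trans (≋-sym (L.r₂ x))
                          (≋-trans (r₁₂ ∘ (a ↑ʳ_)) (N.l₃ z))))) )
      ; ⊇ = λ {x} {z} (y , (lift e₁ , lift (e₂ , e₃)) , t) →
          let (lift (f₁ , f₂) , lift f₃) = toSubst p′ ≡.refl T t
          in fromSubst p q S (lift
               ( glue a
                   (≋-trans (L.r₁ x) (≋-trans e₁ (≋-trans (≋-sym (M.r₁ y))
                      (≋-trans f₁ (≋-sym (N.l₂ z))))))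
                   (≋-trans (L.r₂ x) (≋-trans e₂ (≋-trans (≋-sym (M.r₃ y))
                      (≋-trans f₃ (≋-sym (N.l₃ z))))))
               , ≋-trans (L.r₃ x) (≋-trans e₃ (≋-trans (≋-sym (M.r₂ y))
                   (≋-trans f₂ (≋-sym (N.l₁ z))))) ))
      }
      where
      p  = +-assoc a b c
      q  = ≡.sym (+-assoc c a b)
      p′ = +-assoc a c b
      S  = σₛ (a + b) c
      T  = σₛ a c ⊕ₛ idₛ b
      module L = Assoc a b c
      module M = Assoc a c b
      module N = Assoc c a b

  SV : PROP (lsuc (a ⊔ b)) (a ⊔ b)
  SV = record
    { Hom = Subspace ; _≈_ = _≃_ ; id = idₛ ; _⨾_ = _⨾ₛ_ ; _⊕_ = _⊕ₛ_ ; σ = σₛ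
    ; isEquivalence = record
      { refl  = record { ⊆ = λ v → v ; ⊇ = λ v → v }
      ; sym   = λ p → record { ⊆ = ⊇ p ; ⊇ = ⊆ p }
      ; trans = λ p q → record { ⊆ = λ v → ⊆ q (⊆ p v) ; ⊇ = λ v → ⊇ p (⊇ q v) }
      }
    ; ⨾-cong = λ p q → record
      { ⊆ = λ (y , v , w) → y , ⊆ p v , ⊆ q w
      ; ⊇ = λ (y , v , w) → y , ⊇ p v , ⊇ q w }
    ; ⊕-cong = λ p q → record
      { ⊆ = λ (v , w) → ⊆ p v , ⊆ q w
      ; ⊇ = λ (v , w) → ⊇ p v , ⊇ q w }
    ; ⨾-assoc = λ _ _ _ → record
      { ⊆ = λ (z , (y , u , v) , w) → y , u , z , v , w
      ; ⊇ = λ (y , u , z , v , w) → z , (y , u , v) , w }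
    ; ⨾-identityˡ = λ V → record
      { ⊆ = λ (_ , lift p , v) → resp V (≋-sym p) ≋-refl v
      ; ⊇ = λ v → _ , lift ≋-refl , v }
    ; ⨾-identityʳ = λ V → record
      { ⊆ = λ (_ , v , lift p) → resp V ≋-refl p v
      ; ⊇ = λ v → _ , v , lift ≋-refl }
    ; ⊕-id = λ n m → record
      { ⊆ = λ (lift p , lift q) → lift (glue n p q)
      ; ⊇ = λ (lift p) → lift (p ∘ (_↑ˡ m)) , lift (p ∘ (n ↑ʳ_)) }
    ; ⊕-⨾ = λ V W V′ W′ → record
      { ⊆ = λ ((y , v , w) , (y′ , v′ , w′)) →
              y ++ y′
              , ( resp V ≋-refl (≋-sym (take-++ y y′)) v
                , resp V′ ≋-refl (≋-sym (drop-++ y y′)) v′ )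
              , ( resp W (≋-sym (take-++ y y′)) ≋-refl w
                , resp W′ (≋-sym (drop-++ y y′)) ≋-refl w′ )
      ; ⊇ = λ (_ , (v , v′) , (w , w′)) → (_ , v , w) , (_ , v′ , w′) }
    ; ⊕-assoc = ⊕-assocₛ
    ; ⊕-identityˡ = λ V → record
      { ⊆ = λ (_ , v) → v
      ; ⊇ = λ v → lift (λ ()) , v }
    ; ⊕-identityʳ = ⊕-identityʳₛ
    ; σ-natural = σ-naturalₛ
    ; σ-involutive = σ-involutiveₛ
    ; σ-hexagon = σ-hexagonₛ
    }

{-# OPTIONS --safe #-}

-- A generator of HA is interpreted as the graph of a linear map over K and its
-- opposite as the converse relation.  For faithfulness, the black cup and cap
-- satisfy a snake equation, so wires can be bent one at a time and it suffices to
-- treat arrows 0 → m.  Each of them equals the diagram of the span of a list of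
-- vectors over R: linear maps act on such lists, and every generator of HAᵒᵖ is
-- expressible through HA, η• and ε∘, where η• adds a vector and ε∘ performs one
-- elimination step.  Two lists with the same K-span give equal diagrams, because
-- a vector in the K-span of a list is, after clearing denominators, an
-- R-combination of the list and can be removed by shears.  No Smith or Hermite
-- normal form is needed: beyond being an integral domain, R being a principal
-- ideal domain is used only for the excluded middle that it entails.
module Submission where

open import Defs
open import Algebra.Bundles using (CommutativeRing)
import Algebra.Solver.Ring.NaturalCoefficients.Default as NatCoeffSolver
open import Data.Fin.Base as Fin using (Fin; zero; suc; _↑ˡ_; _↑ʳ_)
open import Data.Fin.Properties using (splitAt-↑ˡ; splitAt-↑ʳ; join-splitAt; toℕ-injective; toℕ-↑ˡ)
open import Data.List.Base as List using (List; []; _∷_)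
open import Data.List.Relation.Binary.Permutation.Propositional as Perm using (_↭_)
open import Data.List.Relation.Binary.Permutation.Propositional.Properties using (++-comm)
open import Data.List.Relation.Unary.All as All using (All; []; _∷_)
open import Data.Nat.Base using (ℕ; zero; suc; _+_)
open import Data.Nat.Properties using (+-assoc; +-identityʳ)
open import Data.Product.Base using (∃; _×_; _,_; proj₁; proj₂)
open import Data.Sum.Base using (_⊎_; inj₁; inj₂; [_,_]′)
open import Data.Vec.Functional using (Vector; head; tail; take; drop; _++_)
  renaming (_∷_ to _∷ᵥ_; [] to []ᵥ)
open import Function.Base using (_∘_)
open import Function.Bundles using (Equivalence)
open import Level using (_⊔_; Lift; lift; lower)
open import Relation.Binary.Bundles using (Setoid)
open import Relation.Binary.Core using (Rel)
open import Relation.Binary.PropositionalEquality as ≡ using (_≡_; subst; subst₂)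
open import Relation.Binary.Structures using (IsEquivalence)
open import Relation.Nullary.Decidable.Core using (Dec; yes; no)
open import Relation.Nullary.Negation.Core using (¬_; contradiction)

-- The obstacle is strictness: tensor is associative only after a transport along `+-assoc`, which
-- does not reduce for variable arities. Diagrams are therefore kept nested to the right, and
-- inductions on terms carry `k` spare wires below the term. A tensor then splits into a left factor
-- with more spare wires and a right factor shifted below other wires, and the transport is dealt
-- with once.
--
-- The matrix calculus is not built on matrix multiplication. A linear diagram is one that commutes
-- with `absorb`, the operation of adding a multiple of a fixed vector. The identity is written as a
-- matrix, by absorbing unit vectors into zero, and any linear diagram is then pushed through it
-- column by column. Replacing the coefficient inputs of a matrix by `η•` turns it into a span, so
-- the same naturality moves linear diagrams through spans.
--
-- The sign in I5 and I6 is why -1 keeps reappearing: it is its own inverse as a scalar, it can be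
-- created before `ε•` or after `η∘`, and being non-zero it is absorbed by `η•`.

-- Calculus of terms in a presented PROP

module Calculus {s e} (P : Presentation s e) where
  open Presentation P

  infix 4 _≈_
  _≈_ : ∀ {n m} → Rel (Term Sig n m) (s ⊔ e)
  _≈_ = _~_ P

  termSetoid : ℕ → ℕ → Setoid s (s ⊔ e)
  termSetoid n m = record
    { Carrier = Term Sig n m ; _≈_ = _≈_
    ; isEquivalence = record { refl = ~refl ; sym = ~sym ; trans = ~trans } }

  module _ {n m : ℕ} where
    open import Relation.Binary.Reasoning.Setoid (termSetoid n m) public

  private
    variable
      a b c d n m k : ℕ

  I : Term Sig 1 1
  I = id₁

  J : ∀ n → Term Sig n n
  J = idₜ

  infixr 4 refl⟩⨾⟨_ refl⟩⊕⟨_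
  infixl 5 _⟩⨾⟨refl
  infixl 6 _⟩⊕⟨refl

  refl⟩⨾⟨_ : {f : Term Sig a b} {g h : Term Sig b c} → g ≈ h → f ⨾ g ≈ f ⨾ h
  refl⟩⨾⟨ p = ⨾-cong ~refl p

  _⟩⨾⟨refl : {f g : Term Sig a b} {h : Term Sig b c} → f ≈ g → f ⨾ h ≈ g ⨾ h
  p ⟩⨾⟨refl = ⨾-cong p ~refl

  refl⟩⊕⟨_ : {f : Term Sig a b} {g h : Term Sig c d} → g ≈ h → f ⊕ g ≈ f ⊕ h
  refl⟩⊕⟨ p = ⊕-cong ~refl p

  _⟩⊕⟨refl : {f g : Term Sig a b} {h : Term Sig c d} → f ≈ g → f ⊕ h ≈ g ⊕ h
  p ⟩⊕⟨refl = ⊕-cong p ~refl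

  assoc : {f : Term Sig a b} {g : Term Sig b c} {h : Term Sig c d} → (f ⨾ g) ⨾ h ≈ f ⨾ (g ⨾ h)
  assoc = ⨾-assoc _ _ _

  pull : {f : Term Sig a b} {g : Term Sig b c} {h : Term Sig a c} {r : Term Sig c d} →
         f ⨾ g ≈ h → f ⨾ (g ⨾ r) ≈ h ⨾ r
  pull p = ~trans (~sym assoc) (p ⟩⨾⟨refl)

  push : {f : Term Sig a b} {g : Term Sig b c} {h : Term Sig a c} {r : Term Sig c d} →
         h ≈ f ⨾ g → h ⨾ r ≈ f ⨾ (g ⨾ r)
  push p = ~trans (p ⟩⨾⟨refl) assoc

  swap₂ : {f : Term Sig a b} {g : Term Sig b c} {f′ : Term Sig a m} {g′ : Term Sig m c} {r : Term Sig c d} →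
          f ⨾ g ≈ f′ ⨾ g′ → f ⨾ (g ⨾ r) ≈ f′ ⨾ (g′ ⨾ r)
  swap₂ p = ~trans (pull p) assoc

  idl : {f : Term Sig n m} → J n ⨾ f ≈ f
  idl = ⨾-identityˡ _

  idr : {f : Term Sig n m} → f ⨾ J m ≈ f
  idr = ⨾-identityʳ _

  -- `idₜ 1` unfolds to `id₁ ⊕ id₀`, which is not the constructor `id₁`; hence the separate versions
  -- of the unit and interchange laws for `I` and for `J`.
  J₁≈I : J 1 ≈ I
  J₁≈I = ⊕-identityʳ id₁

  J₂≈ : J 2 ≈ I ⊕ I
  J₂≈ = refl⟩⊕⟨ J₁≈I

  idl₁ : {f : Term Sig 1 m} → I ⨾ f ≈ f
  idl₁ = ~trans (~sym J₁≈I ⟩⨾⟨refl) idl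

  idr₁ : {f : Term Sig n 1} → f ⨾ I ≈ f
  idr₁ = ~trans (refl⟩⨾⟨ ~sym J₁≈I) idr

  ⊕J-⨾ : {f : Term Sig a b} {g : Term Sig b c} → (f ⨾ g) ⊕ J k ≈ (f ⊕ J k) ⨾ (g ⊕ J k)
  ⊕J-⨾ = ~trans (refl⟩⊕⟨ ~sym idl) (⊕-⨾ _ _ _ _)

  ⊕I-⨾ : {f : Term Sig a b} {g : Term Sig b c} → (f ⨾ g) ⊕ I ≈ (f ⊕ I) ⨾ (g ⊕ I)
  ⊕I-⨾ = ~trans (refl⟩⊕⟨ ~sym idl₁) (⊕-⨾ _ _ _ _)

  I⊕-⨾ : {f : Term Sig a b} {g : Term Sig b c} → I ⊕ (f ⨾ g) ≈ (I ⊕ f) ⨾ (I ⊕ g)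
  I⊕-⨾ = ~trans (~sym idl₁ ⟩⊕⟨refl) (⊕-⨾ _ _ _ _)

  -- For a numeral `n` this computes to the nested form `I ⊕ (I ⊕ g)`, so that `slide` and its
  -- relatives apply to such diagrams without rebracketing.
  W : ∀ n → Term Sig a b → Term Sig (n + a) (n + b)
  W zero    g = g
  W (suc n) g = I ⊕ W n g

  W≈ : ∀ n {g : Term Sig a b} → J n ⊕ g ≈ W n g
  W≈ zero    = ⊕-identityˡ _
  -- `+-assoc` reduces to `refl` when its first argument is a numeral, so the transport in `⊕-assoc`
  -- vanishes as soon as the first factor has fixed arity and coarity. The same holds in the later
  -- uses with a generator or `I` in front.
  W≈ (suc n) = ~trans (⊕-assoc id₁ (J n) _) (refl⟩⊕⟨ W≈ n)

  top-first : {f : Term Sig n m} {g : Term Sig a b} → f ⊕ g ≈ (f ⊕ J a) ⨾ W m g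
  top-first {m = m} {a = a} {f = f} {g} = begin
    f ⊕ g                     ≈⟨ ⊕-cong idr idl ⟨
    (f ⨾ J m) ⊕ (J a ⨾ g)     ≈⟨ ⊕-⨾ _ _ _ _ ⟩
    (f ⊕ J a) ⨾ (J m ⊕ g)     ≈⟨ refl⟩⨾⟨ W≈ m ⟩
    (f ⊕ J a) ⨾ W m g         ∎

  bottom-first : {f : Term Sig n m} {g : Term Sig a b} → f ⊕ g ≈ W n g ⨾ (f ⊕ J b)
  bottom-first {n = n} {b = b} {f = f} {g} = begin
    f ⊕ g                     ≈⟨ ⊕-cong idl idr ⟨
    (J n ⨾ f) ⊕ (g ⨾ J b)     ≈⟨ ⊕-⨾ _ _ _ _ ⟩
    (J n ⊕ g) ⨾ (f ⊕ J b)     ≈⟨ W≈ n ⟩⨾⟨refl ⟩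
    W n g ⨾ (f ⊕ J b)         ∎

  slide : {f : Term Sig n m} {g : Term Sig a b} → (f ⊕ J a) ⨾ W m g ≈ W n g ⨾ (f ⊕ J b)
  slide = ~trans (~sym top-first) bottom-first

  ⊕-pre : {f : Term Sig n m} {g : Term Sig a b} {h : Term Sig b c} →
          f ⊕ (g ⨾ h) ≈ W n g ⨾ (f ⊕ h)
  ⊕-pre {n = n} = ~trans (~sym idl ⟩⊕⟨refl) (~trans (⊕-⨾ _ _ _ _) (W≈ n ⟩⨾⟨refl))

  ⊕-post : {f : Term Sig n m} {g : Term Sig a b} {h : Term Sig b c} →
           f ⊕ (g ⨾ h) ≈ (f ⊕ g) ⨾ W m h
  ⊕-post {m = m} = ~trans (~sym idr ⟩⊕⟨refl) (~trans (⊕-⨾ _ _ _ _) (refl⟩⨾⟨ W≈ m))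

  pre-⊕ : {f : Term Sig n m} {g : Term Sig m k} {h : Term Sig a b} →
          (f ⨾ g) ⊕ h ≈ (f ⊕ J a) ⨾ (g ⊕ h)
  pre-⊕ = ~trans (refl⟩⊕⟨ ~sym idl) (⊕-⨾ _ _ _ _)

  post-⊕ : {f : Term Sig n m} {g : Term Sig m k} {h : Term Sig a b} →
           (f ⨾ g) ⊕ h ≈ (f ⊕ h) ⨾ (g ⊕ J b)
  post-⊕ = ~trans (refl⟩⊕⟨ ~sym idr) (⊕-⨾ _ _ _ _)

  ⊕I≈⊕J : {f : Term Sig n m} → f ⊕ I ≈ f ⊕ J 1
  ⊕I≈⊕J = refl⟩⊕⟨ ~sym J₁≈I

  σ₀₁≈ : σₜ 0 1 ≈ I
  σ₀₁≈ = J₁≈I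

  σ₁₀≈ : σₜ 1 0 ≈ I
  σ₁₀≈ = ~trans (⨾-cong J₁≈I J₁≈I) idl₁

  σ₁-1≈ : σ₁ 1 ≈ σ₁₁
  σ₁-1≈ = begin
    (σ₁₁ ⊕ id₀) ⨾ (id₁ ⊕ id₁)   ≈⟨ ⨾-cong (⊕-identityʳ σ₁₁) (~sym J₂≈) ⟩
    σ₁₁ ⨾ J 2                   ≈⟨ idr ⟩
    σ₁₁                         ∎

  σ₁₁≈ : σₜ 1 1 ≈ σ₁₁
  σ₁₁≈ = begin
    (id₁ ⊕ J 1) ⨾ (σ₁ 1 ⊕ id₀)   ≈⟨ idl ⟩
    σ₁ 1 ⊕ id₀                   ≈⟨ ⊕-identityʳ (σ₁ 1) ⟩
    σ₁ 1                         ≈⟨ σ₁-1≈ ⟩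
    σ₁₁                          ∎

  σ₁₂≈ : σₜ 1 2 ≈ (σ₁₁ ⊕ I) ⨾ (I ⊕ σ₁₁)
  σ₁₂≈ = begin
    (id₁ ⊕ J 2) ⨾ (σ₁ 2 ⊕ id₀)      ≈⟨ idl ⟩
    σ₁ 2 ⊕ id₀                      ≈⟨ ⊕-identityʳ (σ₁ 2) ⟩
    (σ₁₁ ⊕ J 1) ⨾ (I ⊕ σ₁ 1)        ≈⟨ ⨾-cong (~sym ⊕I≈⊕J) (refl⟩⊕⟨ σ₁-1≈) ⟩
    (σ₁₁ ⊕ I) ⨾ (I ⊕ σ₁₁)           ∎

  σ₂₁≈ : σₜ 2 1 ≈ (I ⊕ σ₁₁) ⨾ (σ₁₁ ⊕ I)
  σ₂₁≈ = ⨾-cong (refl⟩⊕⟨ σ₁₁≈) (⊕-cong σ₁-1≈ J₁≈I)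

  σ² : σ₁₁ ⨾ σ₁₁ ≈ I ⊕ I
  σ² = ~trans (⨾-cong (~sym σ₁₁≈) (~sym σ₁₁≈)) (~trans (σ-involutive 1 1) J₂≈)

  σ-nat₁₁ : {f g : Term Sig 1 1} → (f ⊕ g) ⨾ σ₁₁ ≈ σ₁₁ ⨾ (g ⊕ f)
  σ-nat₁₁ = ~trans (refl⟩⨾⟨ ~sym σ₁₁≈) (~trans (σ-natural _ _) (σ₁₁≈ ⟩⨾⟨refl))

-- Diagrams of linear maps and their matrix form

module Maps {c ℓ} (R : CommutativeRing c ℓ) where
  private module R = CommutativeRing R
  open Calculus (IHPresentation R) public
  open Presentation (IHPresentation R) public using (Sig)
  open import Data.Vec.Functional.Relation.Binary.Equality.Setoid R.setoid public
    using (_≋_; ≋-refl; ≋-sym; ≋-trans)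

  private
    variable
      a b d n m k p q : ℕ

  Vec : ℕ → Set c
  Vec = Vector R.Carrier

  gen₁ : HAGen R n m → Term Sig n m
  gen₁ g = gen (inj₁ g)

  Δ• : Term Sig 1 2
  Δ• = gen₁ Δ
  ε• : Term Sig 1 0
  ε• = gen₁ ε
  μ∘ : Term Sig 2 1
  μ∘ = gen₁ μ
  η∘ : Term Sig 0 1
  η∘ = gen₁ η
  s : R.Carrier → Term Sig 1 1
  s x = gen₁ (scale x)

  ha : {t u : Term (HAGen R) n m} → HAEq R t u → mapTerm inj₁ t ≈ mapTerm inj₁ u
  ha e = ax (inj₁ (inl e))

  ha-op : {t u : Term (HAGen R) n m} → HAEq R t u → mapTerm inj₂ (opTerm t) ≈ mapTerm inj₂ (opTerm u)
  ha-op e = ax (inj₁ (inr (op e)))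

  counitʳ : {d : Term Sig 1 2} {e : Term Sig 1 0} → d ⨾ σ₁₁ ≈ d → d ⨾ (e ⊕ I) ≈ I → d ⨾ (I ⊕ e) ≈ I
  counitʳ {d} {e} comm unit = begin
    d ⨾ (I ⊕ e)            ≈⟨ comm ⟩⨾⟨refl ⟨
    (d ⨾ σ₁₁) ⨾ (I ⊕ e)    ≈⟨ assoc ⟩
    d ⨾ (σ₁₁ ⨾ (I ⊕ e))    ≈⟨ refl⟩⨾⟨ σ₁₁≈ ⟩⨾⟨refl ⟨
    d ⨾ (σₜ 1 1 ⨾ (I ⊕ e)) ≈⟨ refl⟩⨾⟨ σ-natural e I ⟨
    d ⨾ ((e ⊕ I) ⨾ σₜ 0 1) ≈⟨ pull unit ⟩
    I ⨾ σₜ 0 1             ≈⟨ ⨾-cong ~refl σ₀₁≈ ⟩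
    I ⨾ I                  ≈⟨ idl₁ ⟩
    I                      ∎

  unitʳ : {g : Term Sig 2 1} {e : Term Sig 0 1} → σ₁₁ ⨾ g ≈ g → (e ⊕ I) ⨾ g ≈ I → (I ⊕ e) ⨾ g ≈ I
  unitʳ {g} {e} comm unit = begin
    (I ⊕ e) ⨾ g              ≈⟨ refl⟩⨾⟨ comm ⟨
    (I ⊕ e) ⨾ (σ₁₁ ⨾ g)      ≈⟨ refl⟩⨾⟨ σ₁₁≈ ⟩⨾⟨refl ⟨
    (I ⊕ e) ⨾ (σₜ 1 1 ⨾ g)   ≈⟨ swap₂ (σ-natural I e) ⟩
    σₜ 1 0 ⨾ ((e ⊕ I) ⨾ g)   ≈⟨ ⨾-cong σ₁₀≈ unit ⟩
    I ⨾ I                    ≈⟨ idl₁ ⟩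
    I                        ∎

  Δε : Δ• ⨾ (I ⊕ ε•) ≈ I
  Δε = counitʳ (ha A5) (ha A4)

  ημ : (I ⊕ η∘) ⨾ μ∘ ≈ I
  ημ = unitʳ (ha A2) (ha A1)

  s-cong′ : ∀ {x y} → x R.≈ y → s x ≈ s y
  s-cong′ e = ha (s-cong e)

  -- M x : (c, y) ↦ x c + y
  M : R.Carrier → Term Sig 2 1
  M x = (s x ⊕ I) ⨾ μ∘

  -- absorb v : (c, y) ↦ y + c v
  absorb : Vec m → Term Sig (suc m) m
  absorb {zero}  v = ε•
  absorb {suc m} v = (Δ• ⊕ J (suc m)) ⨾ ((I ⊕ (σ₁₁ ⊕ J m)) ⨾ (M (head v) ⊕ absorb (tail v)))

  absorb-cong : {v w : Vec m} → v ≋ w → absorb v ≈ absorb w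
  absorb-cong {zero}  e = ~refl
  absorb-cong {suc m} e = refl⟩⨾⟨ refl⟩⨾⟨ ⊕-cong ((s-cong′ (e zero) ⟩⊕⟨refl) ⟩⨾⟨refl) (absorb-cong (e ∘ suc))

  -- The lemmas from here to `M₂-σ` describe how a generator commutes with `absorb` on the wires
  -- that it touches. They are the generator-specific input of `natural-from-split`.
  M-s : ∀ x y → M x ⨾ s y ≈ (I ⊕ s y) ⨾ M (x R.* y)
  M-s x y = begin
    ((s x ⊕ I) ⨾ μ∘) ⨾ s y            ≈⟨ assoc ⟩
    (s x ⊕ I) ⨾ (μ∘ ⨾ s y)            ≈⟨ refl⟩⨾⟨ ha (A13 y) ⟩
    (s x ⊕ I) ⨾ ((s y ⊕ s y) ⨾ μ∘)    ≈⟨ pull (~sym (⊕-⨾ _ _ _ _)) ⟩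
    ((s x ⨾ s y) ⊕ (I ⨾ s y)) ⨾ μ∘
      ≈⟨ ⊕-cong (~trans (ha (A12 x y)) (~sym idl₁)) (~trans idl₁ (~sym idr₁)) ⟩⨾⟨refl ⟩
    ((I ⨾ s (x R.* y)) ⊕ (s y ⨾ I)) ⨾ μ∘  ≈⟨ ⊕-⨾ _ _ _ _ ⟩⨾⟨refl ⟩
    ((I ⊕ s y) ⨾ (s (x R.* y) ⊕ I)) ⨾ μ∘  ≈⟨ assoc ⟩
    (I ⊕ s y) ⨾ M (x R.* y)           ∎

  M-ε : ∀ x → M x ⨾ ε• ≈ ε• ⊕ ε•
  M-ε x = begin
    ((s x ⊕ I) ⨾ μ∘) ⨾ ε•       ≈⟨ assoc ⟩
    (s x ⊕ I) ⨾ (μ∘ ⨾ ε•)       ≈⟨ refl⟩⨾⟨ ha A7 ⟩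
    (s x ⊕ I) ⨾ (ε• ⊕ ε•)       ≈⟨ ⊕-⨾ _ _ _ _ ⟨
    (s x ⨾ ε•) ⊕ (I ⨾ ε•)       ≈⟨ ⊕-cong (ha (A16 x)) idl₁ ⟩
    ε• ⊕ ε•                     ∎

  M-0 : M R.0# ≈ ε• ⊕ I
  M-0 = begin
    (s R.0# ⊕ I) ⨾ μ∘             ≈⟨ (ha A17 ⟩⊕⟨refl) ⟩⨾⟨refl ⟩
    ((ε• ⨾ η∘) ⊕ I) ⨾ μ∘          ≈⟨ push ⊕I-⨾ ⟩
    (ε• ⊕ I) ⨾ ((η∘ ⊕ I) ⨾ μ∘)    ≈⟨ refl⟩⨾⟨ ha A1 ⟩
    (ε• ⊕ I) ⨾ I                  ≈⟨ idr₁ ⟩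
    ε• ⊕ I                        ∎

  -- M₂ x y : (c, z, w) ↦ (x c + z, y c + w)
  M₂ : R.Carrier → R.Carrier → Term Sig 3 2
  M₂ x y = (Δ• ⊕ J 2) ⨾ ((I ⊕ (σ₁₁ ⊕ I)) ⨾ (M x ⊕ M y))

  -- Lets the scalars of `M x ⊕ M y` move back to the two copies of the control, leaving exactly the
  -- crossing and additions that occur in A8.
  middle-exchange : ∀ x y → ((s x ⊕ s y) ⊕ J 2) ⨾ (I ⊕ (σ₁₁ ⊕ I)) ≈ (I ⊕ (σ₁₁ ⊕ I)) ⨾ ((s x ⊕ I) ⊕ (s y ⊕ I))
  middle-exchange x y = begin
    ((s x ⊕ s y) ⊕ J 2) ⨾ (I ⊕ (σ₁₁ ⊕ I))
      ≈⟨ ~trans (⊕-assoc (s x) (s y) (J 2))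
             (refl⟩⊕⟨ ~trans (refl⟩⊕⟨ J₂≈) (~sym (⊕-assoc (s y) I I))) ⟩⨾⟨refl ⟩
    (s x ⊕ ((s y ⊕ I) ⊕ I)) ⨾ (I ⊕ (σ₁₁ ⊕ I))
      ≈⟨ ⊕-⨾ _ _ _ _ ⟨
    (s x ⨾ I) ⊕ (((s y ⊕ I) ⊕ I) ⨾ (σ₁₁ ⊕ I))
      ≈⟨ ⊕-cong (~trans idr₁ (~sym idl₁)) (~trans (~sym ⊕I-⨾) (~trans (σ-nat₁₁ ⟩⊕⟨refl) ⊕I-⨾)) ⟩
    (I ⨾ s x) ⊕ ((σ₁₁ ⊕ I) ⨾ ((I ⊕ s y) ⊕ I))
      ≈⟨ ⊕-⨾ _ _ _ _ ⟩
    (I ⊕ (σ₁₁ ⊕ I)) ⨾ (s x ⊕ ((I ⊕ s y) ⊕ I))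
      ≈⟨ refl⟩⨾⟨ ~trans (refl⟩⊕⟨ ⊕-assoc I (s y) I) (~sym (⊕-assoc (s x) I (s y ⊕ I))) ⟩
    (I ⊕ (σ₁₁ ⊕ I)) ⨾ ((s x ⊕ I) ⊕ (s y ⊕ I))
      ∎

  M-Δ : ∀ x → M x ⨾ Δ• ≈ (I ⊕ Δ•) ⨾ M₂ x x
  M-Δ x = begin
    ((s x ⊕ I) ⨾ μ∘) ⨾ Δ•
      ≈⟨ assoc ⟩
    (s x ⊕ I) ⨾ (μ∘ ⨾ Δ•)
      ≈⟨ refl⟩⨾⟨ ~trans (ha A8) assoc ⟩
    (s x ⊕ I) ⨾ ((Δ• ⊕ Δ•) ⨾ ((I ⊕ (σ₁₁ ⊕ I)) ⨾ (μ∘ ⊕ μ∘)))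
      ≈⟨ pull (~sym (⊕-⨾ _ _ _ _)) ⟩
    ((s x ⨾ Δ•) ⊕ (I ⨾ Δ•)) ⨾ ((I ⊕ (σ₁₁ ⊕ I)) ⨾ (μ∘ ⊕ μ∘))
      ≈⟨ ⊕-cong (ha (A15 x)) (~trans idl₁ (~sym idr)) ⟩⨾⟨refl ⟩
    ((Δ• ⨾ (s x ⊕ s x)) ⊕ (Δ• ⨾ J 2)) ⨾ ((I ⊕ (σ₁₁ ⊕ I)) ⨾ (μ∘ ⊕ μ∘))
      ≈⟨ push (⊕-⨾ _ _ _ _) ⟩
    (Δ• ⊕ Δ•) ⨾ (((s x ⊕ s x) ⊕ J 2) ⨾ ((I ⊕ (σ₁₁ ⊕ I)) ⨾ (μ∘ ⊕ μ∘)))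
      ≈⟨ refl⟩⨾⟨ swap₂ (middle-exchange x x) ⟩
    (Δ• ⊕ Δ•) ⨾ ((I ⊕ (σ₁₁ ⊕ I)) ⨾ (((s x ⊕ I) ⊕ (s x ⊕ I)) ⨾ (μ∘ ⊕ μ∘)))
      ≈⟨ refl⟩⨾⟨ refl⟩⨾⟨ ~sym (⊕-⨾ _ _ _ _) ⟩
    (Δ• ⊕ Δ•) ⨾ ((I ⊕ (σ₁₁ ⊕ I)) ⨾ (M x ⊕ M x))
      ≈⟨ push bottom-first ⟩
    (I ⊕ Δ•) ⨾ M₂ x x
      ∎

  -- Middle-four interchange for a commutative monoid: after flattening the sums by A3 the crossing
  -- exchanges two neighbouring summands, and A2 removes it.
  medial : (I ⊕ (σ₁₁ ⊕ I)) ⨾ ((μ∘ ⊕ μ∘) ⨾ μ∘) ≈ (μ∘ ⊕ μ∘) ⨾ μ∘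
  medial = begin
    (I ⊕ (σ₁₁ ⊕ I)) ⨾ ((μ∘ ⊕ μ∘) ⨾ μ∘)                ≈⟨ refl⟩⨾⟨ unnest ⟩
    (I ⊕ (σ₁₁ ⊕ I)) ⨾ ((I ⊕ ((I ⊕ μ∘) ⨾ μ∘)) ⨾ μ∘)    ≈⟨ pull (~sym I⊕-⨾) ⟩
    (I ⊕ ((σ₁₁ ⊕ I) ⨾ ((I ⊕ μ∘) ⨾ μ∘))) ⨾ μ∘          ≈⟨ (refl⟩⊕⟨ inner) ⟩⨾⟨refl ⟩
    (I ⊕ ((I ⊕ μ∘) ⨾ μ∘)) ⨾ μ∘                        ≈⟨ unnest ⟨
    (μ∘ ⊕ μ∘) ⨾ μ∘                                    ∎
    where
    unnest : (μ∘ ⊕ μ∘) ⨾ μ∘ ≈ (I ⊕ ((I ⊕ μ∘) ⨾ μ∘)) ⨾ μ∘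
    unnest = begin
      (μ∘ ⊕ μ∘) ⨾ μ∘                        ≈⟨ push bottom-first ⟩
      (I ⊕ (I ⊕ μ∘)) ⨾ ((μ∘ ⊕ J 1) ⨾ μ∘)    ≈⟨ refl⟩⨾⟨ ~trans (~sym ⊕I≈⊕J ⟩⨾⟨refl) (ha A3) ⟩
      (I ⊕ (I ⊕ μ∘)) ⨾ ((I ⊕ μ∘) ⨾ μ∘)      ≈⟨ pull (~sym I⊕-⨾) ⟩
      (I ⊕ ((I ⊕ μ∘) ⨾ μ∘)) ⨾ μ∘            ∎
    inner : (σ₁₁ ⊕ I) ⨾ ((I ⊕ μ∘) ⨾ μ∘) ≈ (I ⊕ μ∘) ⨾ μ∘
    inner = begin
      (σ₁₁ ⊕ I) ⨾ ((I ⊕ μ∘) ⨾ μ∘)    ≈⟨ refl⟩⨾⟨ ha A3 ⟨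
      (σ₁₁ ⊕ I) ⨾ ((μ∘ ⊕ I) ⨾ μ∘)    ≈⟨ pull (~trans (~sym ⊕I-⨾) (ha A2 ⟩⊕⟨refl)) ⟩
      (μ∘ ⊕ I) ⨾ μ∘                  ≈⟨ ha A3 ⟩
      (I ⊕ μ∘) ⨾ μ∘                  ∎

  M₂-μ : ∀ x y → M₂ x y ⨾ μ∘ ≈ (I ⊕ μ∘) ⨾ M (x R.+ y)
  M₂-μ x y = begin
    ((Δ• ⊕ J 2) ⨾ ((I ⊕ (σ₁₁ ⊕ I)) ⨾ (M x ⊕ M y))) ⨾ μ∘
      ≈⟨ ~trans assoc (refl⟩⨾⟨ assoc) ⟩
    (Δ• ⊕ J 2) ⨾ ((I ⊕ (σ₁₁ ⊕ I)) ⨾ ((M x ⊕ M y) ⨾ μ∘))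
      ≈⟨ refl⟩⨾⟨ refl⟩⨾⟨ push (⊕-⨾ _ _ _ _) ⟩
    (Δ• ⊕ J 2) ⨾ ((I ⊕ (σ₁₁ ⊕ I)) ⨾ (((s x ⊕ I) ⊕ (s y ⊕ I)) ⨾ ((μ∘ ⊕ μ∘) ⨾ μ∘)))
      ≈⟨ refl⟩⨾⟨ swap₂ (middle-exchange x y) ⟨
    (Δ• ⊕ J 2) ⨾ (((s x ⊕ s y) ⊕ J 2) ⨾ ((I ⊕ (σ₁₁ ⊕ I)) ⨾ ((μ∘ ⊕ μ∘) ⨾ μ∘)))
      ≈⟨ refl⟩⨾⟨ refl⟩⨾⟨ medial ⟩
    (Δ• ⊕ J 2) ⨾ (((s x ⊕ s y) ⊕ J 2) ⨾ ((μ∘ ⊕ μ∘) ⨾ μ∘))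
      ≈⟨ refl⟩⨾⟨ pull (~sym pre-⊕) ⟩
    (Δ• ⊕ J 2) ⨾ ((((s x ⊕ s y) ⨾ μ∘) ⊕ μ∘) ⨾ μ∘)
      ≈⟨ pull (~sym pre-⊕) ⟩
    ((Δ• ⨾ ((s x ⊕ s y) ⨾ μ∘)) ⊕ μ∘) ⨾ μ∘
      ≈⟨ (~trans (~sym assoc) (ha (A18 x y)) ⟩⊕⟨refl) ⟩⨾⟨refl ⟩
    (s (x R.+ y) ⊕ μ∘) ⨾ μ∘
      ≈⟨ push bottom-first ⟩
    (I ⊕ μ∘) ⨾ ((s (x R.+ y) ⊕ J 1) ⨾ μ∘)
      ≈⟨ refl⟩⨾⟨ ~sym ⊕I≈⊕J ⟩⨾⟨refl ⟩
    (I ⊕ μ∘) ⨾ M (x R.+ y)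
      ∎

  -- The crossing of two pairs is a middle crossing, two small swaps and another middle crossing.
  -- The first cancels against the crossing inside `M₂`, the last one rebuilds `M₂ y x`, and the
  -- swap of the two control copies disappears by A5.
  M₂-σ : ∀ x y → M₂ x y ⨾ σ₁₁ ≈ (I ⊕ σ₁₁) ⨾ M₂ y x
  M₂-σ x y = begin
    ((Δ• ⊕ J 2) ⨾ ((I ⊕ (σ₁₁ ⊕ I)) ⨾ (M x ⊕ M y))) ⨾ σ₁₁
      ≈⟨ ~trans assoc (refl⟩⨾⟨ assoc) ⟩
    (Δ• ⊕ J 2) ⨾ ((I ⊕ (σ₁₁ ⊕ I)) ⨾ ((M x ⊕ M y) ⨾ σ₁₁))
      ≈⟨ refl⟩⨾⟨ refl⟩⨾⟨ ~trans (refl⟩⨾⟨ ~sym σ₁₁≈) (~trans (σ-natural (M x) (M y)) (push σ₂₂)) ⟩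
    (Δ• ⊕ J 2) ⨾ ((I ⊕ (σ₁₁ ⊕ I)) ⨾ ((I ⊕ (σ₁₁ ⊕ I)) ⨾ (((σ₁₁ ⊕ σ₁₁) ⨾ (I ⊕ (σ₁₁ ⊕ I))) ⨾ (M y ⊕ M x))))
      ≈⟨ refl⟩⨾⟨ ~trans (pull involution) idl ⟩
    (Δ• ⊕ J 2) ⨾ (((σ₁₁ ⊕ σ₁₁) ⨾ (I ⊕ (σ₁₁ ⊕ I))) ⨾ (M y ⊕ M x))
      ≈⟨ refl⟩⨾⟨ assoc ⟩
    (Δ• ⊕ J 2) ⨾ ((σ₁₁ ⊕ σ₁₁) ⨾ ((I ⊕ (σ₁₁ ⊕ I)) ⨾ (M y ⊕ M x)))
      ≈⟨ swap₂ (~trans (~sym (⊕-⨾ _ _ _ _)) (~trans (⊕-cong (ha A5) idl) bottom-first)) ⟩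
    (I ⊕ σ₁₁) ⨾ M₂ y x
      ∎
    where
    involution : (I ⊕ (σ₁₁ ⊕ I)) ⨾ (I ⊕ (σ₁₁ ⊕ I)) ≈ J 4
    involution = begin
      (I ⊕ (σ₁₁ ⊕ I)) ⨾ (I ⊕ (σ₁₁ ⊕ I))   ≈⟨ I⊕-⨾ ⟨
      I ⊕ ((σ₁₁ ⊕ I) ⨾ (σ₁₁ ⊕ I))         ≈⟨ refl⟩⊕⟨ ~trans (~sym ⊕I-⨾) (σ² ⟩⊕⟨refl) ⟩
      I ⊕ ((I ⊕ I) ⊕ I)                   ≈⟨ refl⟩⊕⟨ ~trans (⊕-assoc I I I) (refl⟩⊕⟨ ~sym J₂≈) ⟩
      J 4                                 ∎
    σ₂₂ : σₜ 2 2 ≈ (I ⊕ (σ₁₁ ⊕ I)) ⨾ ((σ₁₁ ⊕ σ₁₁) ⨾ (I ⊕ (σ₁₁ ⊕ I)))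
    σ₂₂ = begin
      (I ⊕ σₜ 1 2) ⨾ (((σ₁₁ ⊕ J 1) ⨾ (I ⊕ σ₁ 1)) ⊕ J 1)
        ≈⟨ ⨾-cong (refl⟩⊕⟨ σ₁₂≈) (~trans (refl⟩⊕⟨ J₁≈I) ⊕I-⨾) ⟩
      (I ⊕ ((σ₁₁ ⊕ I) ⨾ (I ⊕ σ₁₁))) ⨾ (((σ₁₁ ⊕ J 1) ⊕ I) ⨾ ((I ⊕ σ₁ 1) ⊕ I))
        ≈⟨ push I⊕-⨾ ⟩
      (I ⊕ (σ₁₁ ⊕ I)) ⨾ ((I ⊕ (I ⊕ σ₁₁)) ⨾ (((σ₁₁ ⊕ J 1) ⊕ I) ⨾ ((I ⊕ σ₁ 1) ⊕ I)))
        ≈⟨ refl⟩⨾⟨ pull (~trans (refl⟩⨾⟨ ~trans (⊕-assoc σ₁₁ (J 1) I)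
               (refl⟩⊕⟨ ~trans (J₁≈I ⟩⊕⟨refl) (~sym J₂≈))) (~sym bottom-first)) ⟩
      (I ⊕ (σ₁₁ ⊕ I)) ⨾ ((σ₁₁ ⊕ σ₁₁) ⨾ ((I ⊕ σ₁ 1) ⊕ I))
        ≈⟨ refl⟩⨾⟨ refl⟩⨾⟨ ~trans (⊕-assoc I (σ₁ 1) I) (refl⟩⊕⟨ σ₁-1≈ ⟩⊕⟨refl) ⟩
      (I ⊕ (σ₁₁ ⊕ I)) ⨾ ((σ₁₁ ⊕ σ₁₁) ⨾ (I ⊕ (σ₁₁ ⊕ I)))
        ∎

  -- Splitting `absorb` after the first wires

  -- The control crosses `p` data wires and the other `k` stay in place. The transport disappears
  -- for the values 0, 1 and 2 of `p` at which it is used, these being the arities and coarities of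
  -- the generators.
  Z : ∀ p k → Term Sig (suc (p + k)) (p + suc k)
  Z p k = subst (Term Sig (suc (p + k))) (+-assoc p 1 k) (σₜ 1 p ⊕ J k)

  -- The control wire is copied; the second copy crosses the first p data wires.
  spread : Term Sig (suc (p + k)) (p + suc k) → Term Sig (suc (p + k)) (suc (p + suc k))
  spread {p} {k} z = (Δ• ⊕ J (p + k)) ⨾ (I ⊕ z)

  absorb-split₀ : (v : Vec k) → absorb v ≈ spread {0} (Z 0 k) ⨾ (ε• ⊕ absorb v)
  absorb-split₀ {k} v = ~sym (begin
    ((Δ• ⊕ J k) ⨾ (I ⊕ (σₜ 1 0 ⊕ J k))) ⨾ (ε• ⊕ absorb v)
      ≈⟨ ~trans (refl⟩⨾⟨ refl⟩⊕⟨ ~trans (~trans σ₁₀≈ (~sym J₁≈I) ⟩⊕⟨refl) (⊕-id 1 k)) idr ⟩⨾⟨refl ⟩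
    (Δ• ⊕ J k) ⨾ (ε• ⊕ absorb v)
      ≈⟨ refl⟩⨾⟨ ~trans top-first ((refl⟩⊕⟨ ~sym (⊕-id 1 k)) ⟩⨾⟨refl) ⟩
    (Δ• ⊕ J k) ⨾ ((ε• ⊕ (J 1 ⊕ J k)) ⨾ absorb v)
      ≈⟨ refl⟩⨾⟨ ~trans (refl⟩⊕⟨ J₁≈I ⟩⊕⟨refl) (~sym (⊕-assoc ε• I (J k))) ⟩⨾⟨refl ⟩
    (Δ• ⊕ J k) ⨾ (((ε• ⊕ I) ⊕ J k) ⨾ absorb v)
      ≈⟨ pull (~trans (~sym ⊕J-⨾) (ha A4 ⟩⊕⟨refl)) ⟩
    J (suc k) ⨾ absorb v
      ≈⟨ idl ⟩
    absorb v ∎)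

  absorb-split₁ : (v : Vec (1 + k)) → absorb v ≈ spread {1} (Z 1 k) ⨾ (M (head v) ⊕ absorb (tail v))
  absorb-split₁ v = ~trans (~sym assoc) ((refl⟩⨾⟨ refl⟩⊕⟨ ~sym σ₁₁≈ ⟩⊕⟨refl) ⟩⨾⟨refl)

  -- Unfolding `absorb` twice copies the control for the first entry, and then copies the remainder
  -- for the second. Coassociativity regroups the copies so that the first two entries share one and
  -- the tail gets the other.
  absorb-split₂ : (v : Vec (2 + k)) →
    absorb v ≈ spread {2} (Z 2 k) ⨾ (M₂ (head v) (head (tail v)) ⊕ absorb (tail (tail v)))
  absorb-split₂ {k} v = begin
    D ⨾ ((I ⊕ (σ₁₁ ⊕ J (1 + k))) ⨾ (Mx ⊕ ((Δ• ⊕ J (1 + k)) ⨾ ((I ⊕ (σ₁₁ ⊕ J k)) ⨾ (My ⊕ rest)))))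
      ≈⟨ refl⟩⨾⟨ refl⟩⨾⟨ ~trans ⊕-pre (refl⟩⨾⟨ ⊕-pre) ⟩
    D ⨾ ((I ⊕ (σ₁₁ ⊕ J (1 + k))) ⨾ ((I ⊕ (I ⊕ (Δ• ⊕ J (1 + k)))) ⨾ (S₃ ⨾ N)))
      -- The second copying is pulled in front of the first crossing, which becomes a crossing of
      -- both copies.
      ≈⟨ refl⟩⨾⟨ pull (~trans (~sym I⊕-⨾) (~trans (refl⟩⊕⟨ cross) (~trans I⊕-⨾ (refl⟩⨾⟨ I⊕-⨾)))) ⟩
    D ⨾ (((I ⊕ D) ⨾ (S₂ ⨾ S₁)) ⨾ (S₃ ⨾ N))
      ≈⟨ refl⟩⨾⟨ ~trans assoc (refl⟩⨾⟨ ~trans assoc (refl⟩⨾⟨ swap₂ far)) ⟩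
    D ⨾ ((I ⊕ D) ⨾ (S₂ ⨾ (S₃ ⨾ (S₁ ⨾ N))))
      ≈⟨ refl⟩⨾⟨ refl⟩⨾⟨ pull (~trans (~sym I⊕-⨾) (refl⟩⊕⟨ ~trans (~sym I⊕-⨾) (refl⟩⊕⟨ σ-pair))) ⟩
    D ⨾ ((I ⊕ D) ⨾ (W 2 (Z 2 k) ⨾ (S₁ ⨾ N)))
      -- The second copying now acts on the upper output of the first, so the control of the tail
      -- can leave past both data wires.
      ≈⟨ swap₂ coassoc ⟩
    D ⨾ ((Δ• ⊕ J (3 + k)) ⨾ (W 2 (Z 2 k) ⨾ (S₁ ⨾ N)))
      ≈⟨ refl⟩⨾⟨ swap₂ slide ⟩
    D ⨾ ((I ⊕ Z 2 k) ⨾ ((Δ• ⊕ J (3 + k)) ⨾ (S₁ ⨾ N)))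
      ≈⟨ refl⟩⨾⟨ refl⟩⨾⟨ ⨾-cong (~trans (refl⟩⊕⟨ ~sym (⊕-id 2 (1 + k))) (~sym (⊕-assoc Δ• (J 2) (J (1 + k)))))
           (⨾-cong (~trans (refl⟩⊕⟨ ~sym (⊕-assoc σ₁₁ I (J (1 + k)))) (~sym (⊕-assoc I (σ₁₁ ⊕ I) (J (1 + k)))))
             (~sym (⊕-assoc Mx My rest))) ⟩
    D ⨾ ((I ⊕ Z 2 k) ⨾ (((Δ• ⊕ J 2) ⊕ J (1 + k)) ⨾ (((I ⊕ (σ₁₁ ⊕ I)) ⊕ J (1 + k)) ⨾ ((Mx ⊕ My) ⊕ rest))))
      ≈⟨ refl⟩⨾⟨ refl⟩⨾⟨ ~trans (refl⟩⨾⟨ ~sym pre-⊕) (~sym pre-⊕) ⟩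
    D ⨾ ((I ⊕ Z 2 k) ⨾ (M₂ x y ⊕ rest))
      ≈⟨ ~sym assoc ⟩
    spread {2} (Z 2 k) ⨾ (M₂ x y ⊕ rest)
      ∎
    where
    x = head v
    y = head (tail v)
    Mx = M x
    My = M y
    rest = absorb (tail (tail v))
    N = Mx ⊕ (My ⊕ rest)
    D = Δ• ⊕ J (2 + k)
    S₁ = I ⊕ (σ₁₁ ⊕ J (2 + k))
    S₂ = W 2 (σ₁₁ ⊕ J (1 + k))
    S₃ = W 3 (σ₁₁ ⊕ J k)
    cross : (σ₁₁ ⊕ J (1 + k)) ⨾ (I ⊕ (Δ• ⊕ J (1 + k)))
              ≈ (Δ• ⊕ J (2 + k)) ⨾ ((I ⊕ (σ₁₁ ⊕ J (1 + k))) ⨾ (σ₁₁ ⊕ J (2 + k)))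
    cross = begin
      (σ₁₁ ⊕ J (1 + k)) ⨾ (I ⊕ (Δ• ⊕ J (1 + k)))
        ≈⟨ ⨾-cong (~sym σ₁₁≈ ⟩⊕⟨refl) (~sym (⊕-assoc I Δ• (J (1 + k)))) ⟩
      (σₜ 1 1 ⊕ J (1 + k)) ⨾ ((I ⊕ Δ•) ⊕ J (1 + k))
        ≈⟨ ~trans (~sym ⊕J-⨾) (~trans (~sym (σ-natural Δ• I) ⟩⊕⟨refl) ⊕J-⨾) ⟩
      ((Δ• ⊕ I) ⊕ J (1 + k)) ⨾ (σₜ 2 1 ⊕ J (1 + k))
        ≈⟨ ⨾-cong (⊕-assoc Δ• I (J (1 + k))) (~trans (σ₂₁≈ ⟩⊕⟨refl) ⊕J-⨾) ⟩
      (Δ• ⊕ J (2 + k)) ⨾ (((I ⊕ σ₁₁) ⊕ J (1 + k)) ⨾ ((σ₁₁ ⊕ I) ⊕ J (1 + k)))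
        ≈⟨ refl⟩⨾⟨ ⨾-cong (⊕-assoc I σ₁₁ (J (1 + k))) (⊕-assoc σ₁₁ I (J (1 + k))) ⟩
      (Δ• ⊕ J (2 + k)) ⨾ ((I ⊕ (σ₁₁ ⊕ J (1 + k))) ⨾ (σ₁₁ ⊕ J (2 + k)))
        ∎
    far : (I ⊕ (σ₁₁ ⊕ J (2 + k))) ⨾ W 3 (σ₁₁ ⊕ J k) ≈ W 3 (σ₁₁ ⊕ J k) ⨾ (I ⊕ (σ₁₁ ⊕ J (2 + k)))
    far = ~trans (~sym I⊕-⨾) (~trans (refl⟩⊕⟨ slide) I⊕-⨾)
    σ-pair : (σ₁₁ ⊕ J (1 + k)) ⨾ (I ⊕ (σ₁₁ ⊕ J k)) ≈ Z 2 k
    σ-pair = begin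
      (σ₁₁ ⊕ J (1 + k)) ⨾ (I ⊕ (σ₁₁ ⊕ J k))       ≈⟨ ⨾-cong (⊕-assoc σ₁₁ I (J k)) (⊕-assoc I σ₁₁ (J k)) ⟨
      ((σ₁₁ ⊕ I) ⊕ J k) ⨾ ((I ⊕ σ₁₁) ⊕ J k)       ≈⟨ ⊕J-⨾ ⟨
      ((σ₁₁ ⊕ I) ⨾ (I ⊕ σ₁₁)) ⊕ J k               ≈⟨ σ₁₂≈ ⟩⊕⟨refl ⟨
      Z 2 k                                       ∎
    coassoc : (Δ• ⊕ J (2 + k)) ⨾ (I ⊕ (Δ• ⊕ J (2 + k))) ≈ (Δ• ⊕ J (2 + k)) ⨾ (Δ• ⊕ J (3 + k))
    coassoc = begin
      (Δ• ⊕ J (2 + k)) ⨾ (I ⊕ (Δ• ⊕ J (2 + k)))    ≈⟨ refl⟩⨾⟨ ⊕-assoc I Δ• (J (2 + k)) ⟨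
      (Δ• ⊕ J (2 + k)) ⨾ ((I ⊕ Δ•) ⊕ J (2 + k))    ≈⟨ ⊕J-⨾ ⟨
      (Δ• ⨾ (I ⊕ Δ•)) ⊕ J (2 + k)                  ≈⟨ ha A6 ⟩⊕⟨refl ⟨
      (Δ• ⨾ (Δ• ⊕ I)) ⊕ J (2 + k)                  ≈⟨ ⊕J-⨾ ⟩
      (Δ• ⊕ J (2 + k)) ⨾ ((Δ• ⊕ I) ⊕ J (2 + k))    ≈⟨ refl⟩⨾⟨ ⊕-assoc Δ• I (J (2 + k)) ⟩
      (Δ• ⊕ J (2 + k)) ⨾ (Δ• ⊕ J (3 + k))          ∎

  -- Since `f` leaves the lower `k` entries alone, both vectors have the same remainder `w`. What is
  -- left is `h₃`, on the wires of `f` only, and `h₄`, which in each use is naturality of the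
  -- symmetry.
  natural-from-split :
    (f : Term Sig p q) (v : Vec (p + k)) (v′ : Vec (q + k)) {w : Vec k}
    {zp : Term Sig (suc (p + k)) (p + suc k)} {zq : Term Sig (suc (q + k)) (q + suc k)}
    {np : Term Sig (suc p) p} {nq : Term Sig (suc q) q} →
    absorb v ≈ spread {p} zp ⨾ (np ⊕ absorb w) →
    absorb v′ ≈ spread {q} zq ⨾ (nq ⊕ absorb w) →
    np ⨾ f ≈ (I ⊕ f) ⨾ nq →
    zp ⨾ (f ⊕ J (suc k)) ≈ (I ⊕ (f ⊕ J k)) ⨾ zq →
    absorb v ⨾ (f ⊕ J k) ≈ (I ⊕ (f ⊕ J k)) ⨾ absorb v′
  natural-from-split {p} {q} {k} f v v′ {w} {zp} {zq} {np} {nq} h₁ h₂ h₃ h₄ = begin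
    absorb v ⨾ (f ⊕ J k)
      ≈⟨ push h₁ ⟩
    spread {p} zp ⨾ ((np ⊕ absorb w) ⨾ (f ⊕ J k))
      ≈⟨ refl⟩⨾⟨ ~trans (~sym post-⊕) (~trans (h₃ ⟩⊕⟨refl) pre-⊕) ⟩
    spread {p} zp ⨾ (((I ⊕ f) ⊕ J (suc k)) ⨾ (nq ⊕ absorb w))
      ≈⟨ assoc ⟩
    (Δ• ⊕ J (p + k)) ⨾ ((I ⊕ zp) ⨾ (((I ⊕ f) ⊕ J (suc k)) ⨾ (nq ⊕ absorb w)))
      ≈⟨ refl⟩⨾⟨ pull (~trans (refl⟩⨾⟨ ⊕-assoc I f (J (suc k)))
           (~trans (~sym I⊕-⨾) (~trans (refl⟩⊕⟨ h₄) I⊕-⨾))) ⟩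
    (Δ• ⊕ J (p + k)) ⨾ (((I ⊕ (I ⊕ (f ⊕ J k))) ⨾ (I ⊕ zq)) ⨾ (nq ⊕ absorb w))
      ≈⟨ refl⟩⨾⟨ assoc ⟩
    (Δ• ⊕ J (p + k)) ⨾ ((I ⊕ (I ⊕ (f ⊕ J k))) ⨾ ((I ⊕ zq) ⨾ (nq ⊕ absorb w)))
      ≈⟨ swap₂ slide ⟩
    (I ⊕ (f ⊕ J k)) ⨾ ((Δ• ⊕ J (q + k)) ⨾ ((I ⊕ zq) ⨾ (nq ⊕ absorb w)))
      ≈⟨ refl⟩⨾⟨ ~trans (~sym assoc) (~sym h₂) ⟩
    (I ⊕ (f ⊕ J k)) ⨾ absorb v′
      ∎

  -- Linear diagrams

  zeros : ∀ n → Term Sig 0 n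
  zeros zero    = id₀
  zeros (suc n) = η∘ ⊕ zeros n

  -- Linearity in diagrammatic form: adding c v before f is adding c times action v after it.
  record Linear (f : Term Sig n m) : Set (c ⊔ ℓ) where
    field
      action  : Vec n → Vec m
      zero-ax : zeros n ⨾ f ≈ zeros m
      natural : ∀ v → absorb v ⨾ f ≈ (I ⊕ f) ⨾ absorb (action v)
  open Linear

  Linear-resp : {f g : Term Sig n m} → f ≈ g → Linear f → Linear g
  Linear-resp p l = record
    { action  = action l
    ; zero-ax = ~trans (refl⟩⨾⟨ ~sym p) (zero-ax l)
    ; natural = λ v → ~trans (refl⟩⨾⟨ ~sym p) (~trans (natural l v) ((refl⟩⊕⟨ p) ⟩⨾⟨refl))
    }

  Linear-⨾ : {f : Term Sig n m} {g : Term Sig m k} → Linear f → Linear g → Linear (f ⨾ g)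
  Linear-⨾ l l′ = record
    { action  = action l′ ∘ action l
    ; zero-ax = ~trans (pull (zero-ax l)) (zero-ax l′)
    ; natural = λ v → ~trans (pull (natural l v)) (~trans assoc
                        (~trans (refl⟩⨾⟨ natural l′ (action l v)) (pull (~sym I⊕-⨾))))
    }

  Linear-J : ∀ n → Linear (J n)
  Linear-J n = record
    { action = λ v → v ; zero-ax = idr ; natural = λ v → ~trans idr (~sym idl) }

  Linear-under : {f : Term Sig n m} → Linear f → Linear (I ⊕ f)
  Linear-under {n} {m} {f} l = record
    { action  = λ v → head v ∷ᵥ action l (tail v)
    ; zero-ax = ~trans (~sym ⊕-post) (refl⟩⊕⟨ zero-ax l)
    ; natural = λ v → begin
        ((Δ• ⊕ J (suc n)) ⨾ ((I ⊕ (σ₁₁ ⊕ J n)) ⨾ (M (head v) ⊕ absorb (tail v)))) ⨾ (I ⊕ f)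
          ≈⟨ ~trans assoc (refl⟩⨾⟨ assoc) ⟩
        (Δ• ⊕ J (suc n)) ⨾ ((I ⊕ (σ₁₁ ⊕ J n)) ⨾ ((M (head v) ⊕ absorb (tail v)) ⨾ (I ⊕ f)))
          ≈⟨ refl⟩⨾⟨ refl⟩⨾⟨ ~trans (~sym ⊕-post) (~trans (refl⟩⊕⟨ natural l (tail v)) ⊕-pre) ⟩
        (Δ• ⊕ J (suc n)) ⨾ ((I ⊕ (σ₁₁ ⊕ J n)) ⨾ (W 3 f ⨾ (M (head v) ⊕ absorb (action l (tail v)))))
          ≈⟨ refl⟩⨾⟨ swap₂ (~trans (~sym I⊕-⨾) (~trans (refl⟩⊕⟨ slide) I⊕-⨾)) ⟩
        (Δ• ⊕ J (suc n)) ⨾ (W 3 f ⨾ ((I ⊕ (σ₁₁ ⊕ J m)) ⨾ (M (head v) ⊕ absorb (action l (tail v)))))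
          ≈⟨ swap₂ slide ⟩
        W 2 f ⨾ ((Δ• ⊕ J (suc m)) ⨾ ((I ⊕ (σ₁₁ ⊕ J m)) ⨾ (M (head v) ⊕ absorb (action l (tail v)))))
          ∎
    }

  Linear-W : ∀ j {f : Term Sig n m} → Linear f → Linear (W j f)
  Linear-W zero    l = l
  Linear-W (suc j) l = Linear-under (Linear-W j l)

  -- With the spare wires included from the start, `absorb` has to be split only after the at most
  -- two wires of the generator, and never at a variable position.
  Linear-gen : ∀ k (g : HAGen R n m) → Linear (gen₁ g ⊕ J k)
  Linear-gen k Δ = record
    { action  = action′
    ; zero-ax = ~trans (~sym (⊕-⨾ _ _ _ _)) (~trans (⊕-cong (ha A9) idr) (⊕-assoc η∘ η∘ (zeros k)))
    ; natural = λ v → natural-from-split Δ• v (action′ v) (absorb-split₁ v) (absorb-split₂ (action′ v))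
        (M-Δ _) exchange
    }
    where
    action′ : Vec (1 + k) → Vec (2 + k)
    action′ v = head v ∷ᵥ v
    exchange : Z 1 k ⨾ (Δ• ⊕ J (suc k)) ≈ (I ⊕ (Δ• ⊕ J k)) ⨾ Z 2 k
    exchange = ~trans (refl⟩⨾⟨ ~sym (⊕-assoc Δ• I (J k))) (~trans (~sym ⊕J-⨾)
      (~trans (~sym (σ-natural I Δ•) ⟩⊕⟨refl) (~trans ⊕J-⨾ (⊕-assoc I Δ• (J k) ⟩⨾⟨refl))))
  Linear-gen k ε = record
    { action  = action′
    ; zero-ax = ~trans (~sym (⊕-⨾ _ _ _ _)) (~trans (⊕-cong (ha A10) idr) (⊕-identityˡ (zeros k)))
    ; natural = λ v → natural-from-split ε• v (action′ v) (absorb-split₁ v) (absorb-split₀ (action′ v))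
        (~trans (M-ε _) (~trans bottom-first (refl⟩⨾⟨ ⊕-identityʳ ε•))) exchange
    }
    where
    action′ : Vec (1 + k) → Vec (0 + k)
    action′ v = tail v
    exchange : Z 1 k ⨾ (ε• ⊕ J (suc k)) ≈ (I ⊕ (ε• ⊕ J k)) ⨾ Z 0 k
    exchange = ~trans (refl⟩⨾⟨ ~sym (⊕-assoc ε• I (J k))) (~trans (~sym ⊕J-⨾)
      (~trans (~sym (σ-natural I ε•) ⟩⊕⟨refl) (~trans ⊕J-⨾ (⊕-assoc I ε• (J k) ⟩⨾⟨refl))))
  Linear-gen k μ = record
    { action  = action′
    ; zero-ax = ~trans (~sym (⊕-assoc η∘ η∘ (zeros k)) ⟩⨾⟨refl)
        (~trans (~sym (⊕-⨾ _ _ _ _)) (⊕-cong η-μ idr))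
    ; natural = λ v → natural-from-split μ∘ v (action′ v) (absorb-split₂ v) (absorb-split₁ (action′ v))
        (M₂-μ _ _) exchange
    }
    where
    action′ : Vec (2 + k) → Vec (1 + k)
    action′ v = (head v R.+ head (tail v)) ∷ᵥ tail (tail v)
    η-μ : (η∘ ⊕ η∘) ⨾ μ∘ ≈ η∘
    η-μ = ~trans (push bottom-first) (~trans (refl⟩⨾⟨ ~trans (~sym ⊕I≈⊕J ⟩⨾⟨refl) (ha A1)) idr₁)
    exchange : Z 2 k ⨾ (μ∘ ⊕ J (suc k)) ≈ (I ⊕ (μ∘ ⊕ J k)) ⨾ Z 1 k
    exchange = ~trans (refl⟩⨾⟨ ~sym (⊕-assoc μ∘ I (J k))) (~trans (~sym ⊕J-⨾)
      (~trans (~sym (σ-natural I μ∘) ⟩⊕⟨refl) (~trans ⊕J-⨾ (⊕-assoc I μ∘ (J k) ⟩⨾⟨refl))))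
  Linear-gen k η = record
    { action  = action′
    ; zero-ax = ~sym bottom-first
    ; natural = λ v → natural-from-split η∘ v (action′ v) (absorb-split₀ v) (absorb-split₁ (action′ v))
        (~trans (~sym (⊕-identityʳ ε•) ⟩⨾⟨refl)
          (~trans slide (refl⟩⨾⟨ ~trans (~sym ⊕I≈⊕J) (~sym M-0)))) exchange
    }
    where
    action′ : Vec (0 + k) → Vec (1 + k)
    action′ v = R.0# ∷ᵥ v
    exchange : Z 0 k ⨾ (η∘ ⊕ J (suc k)) ≈ (I ⊕ (η∘ ⊕ J k)) ⨾ Z 1 k
    exchange = ~trans (refl⟩⨾⟨ ~sym (⊕-assoc η∘ I (J k))) (~trans (~sym ⊕J-⨾)
      (~trans (~sym (σ-natural I η∘) ⟩⊕⟨refl) (~trans ⊕J-⨾ (⊕-assoc I η∘ (J k) ⟩⨾⟨refl))))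
  Linear-gen k (scale x) = record
    { action  = action′
    ; zero-ax = ~trans (~sym (⊕-⨾ _ _ _ _)) (⊕-cong (ha (A14 x)) idr)
    ; natural = λ v → natural-from-split (s x) v (action′ v) (absorb-split₁ v) (absorb-split₁ (action′ v))
        (M-s _ x) exchange
    }
    where
    action′ : Vec (1 + k) → Vec (1 + k)
    action′ v = (head v R.* x) ∷ᵥ tail v
    exchange : Z 1 k ⨾ (s x ⊕ J (suc k)) ≈ (I ⊕ (s x ⊕ J k)) ⨾ Z 1 k
    exchange = ~trans (refl⟩⨾⟨ ~sym (⊕-assoc (s x) I (J k))) (~trans (~sym ⊕J-⨾)
      (~trans (~sym (σ-natural I (s x)) ⟩⊕⟨refl) (~trans ⊕J-⨾ (⊕-assoc I (s x) (J k) ⟩⨾⟨refl))))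

  Linear-σ : ∀ k → Linear (σ₁₁ ⊕ J k)
  Linear-σ k = record
    { action  = action′
    ; zero-ax = ~trans (~sym (⊕-assoc η∘ η∘ (zeros k)) ⟩⨾⟨refl)
        (~trans (~sym (⊕-⨾ _ _ _ _)) (~trans (⊕-cong η-σ idr) (⊕-assoc η∘ η∘ (zeros k))))
    ; natural = λ v → natural-from-split σ₁₁ v (action′ v) (absorb-split₂ v) (absorb-split₂ (action′ v))
        (M₂-σ _ _) exchange
    }
    where
    action′ : Vec (2 + k) → Vec (2 + k)
    action′ v = head (tail v) ∷ᵥ (head v ∷ᵥ tail (tail v))
    η-σ : (η∘ ⊕ η∘) ⨾ σ₁₁ ≈ η∘ ⊕ η∘
    η-σ = ~trans (refl⟩⨾⟨ ~sym σ₁₁≈) (~trans (σ-natural η∘ η∘) idl)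
    exchange : Z 2 k ⨾ (σ₁₁ ⊕ J (suc k)) ≈ (I ⊕ (σ₁₁ ⊕ J k)) ⨾ Z 2 k
    exchange = ~trans (refl⟩⨾⟨ ~sym (⊕-assoc σ₁₁ I (J k))) (~trans (~sym ⊕J-⨾)
      (~trans (~sym (σ-natural I σ₁₁) ⟩⊕⟨refl) (~trans ⊕J-⨾ (⊕-assoc I σ₁₁ (J k) ⟩⨾⟨refl))))

  -- t acts beside n + k wires and u below b wires, so associativity has to be used only here.
  tensor-closed : ∀ {r} (Q : ∀ {n m} → Term Sig n m → Set r) →
    (∀ {n m} {f g : Term Sig n m} → f ≈ g → Q f → Q g) →
    (∀ {n m k} {f : Term Sig n m} {g : Term Sig m k} → Q f → Q g → Q (f ⨾ g)) →
    (t : Term Sig a b) (u : Term Sig n m) → Q (t ⊕ J (n + k)) → Q (W b (u ⊕ J k)) → Q ((t ⊕ u) ⊕ J k)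
  tensor-closed {a} {b} {n} {m} {k} Q resp comp t u q₁ q₂ =
    unsubst (+-assoc a n k) (+-assoc b m k)
      (resp (~sym (~trans (⊕-assoc t u (J k)) top-first)) (comp q₁ q₂))
    where
    unsubst : ∀ {n n′ m m′} (p : n ≡ n′) (q : m ≡ m′) {f : Term Sig n m} → Q (subst₂ (Term Sig) p q f) → Q f
    unsubst ≡.refl ≡.refl h = h

  -- Singles out the terms over the full signature that avoid the generators of the opposite
  -- summand. As a derivation it also supports the functional semantics `mapOf`, defined by
  -- recursion on it.
  data IsMap : Term Sig n m → Set c where
    gen : (g : HAGen R n m) → IsMap (gen₁ g)
    id₀ : IsMap id₀
    id₁ : IsMap id₁
    σ₁₁ : IsMap σ₁₁
    _⨾_ : {t : Term Sig n m} {u : Term Sig m k} → IsMap t → IsMap u → IsMap (t ⨾ u)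
    _⊕_ : {t : Term Sig n m} {u : Term Sig a b} → IsMap t → IsMap u → IsMap (t ⊕ u)

  IsMap⇒Linear⊕J : {t : Term Sig n m} → IsMap t → ∀ k → Linear (t ⊕ J k)
  IsMap⇒Linear⊕J (gen g) k = Linear-gen k g
  IsMap⇒Linear⊕J id₀     k = Linear-resp (~sym (⊕-identityˡ (J k))) (Linear-J k)
  IsMap⇒Linear⊕J id₁     k = Linear-J (suc k)
  IsMap⇒Linear⊕J σ₁₁     k = Linear-σ k
  IsMap⇒Linear⊕J (f ⨾ g) k = Linear-resp (~sym ⊕J-⨾) (Linear-⨾ (IsMap⇒Linear⊕J f k) (IsMap⇒Linear⊕J g k))
  IsMap⇒Linear⊕J (_⊕_ {n = n} {m = m} {a = a} {t = t} {u} f g) k =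
    tensor-closed Linear Linear-resp Linear-⨾ t u
      (IsMap⇒Linear⊕J f (a + k)) (Linear-W m (IsMap⇒Linear⊕J g k))

  IsMap⇒Linear : {t : Term Sig n m} → IsMap t → Linear t
  IsMap⇒Linear {n} {m} {t} f =
    Linear-resp (⊕-identityʳ t) (cast (+-identityʳ n) (+-identityʳ m) (IsMap⇒Linear⊕J f 0))
    where
    cast : ∀ {n n′ m m′} (p : n ≡ n′) (q : m ≡ m′) {f : Term Sig n m} →
           Linear f → Linear (subst₂ (Term Sig) p q f)
    cast ≡.refl ≡.refl l = l

  -- Matrix form of linear diagrams

  absorb-0 : ∀ m → absorb {m} (λ _ → R.0#) ≈ ε• ⊕ J m
  absorb-0 zero    = ~sym (⊕-identityʳ ε•)
  absorb-0 (suc m) = begin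
    (Δ• ⊕ J (suc m)) ⨾ ((I ⊕ (σ₁₁ ⊕ J m)) ⨾ (M R.0# ⊕ absorb (λ _ → R.0#)))
      ≈⟨ refl⟩⨾⟨ refl⟩⨾⟨ ~trans (⊕-cong M-0 (absorb-0 m)) (~trans (⊕-assoc ε• I _) bottom-first) ⟩
    (Δ• ⊕ J (suc m)) ⨾ ((I ⊕ (σ₁₁ ⊕ J m)) ⨾ ((I ⊕ (I ⊕ (ε• ⊕ J m))) ⨾ (ε• ⊕ J (suc m))))
      ≈⟨ refl⟩⨾⟨ pull (~trans (~sym I⊕-⨾) (refl⟩⊕⟨ cross)) ⟩
    (Δ• ⊕ J (suc m)) ⨾ ((I ⊕ (ε• ⊕ J (suc m))) ⨾ (ε• ⊕ J (suc m)))
      ≈⟨ pull (Δε⊕J (suc m)) ⟩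
    J (2 + m) ⨾ (ε• ⊕ J (suc m))
      ≈⟨ idl ⟩
    ε• ⊕ J (suc m) ∎
    where
    cross : (σ₁₁ ⊕ J m) ⨾ (I ⊕ (ε• ⊕ J m)) ≈ ε• ⊕ J (suc m)
    cross = begin
      (σ₁₁ ⊕ J m) ⨾ (I ⊕ (ε• ⊕ J m))     ≈⟨ ⨾-cong (~sym σ₁₁≈ ⟩⊕⟨refl) (~sym (⊕-assoc I ε• (J m))) ⟩
      (σₜ 1 1 ⊕ J m) ⨾ ((I ⊕ ε•) ⊕ J m)  ≈⟨ ⊕J-⨾ ⟨
      (σₜ 1 1 ⨾ (I ⊕ ε•)) ⊕ J m          ≈⟨ σ-natural ε• I ⟩⊕⟨refl ⟨
      ((ε• ⊕ I) ⨾ σₜ 0 1) ⊕ J m          ≈⟨ ~trans (refl⟩⨾⟨ σ₀₁≈) idr₁ ⟩⊕⟨refl ⟩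
      (ε• ⊕ I) ⊕ J m                     ≈⟨ ⊕-assoc ε• I (J m) ⟩
      ε• ⊕ J (suc m)                     ∎
    Δε⊕J : ∀ k → (Δ• ⊕ J k) ⨾ (I ⊕ (ε• ⊕ J k)) ≈ J (suc k)
    Δε⊕J k = ~trans (refl⟩⨾⟨ ~sym (⊕-assoc I ε• (J k))) (~trans (~sym ⊕J-⨾) (Δε ⟩⊕⟨refl))

  -- Adding c times the first unit vector to a vector with a zero in front puts c itself in front.
  -- This is the inductive step for the identity matrix, and also the way in which a fresh vector
  -- enters a span.
  absorb-unit : ∀ m → (I ⊕ (η∘ ⊕ J m)) ⨾ absorb (R.1# ∷ᵥ λ _ → R.0#) ≈ J (suc m)
  absorb-unit m = begin
    (I ⊕ (η∘ ⊕ J m)) ⨾ ((Δ• ⊕ J (suc m)) ⨾ ((I ⊕ (σ₁₁ ⊕ J m)) ⨾ (M R.1# ⊕ absorb (λ _ → R.0#))))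
      ≈⟨ swap₂ (~sym slide) ⟩
    (Δ• ⊕ J m) ⨾ ((I ⊕ (I ⊕ (η∘ ⊕ J m))) ⨾ ((I ⊕ (σ₁₁ ⊕ J m)) ⨾ (M R.1# ⊕ absorb (λ _ → R.0#))))
      ≈⟨ refl⟩⨾⟨ pull (~trans (~sym I⊕-⨾) (~trans (refl⟩⊕⟨ cross) (~sym (⊕-assoc I η∘ (J (suc m)))))) ⟩
    (Δ• ⊕ J m) ⨾ (((I ⊕ η∘) ⊕ J (suc m)) ⨾ (M R.1# ⊕ absorb (λ _ → R.0#)))
      ≈⟨ refl⟩⨾⟨ ~trans (~sym pre-⊕) (⊕-cong (~trans (refl⟩⨾⟨ M-1) ημ) (absorb-0 m)) ⟩
    (Δ• ⊕ J m) ⨾ (I ⊕ (ε• ⊕ J m))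
      ≈⟨ ~trans (refl⟩⨾⟨ ~sym (⊕-assoc I ε• (J m))) (~trans (~sym ⊕J-⨾) (Δε ⟩⊕⟨refl)) ⟩
    J (suc m) ∎
    where
    M-1 : M R.1# ≈ μ∘
    M-1 = ~trans (~trans (ha A11 ⟩⊕⟨refl) (~sym J₂≈) ⟩⨾⟨refl) idl
    cross : (I ⊕ (η∘ ⊕ J m)) ⨾ (σ₁₁ ⊕ J m) ≈ η∘ ⊕ J (suc m)
    cross = begin
      (I ⊕ (η∘ ⊕ J m)) ⨾ (σ₁₁ ⊕ J m)     ≈⟨ ⨾-cong (~sym (⊕-assoc I η∘ (J m))) (~sym σ₁₁≈ ⟩⊕⟨refl) ⟩
      ((I ⊕ η∘) ⊕ J m) ⨾ (σₜ 1 1 ⊕ J m)  ≈⟨ ⊕J-⨾ ⟨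
      ((I ⊕ η∘) ⨾ σₜ 1 1) ⊕ J m          ≈⟨ σ-natural I η∘ ⟩⊕⟨refl ⟩
      (σₜ 1 0 ⨾ (η∘ ⊕ I)) ⊕ J m          ≈⟨ ~trans (σ₁₀≈ ⟩⨾⟨refl) idl₁ ⟩⊕⟨refl ⟩
      (η∘ ⊕ I) ⊕ J m                     ≈⟨ ⊕-assoc η∘ I (J m) ⟩
      η∘ ⊕ J (suc m)                     ∎

  -- `A i` is the column that belongs to input `i`; the columns are absorbed into the zero vector,
  -- the last one first.
  mat : ∀ n → (Fin n → Vec m) → Term Sig n m
  mat zero    A = zeros _
  mat (suc n) A = (I ⊕ mat n (tail A)) ⨾ absorb (head A)

  mat-linear : {f : Term Sig m k} (l : Linear f) → ∀ n (A : Fin n → Vec m) →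
               mat n A ⨾ f ≈ mat n (λ i → action l (A i))
  mat-linear l zero    A = zero-ax l
  mat-linear {f = f} l (suc n) A = begin
    ((I ⊕ mat n (tail A)) ⨾ absorb (head A)) ⨾ f
      ≈⟨ assoc ⟩
    (I ⊕ mat n (tail A)) ⨾ (absorb (head A) ⨾ f)
      ≈⟨ refl⟩⨾⟨ natural l (head A) ⟩
    (I ⊕ mat n (tail A)) ⨾ ((I ⊕ f) ⨾ absorb (action l (head A)))
      ≈⟨ pull (~trans (~sym I⊕-⨾) (refl⟩⊕⟨ mat-linear l n (tail A))) ⟩
    mat (suc n) (λ i → action l (A i)) ∎

  -- The unit vectors of the smaller identity matrix are lengthened by the action of `η∘` on top of
  -- the other wires, and `absorb-unit` supplies the new column.
  J≈mat : ∀ n → ∃ λ A → J n ≈ mat n A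
  J≈mat zero    = (λ ()) , ~refl
  J≈mat (suc n) with J≈mat n
  ... | A , p = (R.1# ∷ᵥ λ _ → R.0#) ∷ᵥ (λ i → action l (A i)) , (begin
    J (suc n)
      ≈⟨ absorb-unit n ⟨
    (I ⊕ (η∘ ⊕ J n)) ⨾ absorb (R.1# ∷ᵥ λ _ → R.0#)
      ≈⟨ (refl⟩⊕⟨ ~trans (~sym idl) (~trans (p ⟩⨾⟨refl) (mat-linear l n A))) ⟩⨾⟨refl ⟩
    (I ⊕ mat n (λ i → action l (A i))) ⨾ absorb (R.1# ∷ᵥ λ _ → R.0#) ∎)
    where l = Linear-gen n η

  -- `f` is preceded by the identity, which is a matrix, and naturality then lets `f` act on each
  -- column.
  linear≈mat : {f : Term Sig n m} → Linear f → ∃ λ A → f ≈ mat n A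
  linear≈mat {n} {f = f} l with J≈mat n
  ... | A , p = (λ i → action l (A i)) , (begin
    f                             ≈⟨ idl ⟨
    J n ⨾ f                       ≈⟨ p ⟩⨾⟨refl ⟩
    mat n A ⨾ f                   ≈⟨ mat-linear l n A ⟩
    mat n (λ i → action l (A i))  ∎)

  IsMap-J : ∀ n → IsMap (J n)
  IsMap-J zero    = id₀
  IsMap-J (suc n) = id₁ ⊕ IsMap-J n

  private
    IsMap-subst : (p : m ≡ k) {f : Term Sig n m} → IsMap f → IsMap (subst (Term Sig n) p f)
    IsMap-subst ≡.refl f = f

  IsMap-σ₁ : ∀ m → IsMap (σ₁ m)
  IsMap-σ₁ zero    = id₁
  IsMap-σ₁ (suc m) = (σ₁₁ ⊕ IsMap-J m) ⨾ (id₁ ⊕ IsMap-σ₁ m)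

  IsMap-σ : ∀ n m → IsMap (σₜ n m)
  IsMap-σ zero    m = IsMap-subst (≡.sym (+-identityʳ m)) (IsMap-J m)
  IsMap-σ (suc n) m = (id₁ ⊕ IsMap-σ n m) ⨾ IsMap-subst (+-assoc m 1 n) (IsMap-σ₁ m ⊕ IsMap-J n)

  IsMap-M : ∀ x → IsMap (M x)
  IsMap-M x = (gen (scale x) ⊕ id₁) ⨾ gen μ

  IsMap-absorb : (v : Vec m) → IsMap (absorb v)
  IsMap-absorb {zero}  v = gen ε
  IsMap-absorb {suc m} v =
    (gen Δ ⊕ IsMap-J (suc m)) ⨾ ((id₁ ⊕ (σ₁₁ ⊕ IsMap-J m)) ⨾ (IsMap-M (head v) ⊕ IsMap-absorb (tail v)))

  IsMap-zeros : ∀ m → IsMap (zeros m)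
  IsMap-zeros zero    = id₀
  IsMap-zeros (suc m) = gen η ⊕ IsMap-zeros m

  IsMap-mat : ∀ n (A : Fin n → Vec m) → IsMap (mat n A)
  IsMap-mat {m} zero A = IsMap-zeros m
  IsMap-mat (suc n) A  = (id₁ ⊕ IsMap-mat n (tail A)) ⨾ IsMap-absorb (head A)

-- Interpretation in linear relations and its soundness

-- An injective ring homomorphism for which every element of the field has a denominator. Keeping
-- the field abstract means that equations in it are proved from the field laws rather than by
-- cross-multiplying fractions.
record IsFractionField {c ℓ} (R : CommutativeRing c ℓ) (K : Field (c ⊔ ℓ) ℓ) : Set (c ⊔ ℓ) where
  private
    module R = CommutativeRing R
    module K = Field K
  field
    ι      : R.Carrier → K.Carrier
    ι-cong : ∀ {x y} → x R.≈ y → ι x K.≈ ι y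
    ι-inj  : ∀ {x y} → ι x K.≈ ι y → x R.≈ y
    ι-+    : ∀ x y → ι (x R.+ y) K.≈ ι x K.+ ι y
    ι-*    : ∀ x y → ι (x R.* y) K.≈ ι x K.* ι y
    ι-0    : ι R.0# K.≈ K.0#
    ι-1    : ι R.1# K.≈ K.1#
    clear  : ∀ x → ∃ λ d → ∃ λ n → ¬ (d R.≈ R.0#) × ι d K.* x K.≈ ι n

module Semantics {c ℓ} (R : CommutativeRing c ℓ) (K : Field (c ⊔ ℓ) ℓ)
                 (isFractionField : IsFractionField R K) where
  private
    module R = CommutativeRing R
    module K = Field K
    module S = PROP (SV K)
    module SE {n m : ℕ} = IsEquivalence (S.isEquivalence {n} {m})
    variable
      a b d n m k : ℕ
  open import Algebra.Properties.Ring (CommutativeRing.ring K.commutativeRing) using (-1*x≈-x)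
  open import Algebra.Properties.Group (CommutativeRing.+-group K.commutativeRing)
    using (inverseʳ-unique; inverseˡ-unique)
  open import Algebra.Properties.CommutativeSemigroup (CommutativeRing.+-commutativeSemigroup K.commutativeRing)
    using (interchange)
  open import Algebra.Properties.CommutativeSemigroup (CommutativeRing.*-commutativeSemigroup K.commutativeRing)
    using (x∙yz≈y∙xz)
  open import Algebra.Properties.AbelianGroup (CommutativeRing.+-abelianGroup K.commutativeRing)
    using (xyx⁻¹≈y)
  open IsFractionField isFractionField public
  open Maps R using (IsMap; gen; id₀; id₁; σ₁₁; _⨾_; _⊕_; Sig; _≈_)
  open import Data.Vec.Functional.Relation.Binary.Equality.Setoid K.setoid public
    using () renaming (_≋_ to _≋ᴷ_; ≋-refl to ≋ᴷ-refl; ≋-sym to ≋ᴷ-sym; ≋-trans to ≋ᴷ-trans)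
  open Subspace public
  open _≃_ public
  open import Relation.Binary.Reasoning.Setoid K.setoid

  Vecᴷ : ℕ → Set (c ⊔ ℓ)
  Vecᴷ = Vector K.Carrier

  ι-neg : ∀ x → ι (R.- x) K.≈ K.- ι x
  ι-neg x = inverseʳ-unique (ι x) (ι (R.- x))
    (K.trans (K.sym (ι-+ x (R.- x))) (K.trans (ι-cong (R.-‿inverseʳ x)) ι-0))

  take-++ : (x : Vecᴷ n) (y : Vecᴷ m) → take n (x ++ y) ≋ᴷ x
  take-++ {n} {m} x y i = K.reflexive (≡.cong [ x , y ]′ (splitAt-↑ˡ n i m))

  drop-++ : (x : Vecᴷ n) (y : Vecᴷ m) → drop n (x ++ y) ≋ᴷ y
  drop-++ {n} {m} x y i = K.reflexive (≡.cong [ x , y ]′ (splitAt-↑ʳ n m i))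

  glue : ∀ n {m} {x y : Vecᴷ (n + m)} → take n x ≋ᴷ take n y → drop n x ≋ᴷ drop n y → x ≋ᴷ y
  glue n {m} {x} {y} p q i =
    ≡.subst (λ j → x j K.≈ y j) (join-splitAt n m i) (go (Fin.splitAt n i))
    where
    go : ∀ j → x (Fin.join n m j) K.≈ y (Fin.join n m j)
    go (inj₁ j) = p j
    go (inj₂ j) = q j

  genMap : HAGen R n m → Vecᴷ n → Vecᴷ m
  genMap Δ         x = head x ∷ᵥ x
  genMap ε         x = []ᵥ
  genMap μ         x = (head x K.+ head (tail x)) ∷ᵥ []ᵥ
  genMap η         x = K.0# ∷ᵥ []ᵥ
  genMap (scale r) x = (ι r K.* head x) ∷ᵥ []ᵥ

  genMap-cong : (g : HAGen R n m) {x y : Vecᴷ n} → x ≋ᴷ y → genMap g x ≋ᴷ genMap g y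
  genMap-cong Δ         p zero       = p zero
  genMap-cong Δ         p (suc i)    = p i
  genMap-cong μ         p zero       = K.+-cong (p zero) (p (suc zero))
  genMap-cong η         p zero       = K.refl
  genMap-cong (scale r) p zero       = K.*-congˡ (p zero)

  graph : HAGen R n m → Subspace K n m
  graph g = record
    { rel  = λ x y → Lift (c ⊔ ℓ) (y ≋ᴷ genMap g x)
    ; resp = λ p q (lift e) → lift (≋ᴷ-trans (≋ᴷ-sym q) (≋ᴷ-trans e (genMap-cong g p)))
    ; 0∈   = lift (zero′ g)
    ; +∈   = λ (lift p) (lift q) → lift (plus g p q)
    ; *∈   = λ r (lift p) → lift (times g r p)
    }
    where
    zero′ : ∀ {n m} (g : HAGen R n m) → (λ _ → K.0#) ≋ᴷ genMap g (λ _ → K.0#)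
    zero′ Δ         zero    = K.refl
    zero′ Δ         (suc i) = K.refl
    zero′ μ         zero    = K.sym (K.+-identityˡ K.0#)
    zero′ η         zero    = K.refl
    zero′ (scale r) zero    = K.sym (K.zeroʳ (ι r))
    plus : ∀ {n m} (g : HAGen R n m) {x x′ : Vecᴷ n} {y y′ : Vecᴷ m} →
           y ≋ᴷ genMap g x → y′ ≋ᴷ genMap g x′ → (λ i → y i K.+ y′ i) ≋ᴷ genMap g (λ i → x i K.+ x′ i)
    plus Δ         p q zero    = K.+-cong (p zero) (q zero)
    plus Δ         p q (suc i) = K.+-cong (p (suc i)) (q (suc i))
    plus μ         p q zero    = K.trans (K.+-cong (p zero) (q zero)) (interchange _ _ _ _)
    plus η         p q zero    = K.trans (K.+-cong (p zero) (q zero)) (K.+-identityˡ K.0#)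
    plus (scale r) p q zero    = K.trans (K.+-cong (p zero) (q zero)) (K.sym (K.distribˡ _ _ _))
    times : ∀ {n m} (g : HAGen R n m) r {x : Vecᴷ n} {y : Vecᴷ m} →
            y ≋ᴷ genMap g x → (λ i → r K.* y i) ≋ᴷ genMap g (λ i → r K.* x i)
    times Δ          r p zero    = K.*-congˡ (p zero)
    times Δ          r p (suc i) = K.*-congˡ (p (suc i))
    times μ          r p zero    = K.trans (K.*-congˡ (p zero)) (K.distribˡ _ _ _)
    times η          r p zero    = K.trans (K.*-congˡ (p zero)) (K.zeroʳ r)
    times (scale r′) r p zero    = K.trans (K.*-congˡ (p zero)) (x∙yz≈y∙xz _ _ _)

  converse : Subspace K n m → Subspace K m n
  converse V = record
    { rel  = λ x y → rel V y x
    ; resp = λ p q → resp V q p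
    ; 0∈   = 0∈ V
    ; +∈   = +∈ V
    ; *∈   = λ r → *∈ V r
    }

  ⟦_⟧ : Term Sig n m → Subspace K n m
  ⟦ gen (inj₁ g) ⟧ = graph g
  ⟦ gen (inj₂ g) ⟧ = converse (graph g)
  ⟦ id₀ ⟧          = S.id 0
  ⟦ id₁ ⟧          = S.id 1
  ⟦ σ₁₁ ⟧          = S.σ 1 1
  ⟦ t ⨾ u ⟧        = ⟦ t ⟧ S.⨾ ⟦ u ⟧
  ⟦ t ⊕ u ⟧        = ⟦ t ⟧ S.⊕ ⟦ u ⟧

  -- For maps the relational semantics is a graph. Working with the function avoids exhibiting
  -- intermediate vectors, and the axioms of HA become pointwise identities.
  mapOf : {t : Term Sig n m} → IsMap t → Vecᴷ n → Vecᴷ m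
  mapOf (gen g) x = genMap g x
  mapOf id₀     x = x
  mapOf id₁     x = x
  mapOf σ₁₁     x = head (tail x) ∷ᵥ head x ∷ᵥ []ᵥ
  mapOf (f ⨾ g) x = mapOf g (mapOf f x)
  mapOf (_⊕_ {n = n} f g) x = mapOf f (take n x) ++ mapOf g (drop n x)

  mapOf-cong : {t : Term Sig n m} (f : IsMap t) {x y : Vecᴷ n} → x ≋ᴷ y → mapOf f x ≋ᴷ mapOf f y
  mapOf-cong (gen g) p = genMap-cong g p
  mapOf-cong id₀     p = p
  mapOf-cong id₁     p = p
  mapOf-cong σ₁₁     p zero       = p (suc zero)
  mapOf-cong σ₁₁     p (suc zero) = p zero
  mapOf-cong (f ⨾ g) p = mapOf-cong g (mapOf-cong f p)
  mapOf-cong (_⊕_ {n = n} {m = m} f g) p = glue m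
    (≋ᴷ-trans (take-++ _ _) (≋ᴷ-trans (mapOf-cong f (p ∘ (_↑ˡ _))) (≋ᴷ-sym (take-++ _ _))))
    (≋ᴷ-trans (drop-++ {n = m} _ _) (≋ᴷ-trans (mapOf-cong g (p ∘ (n ↑ʳ_))) (≋ᴷ-sym (drop-++ {n = m} _ _))))

  ⟦map⟧⇒ : {t : Term Sig n m} (f : IsMap t) {x : Vecᴷ n} {y : Vecᴷ m} → rel ⟦ t ⟧ x y → y ≋ᴷ mapOf f x
  ⟦map⟧⇒ (gen g) (lift p) = p
  ⟦map⟧⇒ id₀     (lift p) = ≋ᴷ-sym p
  ⟦map⟧⇒ id₁     (lift p) = ≋ᴷ-sym p
  ⟦map⟧⇒ σ₁₁     (lift (p , q)) zero       = K.sym (q zero)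
  ⟦map⟧⇒ σ₁₁     (lift (p , q)) (suc zero) = K.sym (p zero)
  ⟦map⟧⇒ (f ⨾ g) (_ , p , q) = ≋ᴷ-trans (⟦map⟧⇒ g q) (mapOf-cong g (⟦map⟧⇒ f p))
  ⟦map⟧⇒ (_⊕_ {m = m} f g) (p , q) = glue m
    (≋ᴷ-trans (⟦map⟧⇒ f p) (≋ᴷ-sym (take-++ _ _))) (≋ᴷ-trans (⟦map⟧⇒ g q) (≋ᴷ-sym (drop-++ {n = m} _ _)))

  ⟦map⟧∋ : {t : Term Sig n m} (f : IsMap t) (x : Vecᴷ n) → rel ⟦ t ⟧ x (mapOf f x)
  ⟦map⟧∋ (gen g) x = lift ≋ᴷ-refl
  ⟦map⟧∋ id₀     x = lift ≋ᴷ-refl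
  ⟦map⟧∋ id₁     x = lift ≋ᴷ-refl
  ⟦map⟧∋ σ₁₁     x = lift ((λ { zero → K.refl }) , (λ { zero → K.refl }))
  ⟦map⟧∋ (f ⨾ g) x = mapOf f x , ⟦map⟧∋ f x , ⟦map⟧∋ g (mapOf f x)
  ⟦map⟧∋ (_⊕_ {n = n} {m = m} {t = t} {u} f g) x =
    resp ⟦ t ⟧ ≋ᴷ-refl (≋ᴷ-sym (take-++ _ _)) (⟦map⟧∋ f (take n x)) ,
    resp ⟦ u ⟧ ≋ᴷ-refl (≋ᴷ-sym (drop-++ {n = m} _ _)) (⟦map⟧∋ g (drop n x))

  ⟦map⟧⇐ : {t : Term Sig n m} (f : IsMap t) {x : Vecᴷ n} {y : Vecᴷ m} → y ≋ᴷ mapOf f x → rel ⟦ t ⟧ x y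
  ⟦map⟧⇐ {t = t} f {x} p = resp ⟦ t ⟧ ≋ᴷ-refl (≋ᴷ-sym p) (⟦map⟧∋ f x)

  map-≃ : {t u : Term Sig n m} (f : IsMap t) (g : IsMap u) → (∀ x → mapOf f x ≋ᴷ mapOf g x) → ⟦ t ⟧ S.≈ ⟦ u ⟧
  map-≃ f g e = record
    { ⊆ = λ {x} p → ⟦map⟧⇐ g (≋ᴷ-trans (⟦map⟧⇒ f p) (e x))
    ; ⊇ = λ {x} p → ⟦map⟧⇐ f (≋ᴷ-trans (⟦map⟧⇒ g p) (≋ᴷ-sym (e x))) }

  HA-isMap : (t : Term (HAGen R) n m) → IsMap (mapTerm inj₁ t)
  HA-isMap (gen g) = gen g
  HA-isMap id₀     = id₀
  HA-isMap id₁     = id₁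
  HA-isMap σ₁₁     = σ₁₁
  HA-isMap (t ⨾ u) = HA-isMap t ⨾ HA-isMap u
  HA-isMap (t ⊕ u) = HA-isMap t ⊕ HA-isMap u

  -- A7, A10 and A16 have no clause because their sides have no output coordinate.
  HA-sound : {t u : Term (HAGen R) n m} → HAEq R t u → ∀ x → mapOf (HA-isMap t) x ≋ᴷ mapOf (HA-isMap u) x
  HA-sound (s-cong e) x zero = K.*-congʳ (ι-cong e)
  HA-sound A1 x zero = K.+-identityˡ _
  HA-sound A2 x zero = K.+-comm _ _
  HA-sound A3 x zero = K.+-assoc _ _ _
  HA-sound A4 x zero = K.refl
  HA-sound A5 x zero = K.refl
  HA-sound A5 x (suc zero) = K.refl
  HA-sound A6 x zero = K.refl
  HA-sound A6 x (suc zero) = K.refl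
  HA-sound A6 x (suc (suc zero)) = K.refl
  HA-sound A8 x zero = K.refl
  HA-sound A8 x (suc zero) = K.refl
  HA-sound A9 x zero = K.refl
  HA-sound A9 x (suc zero) = K.refl
  HA-sound A11 x zero = K.trans (K.*-congʳ ι-1) (K.*-identityˡ _)
  HA-sound (A12 k₁ k₂) x zero = begin
    ι k₂ K.* (ι k₁ K.* head x)   ≈⟨ K.*-assoc _ _ _ ⟨
    (ι k₂ K.* ι k₁) K.* head x   ≈⟨ K.*-congʳ (K.trans (K.*-comm _ _) (K.sym (ι-* k₁ k₂))) ⟩
    ι (k₁ R.* k₂) K.* head x     ∎
  HA-sound (A13 k) x zero = K.distribˡ _ _ _
  HA-sound (A14 k) x zero = K.zeroʳ _
  HA-sound (A15 k) x zero = K.refl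
  HA-sound (A15 k) x (suc zero) = K.refl
  HA-sound A17 x zero = K.trans (K.*-congʳ ι-0) (K.zeroˡ _)
  HA-sound (A18 k₁ k₂) x zero = K.trans (K.sym (K.distribʳ _ _ _)) (K.*-congʳ (K.sym (ι-+ k₁ k₂)))

  -- Taking converses reverses composition and respects direct sums, so soundness of the reversed
  -- axioms is inherited from HA.
  ⟦op⟧ : (t : Term (HAGen R) n m) → ⟦ mapTerm inj₂ (opTerm t) ⟧ S.≈ converse ⟦ mapTerm inj₁ t ⟧
  ⟦op⟧ (gen g) = SE.refl
  ⟦op⟧ id₀     = record { ⊆ = λ (lift p) → lift (≋ᴷ-sym p) ; ⊇ = λ (lift p) → lift (≋ᴷ-sym p) }
  ⟦op⟧ id₁     = record { ⊆ = λ (lift p) → lift (≋ᴷ-sym p) ; ⊇ = λ (lift p) → lift (≋ᴷ-sym p) }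
  ⟦op⟧ σ₁₁     = record
    { ⊆ = λ (lift (p , q)) → lift (≋ᴷ-sym q , ≋ᴷ-sym p)
    ; ⊇ = λ (lift (p , q)) → lift (≋ᴷ-sym q , ≋ᴷ-sym p) }
  ⟦op⟧ (t ⨾ u) = record
    { ⊆ = λ (y , p , q) → y , ⊆ (⟦op⟧ t) q , ⊆ (⟦op⟧ u) p
    ; ⊇ = λ (y , p , q) → y , ⊇ (⟦op⟧ u) q , ⊇ (⟦op⟧ t) p }
  ⟦op⟧ (t ⊕ u) = record
    { ⊆ = λ (p , q) → ⊆ (⟦op⟧ t) p , ⊆ (⟦op⟧ u) q
    ; ⊇ = λ (p , q) → ⊇ (⟦op⟧ t) p , ⊇ (⟦op⟧ u) q }

  ⨾-congˢ : (V V′ : Subspace K n m) (W W′ : Subspace K m k) → V S.≈ V′ → W S.≈ W′ → V S.⨾ W S.≈ V′ S.⨾ W′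
  ⨾-congˢ V V′ W W′ p q = S.⨾-cong {f = V} {V′} {W} {W′} p q

  ⊕-congˢ : (V V′ : Subspace K n m) (W W′ : Subspace K a b) → V S.≈ V′ → W S.≈ W′ → V S.⊕ W S.≈ V′ S.⊕ W′
  ⊕-congˢ V V′ W W′ p q = S.⊕-cong {f = V} {V′} {W} {W′} p q

  reflˢ : {V : Subspace K n m} → V S.≈ V
  reflˢ = record { ⊆ = λ v → v ; ⊇ = λ v → v }

  ⟦idₜ⟧ : ∀ n → ⟦ idₜ n ⟧ S.≈ S.id n
  ⟦idₜ⟧ zero    = SE.refl
  ⟦idₜ⟧ (suc n) = SE.trans (⊕-congˢ (S.id 1) (S.id 1) ⟦ idₜ n ⟧ (S.id n) reflˢ (⟦idₜ⟧ n)) (S.⊕-id 1 n)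

  ⟦subst₂⟧ : ∀ {n n′ m m′} (p : n ≡ n′) (q : m ≡ m′) (t : Term Sig n m) →
             ⟦ subst₂ (Term Sig) p q t ⟧ S.≈ subst₂ (Subspace K) p q ⟦ t ⟧
  ⟦subst₂⟧ ≡.refl ≡.refl t = SE.refl

  ⟦subst⟧ : ∀ {n m m′} (q : m ≡ m′) (t : Term Sig n m) →
            ⟦ subst (Term Sig n) q t ⟧ S.≈ subst (Subspace K n) q ⟦ t ⟧
  ⟦subst⟧ ≡.refl t = SE.refl

  subst-cong : ∀ {n m m′} (q : m ≡ m′) {V W : Subspace K n m} →
               V S.≈ W → subst (Subspace K n) q V S.≈ subst (Subspace K n) q W
  subst-cong ≡.refl e = e

  subst₂-cong : ∀ {n n′ m m′} (p : n ≡ n′) (q : m ≡ m′) {V W : Subspace K n m} →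
                V S.≈ W → subst₂ (Subspace K) p q V S.≈ subst₂ (Subspace K) p q W
  subst₂-cong ≡.refl ≡.refl e = e

  ⟦σ₁⟧ : ∀ m → ⟦ σ₁ m ⟧ S.≈ S.σ 1 m
  ⟦σ₁⟧ zero = record
    { ⊆ = λ (lift p) → lift ((λ { zero → p zero }) , λ ())
    ; ⊇ = λ (lift (p , _)) → lift λ { zero → p zero } }
  ⟦σ₁⟧ (suc m) = SE.trans
    (⨾-congˢ (S.σ 1 1 S.⊕ ⟦ idₜ m ⟧) (S.σ 1 1 S.⊕ S.id m) (S.id 1 S.⊕ ⟦ σ₁ m ⟧) (S.id 1 S.⊕ S.σ 1 m)
      (⊕-congˢ (S.σ 1 1) (S.σ 1 1) ⟦ idₜ m ⟧ (S.id m) reflˢ (⟦idₜ⟧ m))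
      (⊕-congˢ (S.id 1) (S.id 1) ⟦ σ₁ m ⟧ (S.σ 1 m) reflˢ (⟦σ₁⟧ m))) (record
    { ⊆ = λ (y , (lift (p , q) , lift r) , (lift p′ , lift (q′ , r′))) →
          lift ( (λ { zero → K.trans (p zero) (q′ zero) })
               , (λ { zero    → K.trans (q zero) (p′ zero)
                    ; (suc i) → K.trans (r i) (r′ i) }) )
    ; ⊇ = λ {x} {z} (lift (p , q)) →
          (head (tail x) ∷ᵥ head x ∷ᵥ tail (tail x))
          , (lift ((λ { zero → K.refl }) , (λ { zero → K.refl })) , lift ≋ᴷ-refl)
          , lift (λ { zero → q zero })
          , lift ((λ { zero → p zero }) , (q ∘ suc)) })

  ⟦σₜ⟧ : ∀ n m → ⟦ σₜ n m ⟧ S.≈ S.σ n m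
  ⟦σₜ⟧ zero m = SE.trans (⟦subst⟧ p (idₜ m)) (SE.trans (subst-cong p (⟦idₜ⟧ m)) (record
    { ⊆ = λ {x} {y} r → lift ((λ ()) , λ i → K.trans (toId p r i) (K.reflexive (≡.cong y (index i))))
    ; ⊇ = λ {x} {y} (lift (_ , q)) → fromId p λ i →
            K.trans (q i) (K.reflexive (≡.cong y (≡.sym (index i)))) }))
    where
    p = ≡.sym (+-identityʳ m)
    toId : ∀ {m m′} (p : m ≡ m′) {x : Vecᴷ m} {y : Vecᴷ m′} →
           rel (subst (Subspace K m) p (S.id m)) x y → x ≋ᴷ (y ∘ subst Fin p)
    toId ≡.refl (lift r) = r
    fromId : ∀ {m m′} (p : m ≡ m′) {x : Vecᴷ m} {y : Vecᴷ m′} →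
             x ≋ᴷ (y ∘ subst Fin p) → rel (subst (Subspace K m) p (S.id m)) x y
    fromId ≡.refl r = lift r
    toℕ-subst : ∀ {n m} (p : n ≡ m) (i : Fin n) → Fin.toℕ (subst Fin p i) ≡ Fin.toℕ i
    toℕ-subst ≡.refl i = ≡.refl
    index : ∀ i → subst Fin p i ≡ i ↑ˡ 0
    index i = toℕ-injective (≡.trans (toℕ-subst p i) (≡.sym (toℕ-↑ˡ i 0)))
  ⟦σₜ⟧ (suc n) m = SE.trans
    (⨾-congˢ (S.id 1 S.⊕ ⟦ σₜ n m ⟧) (S.id 1 S.⊕ S.σ n m) _ _
      (⊕-congˢ (S.id 1) (S.id 1) ⟦ σₜ n m ⟧ (S.σ n m) reflˢ (⟦σₜ⟧ n m))
      (SE.trans (⟦subst⟧ q (σ₁ m ⊕ idₜ n))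
        (subst-cong q (⊕-congˢ ⟦ σ₁ m ⟧ (S.σ 1 m) ⟦ idₜ n ⟧ (S.id n) (⟦σ₁⟧ m) (⟦idₜ⟧ n)))))
    -- The recursion that defines `σₜ` is the hexagon for a single first wire, with the transport on
    -- the other side of the equation.
    (transpose q {S.id 1 S.⊕ S.σ n m} {S.σ 1 m S.⊕ S.id n} {S.σ (suc n) m} (S.σ-hexagon 1 n m))
    where
    q = +-assoc m 1 n
    transpose : ∀ {n m k k′} (q : k ≡ k′) {A : Subspace K n m} {B : Subspace K m k} {X : Subspace K n k′} →
                subst₂ (Subspace K) ≡.refl (≡.sym q) X S.≈ A S.⨾ B → A S.⨾ subst (Subspace K m) q B S.≈ X
    transpose ≡.refl e = SE.sym e

  ι≉0 : ∀ {r} → ¬ (r R.≈ R.0#) → ¬ (ι r K.≈ K.0#)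
  ι≉0 r≉0 e = r≉0 (ι-inj (K.trans e (K.sym ι-0)))

  cancelˡ : ∀ {k x y} → ¬ (k K.≈ K.0#) → k K.* x K.≈ k K.* y → x K.≈ y
  cancelˡ {k} {x} {y} k≉0 e with K.inverse k k≉0
  ... | j , kj≈1 = begin
    x               ≈⟨ unit x ⟨
    j K.* (k K.* x) ≈⟨ K.*-congˡ e ⟩
    j K.* (k K.* y) ≈⟨ unit y ⟩
    y               ∎
    where
    unit : ∀ z → j K.* (k K.* z) K.≈ z
    unit z = K.trans (K.sym (K.*-assoc _ _ _))
      (K.trans (K.*-congʳ (K.trans (K.*-comm _ _) kj≈1)) (K.*-identityˡ z))

  a+[b-a]≈b : ∀ a b → a K.+ (b K.- a) K.≈ b
  a+[b-a]≈b a b = K.trans (K.sym (K.+-assoc _ _ _)) (xyx⁻¹≈y a b)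

  [a-b]+c≈d : ∀ {a b c d} → a K.+ c K.≈ b K.+ d → (a K.- b) K.+ c K.≈ d
  [a-b]+c≈d {a} {b} {c} {d} e = begin
    (a K.- b) K.+ c     ≈⟨ K.+-assoc _ _ _ ⟩
    a K.+ (K.- b K.+ c) ≈⟨ K.+-congˡ (K.+-comm _ _) ⟩
    a K.+ (c K.- b)     ≈⟨ K.+-assoc _ _ _ ⟨
    (a K.+ c) K.- b     ≈⟨ K.+-congʳ e ⟩
    (b K.+ d) K.- b     ≈⟨ xyx⁻¹≈y b d ⟩
    d                   ∎

  ι[-1]* : ∀ x → ι (R.- R.1#) K.* x K.≈ K.- x
  ι[-1]* x = K.trans (K.*-congʳ (K.trans (ι-neg R.1#) (K.-‿cong ι-1))) (-1*x≈-x x)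

  IH-sound : {t u : Term Sig n m} → IHEq R t u → ⟦ t ⟧ S.≈ ⟦ u ⟧
  IH-sound (I1 l l≉0) = record
    { ⊆ = λ { (y , lift p , lift q) → lift λ
              { zero → cancelˡ (ι≉0 l≉0) (K.trans (K.sym (p zero)) (q zero)) } }
    ; ⊇ = λ { {x} (lift p) → genMap (scale l) x , lift ≋ᴷ-refl , lift (genMap-cong (scale l) p) } }
  IH-sound (I2 l l≉0) with K.inverse (ι l) (ι≉0 l≉0)
  ... | j , lj≈1 = record
    { ⊆ = λ { (y , lift p , lift q) → lift (≋ᴷ-trans p (≋ᴷ-sym q)) }
    ; ⊇ = λ { {x} {z} (lift p) → (λ i → j K.* x i) , lift (λ { zero → unit (x zero) })
              , lift (λ { zero → K.trans (K.sym (p zero)) (unit (x zero)) }) } }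
    where
    unit : ∀ z → z K.≈ ι l K.* (j K.* z)
    unit z = K.sym (K.trans (K.sym (K.*-assoc _ _ _)) (K.trans (K.*-congʳ lj≈1) (K.*-identityˡ z)))
  IH-sound I3ˡ = record
    { ⊆ = λ { {x} {z} (y , (lift p , lift p′) , (lift q , lift q′)) →
              (λ _ → x zero K.+ x (suc zero)) , lift (λ { zero → K.refl }) , lift λ { zero → begin
                x zero K.+ x (suc zero)
                  ≈⟨ K.+-cong (p zero) (p′ zero) ⟩
                (y zero K.+ y (suc zero)) K.+ y (suc (suc zero))
                  ≈⟨ K.+-assoc _ _ _ ⟩
                y zero K.+ (y (suc zero) K.+ y (suc (suc zero)))
                  ≈⟨ K.+-cong (q zero) (K.sym (q′ zero)) ⟩
                z zero K.+ z (suc zero) ∎ } }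
    ; ⊇ = λ { {x} {z} (w , lift p , lift q) →
              -- The first input is split into the required first output and a surplus, which is
              -- added to the second input.
              (z zero ∷ᵥ (x zero K.- z zero) ∷ᵥ x (suc zero) ∷ᵥ []ᵥ)
              , (lift (λ { zero → K.sym (a+[b-a]≈b _ _) }) , lift (λ { zero → K.refl }))
              , (lift (λ { zero → K.refl })
              , lift (λ { zero → K.sym ([a-b]+c≈d (K.trans (K.sym (p zero)) (q zero))) })) } }
  IH-sound I3ʳ = record
    { ⊆ = λ { {x} {z} (w , lift p , lift q) →
              (x zero ∷ᵥ (z zero K.- x zero) ∷ᵥ z (suc zero) ∷ᵥ []ᵥ)
              , (lift (λ { zero → K.refl })
              , lift (λ { zero → K.sym ([a-b]+c≈d (K.trans (K.sym (q zero)) (p zero))) }))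
              , (lift (λ { zero → K.sym (a+[b-a]≈b _ _) }) , lift (λ { zero → K.refl })) }
    ; ⊇ = λ { {x} {z} (y , (lift p , lift p′) , (lift q , lift q′)) →
              (λ _ → x zero K.+ x (suc zero)) , lift (λ { zero → K.refl }) , lift λ { zero → begin
                x zero K.+ x (suc zero)
                  ≈⟨ K.+-cong (p zero) (p′ zero) ⟩
                y zero K.+ (y (suc zero) K.+ y (suc (suc zero)))
                  ≈⟨ K.+-assoc _ _ _ ⟨
                (y zero K.+ y (suc zero)) K.+ y (suc (suc zero))
                  ≈⟨ K.+-cong (K.sym (q zero)) (q′ zero) ⟩
                z zero K.+ z (suc zero) ∎ } } }
  IH-sound I4ˡ = record
    { ⊆ = λ { {x} {z} (y , (lift p , lift p′) , (lift q , lift q′)) →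
              take 1 (drop 1 z)
              , lift (λ { zero       → K.trans (K.sym (p (suc zero))) (q′ zero)
                        ; (suc zero) → K.trans (p′ zero) (q′ (suc zero)) })
              , lift (λ { zero       → K.trans (K.sym (q zero)) (K.trans (p zero)
                                         (K.trans (K.sym (p (suc zero))) (q′ zero)))
                        ; (suc zero) → K.refl }) }
    ; ⊇ = λ { {x} {z} (w , lift p , lift q) →
              (x zero ∷ᵥ x)
              , (lift (λ { zero → K.refl ; (suc zero) → K.refl }) , lift (λ { zero → K.refl }))
              , (lift (λ { zero → K.trans (p zero) (K.sym (q zero)) })
              , lift (λ { zero       → K.trans (p zero) (K.sym (q (suc zero)))
                        ; (suc zero) → K.trans (p (suc zero)) (K.sym (q (suc zero))) })) } }
  IH-sound I4ʳ = record
    { ⊆ = λ { {x} {z} (w , lift p , lift q) →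
              (x zero ∷ᵥ x (suc zero) ∷ᵥ x (suc zero) ∷ᵥ []ᵥ)
              , (lift (λ { zero → K.refl }) , lift (λ { zero → K.refl ; (suc zero) → K.refl }))
              , (lift (λ { zero       → K.trans (p zero) (K.sym (q zero))
                         ; (suc zero) → K.trans (p (suc zero)) (K.sym (q zero)) })
              , lift (λ { zero → K.trans (p (suc zero)) (K.sym (q (suc zero))) })) }
    ; ⊇ = λ { {x} {z} (y , (lift p , lift p′) , (lift q , lift q′)) →
              take 1 z
              , lift (λ { zero       → K.trans (p zero) (q zero)
                        ; (suc zero) → K.trans (K.sym (p′ zero)) (q (suc zero)) })
              , lift (λ { zero       → K.refl
                        ; (suc zero) → K.trans (K.sym (q′ zero)) (K.trans (p′ (suc zero))
                                         (K.trans (K.sym (p′ zero)) (q (suc zero)))) }) } }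
  IH-sound I5 = record
    { ⊆ = λ { {x} {z} (w , lift p , lift q) →
              (λ _ → z zero)
              , ((λ _ → z zero) , lift (λ ()) , lift (λ { zero → K.refl ; (suc zero) → K.refl }))
              , (lift (λ { zero → K.refl })
              , lift (λ { zero → K.trans (inverseʳ-unique (z zero) (z (suc zero))
                                           (K.trans (K.sym (q zero)) (p zero)))
                                         (K.sym (ι[-1]* _)) })) }
    ; ⊇ = λ { {x} {z} (y , (w , lift _ , lift r) , (lift p , lift q)) →
              (λ _ → K.0#) , lift (λ { zero → K.refl }) , lift λ { zero → K.sym (begin
                z zero K.+ z (suc zero)    ≈⟨ K.+-cong (K.sym (p zero)) (K.trans (q zero) (ι[-1]* _)) ⟩
                y zero K.+ K.- y (suc zero) ≈⟨ K.+-cong (r zero) (K.-‿cong (r (suc zero))) ⟩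
                w zero K.+ K.- w zero      ≈⟨ K.-‿inverseʳ _ ⟩
                K.0#                       ∎) } } }
  IH-sound I6 = record
    { ⊆ = λ { {x} {z} (w , lift p , lift q) →
              (λ _ → x zero)
              , ((λ _ → x zero)
                , (lift (λ { zero → K.refl })
                  , lift (λ { zero → K.sym (K.trans (ι[-1]* _) (K.sym
                      (inverseˡ-unique (x zero) (x (suc zero)) (K.trans (K.sym (p zero)) (q zero))))) }))
                , lift (λ { zero → K.refl ; (suc zero) → K.refl }))
              , lift (λ ()) }
    ; ⊇ = λ { {x} {z} (w , (y , (lift p , lift q) , lift r) , lift _) →
              (λ _ → K.0#) , lift (λ { zero → K.sym (begin
                x zero K.+ x (suc zero)     ≈⟨ K.+-congʳ (begin
                  x zero                    ≈⟨ p zero ⟩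
                  y zero                    ≈⟨ r zero ⟩
                  w zero                    ≈⟨ r (suc zero) ⟨
                  y (suc zero)              ≈⟨ q zero ⟩
                  _                         ≈⟨ ι[-1]* _ ⟩
                  K.- x (suc zero)          ∎) ⟩
                K.- x (suc zero) K.+ x (suc zero) ≈⟨ K.-‿inverseˡ _ ⟩
                K.0#                        ∎) }) , lift (λ { zero → K.refl }) } }
  IH-sound I7 = record
    { ⊆ = λ { (y , lift p , lift q) → lift (λ { zero → K.trans (p zero) (K.sym (q zero)) }) }
    ; ⊇ = λ { {x} (lift p) → (x zero ∷ᵥ K.0# ∷ᵥ []ᵥ) , lift (λ { zero → K.sym (K.+-identityʳ _) })
              , lift (λ { zero → K.trans (K.sym (p zero)) (K.sym (K.+-identityʳ _)) }) } }
  IH-sound I8 = record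
    { ⊆ = λ { (y , lift p , lift q) → lift (λ { zero → K.trans (K.sym (p zero)) (q zero) }) }
    ; ⊇ = λ { {x} (lift p) → (λ _ → x zero) , lift (λ { zero → K.refl ; (suc zero) → K.refl })
              , lift (λ { zero → p zero ; (suc zero) → p zero }) } }

  sound : {t u : Term Sig n m} → t ≈ u → ⟦ t ⟧ S.≈ ⟦ u ⟧
  sound (ax (inj₁ (inl {t = t} {u} e))) = map-≃ (HA-isMap t) (HA-isMap u) (HA-sound e)
  sound (ax (inj₁ (inr (op {t = t} {u} e)))) = SE.trans (⟦op⟧ t) (SE.trans
    (record { ⊆ = ⊆ e′ ; ⊇ = ⊇ e′ }) (SE.sym (⟦op⟧ u)))
    where e′ = map-≃ (HA-isMap t) (HA-isMap u) (HA-sound e)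
  sound (ax (inj₂ e))       = IH-sound e
  sound ~refl               = SE.refl
  sound (~sym p)            = SE.sym (sound p)
  sound (~trans p q)        = SE.trans (sound p) (sound q)
  sound (⨾-cong {t = t} {t′} {u} {u′} p q) = ⨾-congˢ ⟦ t ⟧ ⟦ t′ ⟧ ⟦ u ⟧ ⟦ u′ ⟧ (sound p) (sound q)
  sound (⊕-cong {t = t} {t′} {u} {u′} p q) = ⊕-congˢ ⟦ t ⟧ ⟦ t′ ⟧ ⟦ u ⟧ ⟦ u′ ⟧ (sound p) (sound q)
  sound (⨾-assoc t u v)     = S.⨾-assoc ⟦ t ⟧ ⟦ u ⟧ ⟦ v ⟧
  sound (⨾-identityˡ {n} t) =
    SE.trans (⨾-congˢ ⟦ idₜ n ⟧ (S.id n) ⟦ t ⟧ ⟦ t ⟧ (⟦idₜ⟧ n) reflˢ) (S.⨾-identityˡ ⟦ t ⟧)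
  sound (⨾-identityʳ {n} {m} t) =
    SE.trans (⨾-congˢ ⟦ t ⟧ ⟦ t ⟧ ⟦ idₜ m ⟧ (S.id m) reflˢ (⟦idₜ⟧ m)) (S.⨾-identityʳ ⟦ t ⟧)
  sound (⊕-id n m)          = SE.trans (⊕-congˢ ⟦ idₜ n ⟧ (S.id n) ⟦ idₜ m ⟧ (S.id m) (⟦idₜ⟧ n) (⟦idₜ⟧ m))
    (SE.trans (S.⊕-id n m) (SE.sym (⟦idₜ⟧ (n + m))))
  sound (⊕-⨾ t u t′ u′)     = S.⊕-⨾ ⟦ t ⟧ ⟦ u ⟧ ⟦ t′ ⟧ ⟦ u′ ⟧
  sound (⊕-assoc {a} {b} {c} {a′} {b′} {c′} t u v) =
    SE.trans (⟦subst₂⟧ (+-assoc a b c) (+-assoc a′ b′ c′) ((t ⊕ u) ⊕ v)) (S.⊕-assoc ⟦ t ⟧ ⟦ u ⟧ ⟦ v ⟧)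
  sound (⊕-identityˡ t)     = S.⊕-identityˡ ⟦ t ⟧
  sound (⊕-identityʳ {n} {m} t) =
    SE.trans (⟦subst₂⟧ (+-identityʳ n) (+-identityʳ m) (t ⊕ id₀)) (S.⊕-identityʳ ⟦ t ⟧)
  sound (σ-natural {n} {m} {n′} {m′} t u) =
    SE.trans (⨾-congˢ (⟦ t ⟧ S.⊕ ⟦ u ⟧) (⟦ t ⟧ S.⊕ ⟦ u ⟧) ⟦ σₜ m m′ ⟧ (S.σ m m′) reflˢ (⟦σₜ⟧ m m′))
      (SE.trans (S.σ-natural ⟦ t ⟧ ⟦ u ⟧)
        (⨾-congˢ (S.σ n n′) ⟦ σₜ n n′ ⟧ (⟦ u ⟧ S.⊕ ⟦ t ⟧) (⟦ u ⟧ S.⊕ ⟦ t ⟧) (SE.sym (⟦σₜ⟧ n n′)) reflˢ))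
  sound (σ-involutive n m)  =
    SE.trans (⨾-congˢ ⟦ σₜ n m ⟧ (S.σ n m) ⟦ σₜ m n ⟧ (S.σ m n) (⟦σₜ⟧ n m) (⟦σₜ⟧ m n))
      (SE.trans (S.σ-involutive n m) (SE.sym (⟦idₜ⟧ (n + m))))
  sound (σ-hexagon a b c)   = SE.trans
    (SE.trans (⟦subst₂⟧ (+-assoc a b c) (≡.sym (+-assoc c a b)) (σₜ (a + b) c))
      (subst₂-cong (+-assoc a b c) (≡.sym (+-assoc c a b)) (⟦σₜ⟧ (a + b) c)))
    (SE.trans (S.σ-hexagon a b c) (SE.sym (⨾-congˢ
      (⟦ idₜ a ⟧ S.⊕ ⟦ σₜ b c ⟧) (S.id a S.⊕ S.σ b c) _ _
      (⊕-congˢ ⟦ idₜ a ⟧ (S.id a) ⟦ σₜ b c ⟧ (S.σ b c) (⟦idₜ⟧ a) (⟦σₜ⟧ b c))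
      (SE.trans (⟦subst₂⟧ (+-assoc a c b) ≡.refl (σₜ a c ⊕ idₜ b))
        (subst₂-cong (+-assoc a c b) ≡.refl
          (⊕-congˢ ⟦ σₜ a c ⟧ (S.σ a c) ⟦ idₜ b ⟧ (S.id b) (⟦σₜ⟧ a c) (⟦idₜ⟧ b)))))))

-- Derived equations of interacting Hopf algebras

module Relations {c ℓ} (R : CommutativeRing c ℓ)
                 (1≉0 : ¬ (CommutativeRing._≈_ R (CommutativeRing.1# R) (CommutativeRing.0# R))) where
  private
    module R = CommutativeRing R
    variable
      n m : ℕ
  open Maps R public
  open import Algebra.Properties.Ring R.ring using (-1*x≈-x; -0#≈0#)
  open import Algebra.Properties.Group R.+-group using (⁻¹-involutive)

  μ• : Term Sig 2 1
  μ• = gen (inj₂ Δ)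
  η• : Term Sig 0 1
  η• = gen (inj₂ ε)
  Δ∘ : Term Sig 1 2
  Δ∘ = gen (inj₂ μ)
  ε∘ : Term Sig 1 0
  ε∘ = gen (inj₂ η)
  s̄ : R.Carrier → Term Sig 1 1
  s̄ x = gen (inj₂ (scale x))

  ih : {t u : Term Sig n m} → IHEq R t u → t ≈ u
  ih e = ax (inj₂ e)

  -1ᴿ : R.Carrier
  -1ᴿ = R.- R.1#

  -1≉0 : ¬ (-1ᴿ R.≈ R.0#)
  -1≉0 e = 1≉0 (R.trans (R.sym (⁻¹-involutive R.1#)) (R.trans (R.-‿cong e) -0#≈0#))

  s₋₁² : s -1ᴿ ⨾ s -1ᴿ ≈ I
  s₋₁² = ~trans (ha (A12 _ _)) (~trans (s-cong′ (R.trans (-1*x≈-x -1ᴿ) (⁻¹-involutive R.1#))) (ha A11))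

  cup : Term Sig 0 2
  cup = η• ⨾ Δ•

  cap : Term Sig 2 0
  cap = μ• ⨾ ε•

  -- The reversed A16 lets `η•` emit `s̄ x`, which I2 cancels against `s x`: a completely free value
  -- stays free under an invertible scaling.
  η•-s : ∀ {x} → ¬ (x R.≈ R.0#) → η• ⨾ s x ≈ η•
  η•-s {x} x≉0 = begin
    η• ⨾ s x            ≈⟨ ha-op (A16 x) ⟩⨾⟨refl ⟨
    (η• ⨾ s̄ x) ⨾ s x    ≈⟨ assoc ⟩
    η• ⨾ (s̄ x ⨾ s x)    ≈⟨ refl⟩⨾⟨ ih (I2 x x≉0) ⟩
    η• ⨾ I              ≈⟨ idr₁ ⟩
    η•                  ∎

  s-ε∘ : ∀ {x} → ¬ (x R.≈ R.0#) → s x ⨾ ε∘ ≈ ε∘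
  s-ε∘ {x} x≉0 = begin
    s x ⨾ ε∘            ≈⟨ refl⟩⨾⟨ ha-op (A14 x) ⟨
    s x ⨾ (s̄ x ⨾ ε∘)    ≈⟨ pull (ih (I1 x x≉0)) ⟩
    I ⨾ ε∘              ≈⟨ idl₁ ⟩
    ε∘                  ∎

  -- `ε•` is doubled by A4 and a sign is inserted before it by A16, so that the right side of I5
  -- appears. After I5 and A7 the white loop closes by I7, and A10 finishes. The white analogue
  -- `η∘-ε∘` uses I6 and I8 instead.
  η•-ε• : η• ⨾ ε• ≈ id₀
  η•-ε• = begin
    η• ⨾ ε•
      ≈⟨ refl⟩⨾⟨ ~trans (pull (~trans (refl⟩⨾⟨ ~sym ⊕I≈⊕J) (ha A4))) idl₁ ⟨
    η• ⨾ (Δ• ⨾ ((ε• ⊕ J 1) ⨾ ε•))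
      ≈⟨ refl⟩⨾⟨ refl⟩⨾⟨ top-first ⟨
    η• ⨾ (Δ• ⨾ (ε• ⊕ ε•))
      ≈⟨ refl⟩⨾⟨ refl⟩⨾⟨ ~trans (~sym (⊕-⨾ _ _ _ _)) (⊕-cong idl₁ (ha (A16 _))) ⟨
    η• ⨾ (Δ• ⨾ ((I ⊕ s -1ᴿ) ⨾ (ε• ⊕ ε•)))
      ≈⟨ ~trans (refl⟩⨾⟨ ~sym assoc) (~trans (~sym assoc) (~sym assoc ⟩⨾⟨refl)) ⟩
    ((η• ⨾ Δ•) ⨾ (I ⊕ s -1ᴿ)) ⨾ (ε• ⊕ ε•)
      ≈⟨ ⨾-cong (ih I5) (ha A7) ⟨
    (η∘ ⨾ Δ∘) ⨾ (μ∘ ⨾ ε•)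
      ≈⟨ ~trans assoc (refl⟩⨾⟨ pull (ih I7)) ⟩
    η∘ ⨾ (I ⨾ ε•)
      ≈⟨ refl⟩⨾⟨ idl₁ ⟩
    η∘ ⨾ ε•
      ≈⟨ ha A10 ⟩
    id₀ ∎

  η∘-ε∘ : η∘ ⨾ ε∘ ≈ id₀
  η∘-ε∘ = begin
    η∘ ⨾ ε∘
      ≈⟨ η-μ ⟩⨾⟨refl ⟨
    ((η∘ ⊕ η∘) ⨾ μ∘) ⨾ ε∘
      ≈⟨ assoc ⟩
    (η∘ ⊕ η∘) ⨾ (μ∘ ⨾ ε∘)
      ≈⟨ refl⟩⨾⟨ ~trans (ih I6) assoc ⟩
    (η∘ ⊕ η∘) ⨾ ((I ⊕ s -1ᴿ) ⨾ cap)
      ≈⟨ pull (~trans (~sym (⊕-⨾ _ _ _ _)) (⊕-cong idr₁ (ha (A14 _)))) ⟩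
    (η∘ ⊕ η∘) ⨾ cap
      ≈⟨ ~sym (ha A9) ⟩⨾⟨refl ⟩
    (η∘ ⨾ Δ•) ⨾ (μ• ⨾ ε•)
      ≈⟨ ~trans assoc (refl⟩⨾⟨ pull (ih I8)) ⟩
    η∘ ⨾ (I ⨾ ε•)
      ≈⟨ refl⟩⨾⟨ idl₁ ⟩
    η∘ ⨾ ε•
      ≈⟨ ha A10 ⟩
    id₀ ∎
    where
    η-μ : (η∘ ⊕ η∘) ⨾ μ∘ ≈ η∘
    η-μ = ~trans (push bottom-first) (~trans (refl⟩⨾⟨ ~trans (~sym ⊕I≈⊕J ⟩⨾⟨refl) (ha A1)) idr₁)

  -- The cup equates its two wires, so testing one for zero makes the other zero. Two signs are
  -- inserted on the free wire: one completes the right side of I5, the other is swallowed by `η∘`.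
  cup-ε∘ : cup ⨾ (ε∘ ⊕ I) ≈ η∘
  cup-ε∘ = begin
    cup ⨾ (ε∘ ⊕ I)
      ≈⟨ ~trans (refl⟩⨾⟨ s₋₁²) idr₁ ⟨
    (cup ⨾ (ε∘ ⊕ I)) ⨾ (s -1ᴿ ⨾ s -1ᴿ)
      ≈⟨ ~trans assoc (refl⟩⨾⟨ ~sym assoc) ⟩
    cup ⨾ (((ε∘ ⊕ I) ⨾ s -1ᴿ) ⨾ s -1ᴿ)
      ≈⟨ refl⟩⨾⟨ ~trans (⊕I≈⊕J ⟩⨾⟨refl) slide ⟩⨾⟨refl ⟩
    cup ⨾ (((I ⊕ s -1ᴿ) ⨾ (ε∘ ⊕ J 1)) ⨾ s -1ᴿ)
      ≈⟨ refl⟩⨾⟨ (refl⟩⨾⟨ ~sym ⊕I≈⊕J) ⟩⨾⟨refl ⟩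
    cup ⨾ (((I ⊕ s -1ᴿ) ⨾ (ε∘ ⊕ I)) ⨾ s -1ᴿ)
      ≈⟨ ~trans (refl⟩⨾⟨ assoc) (pull (~sym (ih I5))) ⟩
    (η∘ ⨾ Δ∘) ⨾ ((ε∘ ⊕ I) ⨾ s -1ᴿ)
      ≈⟨ ~trans assoc (refl⟩⨾⟨ ~trans (pull (ha-op A1)) idl₁) ⟩
    η∘ ⨾ s -1ᴿ
      ≈⟨ ha (A14 _) ⟩
    η∘ ∎

  -- Adding a free value forgets the input. `X` is recovered from `X ⨾ Δ∘` by the counit law; I3
  -- with the reversed A7 makes the second output of `X ⨾ Δ∘` an independent `η•`, and by I6 the
  -- zero test on `X` just discards its input.
  add-η• : (I ⊕ η•) ⨾ μ∘ ≈ ε• ⨾ η•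
  add-η• = begin
    X                         ≈⟨ ~trans (refl⟩⨾⟨ ha-op A1) idr₁ ⟨
    X ⨾ (Δ∘ ⨾ (ε∘ ⊕ I))       ≈⟨ pull X-Δ∘ ⟩
    (X ⊕ η•) ⨾ (ε∘ ⊕ I)       ≈⟨ ⊕-⨾ _ _ _ _ ⟨
    (X ⨾ ε∘) ⊕ (η• ⨾ I)       ≈⟨ ⊕-cong X-ε∘ idr₁ ⟩
    ε• ⊕ η•                   ≈⟨ top-first ⟩
    (ε• ⊕ id₀) ⨾ η•           ≈⟨ ⊕-identityʳ ε• ⟩⨾⟨refl ⟩
    ε• ⨾ η•                   ∎
    where
    X = (I ⊕ η•) ⨾ μ∘
    X-Δ∘ : X ⨾ Δ∘ ≈ X ⊕ η•
    X-Δ∘ = begin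
      ((I ⊕ η•) ⨾ μ∘) ⨾ Δ∘                 ≈⟨ ~trans assoc (refl⟩⨾⟨ ih I3ʳ) ⟩
      (I ⊕ η•) ⨾ ((I ⊕ Δ∘) ⨾ (μ∘ ⊕ I))     ≈⟨ pull (~trans (~sym I⊕-⨾) (refl⟩⊕⟨ ha-op A7)) ⟩
      (I ⊕ (η• ⊕ η•)) ⨾ (μ∘ ⊕ I)           ≈⟨ ~sym (⊕-assoc I η• η•) ⟩⨾⟨refl ⟩
      ((I ⊕ η•) ⊕ η•) ⨾ (μ∘ ⊕ I)           ≈⟨ ⊕-⨾ _ _ _ _ ⟨
      X ⊕ (η• ⨾ I)                         ≈⟨ refl⟩⊕⟨ idr₁ ⟩
      X ⊕ η•                               ∎
    X-ε∘ : X ⨾ ε∘ ≈ ε•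
    X-ε∘ = begin
      ((I ⊕ η•) ⨾ μ∘) ⨾ ε∘                 ≈⟨ ~trans assoc (refl⟩⨾⟨ ~trans (ih I6) assoc) ⟩
      (I ⊕ η•) ⨾ ((I ⊕ s -1ᴿ) ⨾ cap)       ≈⟨ pull (~trans (~sym I⊕-⨾) (refl⟩⊕⟨ η•-s -1≉0)) ⟩
      (I ⊕ η•) ⨾ (μ• ⨾ ε•)                 ≈⟨ pull (unitʳ (ha-op A5) (ha-op A4)) ⟩
      I ⨾ ε•                               ≈⟨ idl₁ ⟩
      ε•                                   ∎

  -- shear x : (c, d) ↦ (c, x c + d)
  shear : R.Carrier → Term Sig 2 2
  shear x = (Δ• ⊕ I) ⨾ (I ⊕ M x)

  -- The second coordinate is already free, so `add-η•` swallows the multiple of the first one that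
  -- the shear adds. This is what makes shears of spanning vectors invisible.
  η•²-shear : ∀ x → (η• ⊕ η•) ⨾ shear x ≈ η• ⊕ η•
  η•²-shear x = begin
    (η• ⊕ η•) ⨾ ((Δ• ⊕ I) ⨾ (I ⊕ M x))
      ≈⟨ pull (~trans (~sym (⊕-⨾ _ _ _ _))
           (~trans (refl⟩⊕⟨ idr₁) (~trans top-first (⊕-identityʳ cup ⟩⨾⟨refl)))) ⟩
    (cup ⨾ (I ⊕ (I ⊕ η•))) ⨾ (I ⊕ M x)
      ≈⟨ ~trans assoc (~trans assoc (refl⟩⨾⟨ refl⟩⨾⟨ ~sym I⊕-⨾)) ⟩
    η• ⨾ (Δ• ⨾ (I ⊕ ((I ⊕ η•) ⨾ M x)))
      ≈⟨ refl⟩⨾⟨ refl⟩⨾⟨ refl⟩⊕⟨ absorbed ⟩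
    η• ⨾ (Δ• ⨾ (I ⊕ (ε• ⨾ η•)))
      ≈⟨ refl⟩⨾⟨ ~trans (refl⟩⨾⟨ I⊕-⨾) (~trans (pull Δε) idl₁) ⟩
    η• ⨾ (I ⊕ η•)
      ≈⟨ ~trans top-first (⊕-identityʳ η• ⟩⨾⟨refl) ⟨
    η• ⊕ η• ∎
    where
    absorbed : (I ⊕ η•) ⨾ M x ≈ ε• ⨾ η•
    absorbed = begin
      (I ⊕ η•) ⨾ ((s x ⊕ I) ⨾ μ∘)
        ≈⟨ pull (~trans (refl⟩⨾⟨ ⊕I≈⊕J) (~trans (~sym slide) (⊕-identityʳ (s x) ⟩⨾⟨refl))) ⟩
      (s x ⨾ (I ⊕ η•)) ⨾ μ∘           ≈⟨ ~trans assoc (refl⟩⨾⟨ add-η•) ⟩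
      s x ⨾ (ε• ⨾ η•)                 ≈⟨ pull (ha (A16 x)) ⟩
      ε• ⨾ η•                         ∎

  snake : (I ⊕ cup) ⨾ (cap ⊕ I) ≈ I
  snake = begin
    (I ⊕ (η• ⨾ Δ•)) ⨾ ((μ• ⨾ ε•) ⊕ I)              ≈⟨ ⨾-cong I⊕-⨾ ⊕I-⨾ ⟩
    ((I ⊕ η•) ⨾ (I ⊕ Δ•)) ⨾ ((μ• ⊕ I) ⨾ (ε• ⊕ I))  ≈⟨ ~trans assoc (refl⟩⨾⟨ ~sym assoc) ⟩
    (I ⊕ η•) ⨾ (((I ⊕ Δ•) ⨾ (μ• ⊕ I)) ⨾ (ε• ⊕ I))  ≈⟨ refl⟩⨾⟨ ~sym (ih I4ʳ) ⟩⨾⟨refl ⟩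
    (I ⊕ η•) ⨾ ((μ• ⨾ Δ•) ⨾ (ε• ⊕ I))              ≈⟨ refl⟩⨾⟨ ~trans assoc (~trans (refl⟩⨾⟨ ha A4) idr₁) ⟩
    (I ⊕ η•) ⨾ μ•                                  ≈⟨ unitʳ (ha-op A5) (ha-op A4) ⟩
    I                                              ∎

  -- I6 solved for the black cap: two values agree when their difference passes the zero test.
  cap≈ : cap ≈ (I ⊕ s -1ᴿ) ⨾ (μ∘ ⨾ ε∘)
  cap≈ = begin
    cap                                       ≈⟨ idl ⟨
    J 2 ⨾ cap
      ≈⟨ ~trans (~sym I⊕-⨾) (refl⟩⊕⟨ ~trans s₋₁² (~sym J₁≈I)) ⟩⨾⟨refl ⟨
    ((I ⊕ s -1ᴿ) ⨾ (I ⊕ s -1ᴿ)) ⨾ cap         ≈⟨ ~trans assoc (refl⟩⨾⟨ ~sym assoc) ⟩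
    (I ⊕ s -1ᴿ) ⨾ (((I ⊕ s -1ᴿ) ⨾ μ•) ⨾ ε•)   ≈⟨ refl⟩⨾⟨ ih I6 ⟨
    (I ⊕ s -1ᴿ) ⨾ (μ∘ ⨾ ε∘)                   ∎

  μ•≈ : μ• ≈ (Δ• ⊕ I) ⨾ (I ⊕ cap)
  μ•≈ = begin
    μ•                                     ≈⟨ ~trans (refl⟩⨾⟨ Δε) idr₁ ⟨
    μ• ⨾ (Δ• ⨾ (I ⊕ ε•))                   ≈⟨ pull (~sym (ih I4ˡ)) ⟩
    ((Δ• ⊕ I) ⨾ (I ⊕ μ•)) ⨾ (I ⊕ ε•)       ≈⟨ ~trans assoc (refl⟩⨾⟨ ~sym I⊕-⨾) ⟩
    (Δ• ⊕ I) ⨾ (I ⊕ cap)                   ∎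

  -- By I3 the white comultiplication is determined by its value at zero, which I5 describes: the
  -- cup chooses a summand a freely, and x - a is the other one.
  Δ∘≈ : Δ∘ ≈ ((cup ⨾ (I ⊕ s -1ᴿ)) ⊕ I) ⨾ (I ⊕ μ∘)
  Δ∘≈ = begin
    Δ∘                                           ≈⟨ idl₁ ⟨
    I ⨾ Δ∘                                       ≈⟨ ha A1 ⟩⨾⟨refl ⟨
    ((η∘ ⊕ I) ⨾ μ∘) ⨾ Δ∘                         ≈⟨ ~trans assoc (refl⟩⨾⟨ ~sym (ih I3ˡ)) ⟩
    (η∘ ⊕ I) ⨾ ((Δ∘ ⊕ I) ⨾ (I ⊕ μ∘))             ≈⟨ pull (~trans (~sym ⊕I-⨾) (ih I5 ⟩⊕⟨refl)) ⟩
    ((cup ⨾ (I ⊕ s -1ᴿ)) ⊕ I) ⨾ (I ⊕ μ∘)         ∎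

  -- I1 and I2 make `s x` pass through `μ•`, so sliding it around the cap turns it into `s̄ x`; the
  -- snake equation then straightens the wire.
  s̄≈ : ∀ {x} → ¬ (x R.≈ R.0#) → s̄ x ≈ (I ⊕ cup) ⨾ ((I ⊕ (s x ⊕ I)) ⨾ (cap ⊕ I))
  s̄≈ {x} x≉0 = ~sym (begin
    (I ⊕ cup) ⨾ ((I ⊕ (s x ⊕ I)) ⨾ (cap ⊕ I))
      ≈⟨ refl⟩⨾⟨ ~trans (~sym (⊕-assoc I (s x) I) ⟩⨾⟨refl) (~trans (~sym ⊕I-⨾) (transpose ⟩⊕⟨refl)) ⟩
    (I ⊕ cup) ⨾ (((s̄ x ⊕ I) ⨾ cap) ⊕ I)
      ≈⟨ refl⟩⨾⟨ ~trans ⊕I-⨾ (~trans (⊕-assoc (s̄ x) I I) (refl⟩⊕⟨ ~sym J₂≈) ⟩⨾⟨refl) ⟩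
    (I ⊕ cup) ⨾ ((s̄ x ⊕ J 2) ⨾ (cap ⊕ I))
      ≈⟨ pull (~trans (~sym slide) (⊕-identityʳ (s̄ x) ⟩⨾⟨refl)) ⟩
    (s̄ x ⨾ (I ⊕ cup)) ⨾ (cap ⊕ I)
      ≈⟨ ~trans assoc (refl⟩⨾⟨ snake) ⟩
    s̄ x ⨾ I
      ≈⟨ idr₁ ⟩
    s̄ x ∎)
    where
    μ•-s : (s x ⊕ s x) ⨾ μ• ≈ μ• ⨾ s x
    μ•-s = begin
      (s x ⊕ s x) ⨾ μ•                          ≈⟨ refl⟩⨾⟨ ~trans (refl⟩⨾⟨ ih (I2 x x≉0)) idr₁ ⟨
      (s x ⊕ s x) ⨾ (μ• ⨾ (s̄ x ⨾ s x))          ≈⟨ refl⟩⨾⟨ ~trans (pull (ha-op (A15 x))) assoc ⟩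
      (s x ⊕ s x) ⨾ ((s̄ x ⊕ s̄ x) ⨾ (μ• ⨾ s x))
        ≈⟨ pull (~trans (~sym (⊕-⨾ _ _ _ _))
             (~trans (⊕-cong (ih (I1 x x≉0)) (ih (I1 x x≉0))) (~sym J₂≈))) ⟩
      J 2 ⨾ (μ• ⨾ s x)                          ≈⟨ idl ⟩
      μ• ⨾ s x                                  ∎
    transpose : (I ⊕ s x) ⨾ cap ≈ (s̄ x ⊕ I) ⨾ cap
    transpose = begin
      (I ⊕ s x) ⨾ cap                           ≈⟨ ~sym (⊕-cong (ih (I2 x x≉0)) idl₁) ⟩⨾⟨refl ⟩
      ((s̄ x ⨾ s x) ⊕ (I ⨾ s x)) ⨾ cap           ≈⟨ push (⊕-⨾ _ _ _ _) ⟩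
      (s̄ x ⊕ I) ⨾ ((s x ⊕ s x) ⨾ (μ• ⨾ ε•))     ≈⟨ refl⟩⨾⟨ ~trans (swap₂ μ•-s) (refl⟩⨾⟨ ha (A16 x)) ⟩
      (s̄ x ⊕ I) ⨾ cap                           ∎

  bend : Term Sig (suc n) m → Term Sig n (suc m)
  bend {n} f = (cup ⊕ J n) ⨾ (I ⊕ f)

  unbend : Term Sig n (suc m) → Term Sig (suc n) m
  unbend {m = m} g = (I ⊕ g) ⨾ (cap ⊕ J m)

  unbend-bend : (f : Term Sig (suc n) m) → unbend (bend f) ≈ f
  unbend-bend {n} {m} f = begin
    (I ⊕ ((cup ⊕ J n) ⨾ (I ⊕ f))) ⨾ (cap ⊕ J m)            ≈⟨ push I⊕-⨾ ⟩
    (I ⊕ (cup ⊕ J n)) ⨾ ((I ⊕ (I ⊕ f)) ⨾ (cap ⊕ J m))      ≈⟨ refl⟩⨾⟨ ~sym slide ⟩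
    (I ⊕ (cup ⊕ J n)) ⨾ ((cap ⊕ J (suc n)) ⨾ f)
      ≈⟨ pull (⨾-cong (~sym (⊕-assoc I cup (J n))) (~sym (⊕-assoc cap I (J n)))) ⟩
    (((I ⊕ cup) ⊕ J n) ⨾ ((cap ⊕ I) ⊕ J n)) ⨾ f            ≈⟨ ~trans (~sym ⊕J-⨾) (snake ⟩⊕⟨refl) ⟩⨾⟨refl ⟩
    J (suc n) ⨾ f                                          ≈⟨ idl ⟩
    f                                                      ∎

-- Faithfulness on maps

module States {c ℓ} (R : CommutativeRing c ℓ) (isIntegralDomain : IsIntegralDomain R)
              (K : Field (c ⊔ ℓ) ℓ) (isFractionField : IsFractionField R K)
              (lem : (P : Set (c ⊔ ℓ)) → Dec P) where
  open IsIntegralDomain isIntegralDomain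
  open Relations R 1≉0
  open Semantics R K isFractionField
  open Linear
  private
    module R = CommutativeRing R
    module K = Field K
    variable
      a b d n m k : ℕ
  open NatCoeffSolver K.commutativeSemiring using (solve; _:=_; _:+_; _:*_)
  open import Algebra.Properties.Ring R.ring using () renaming (-‿distribˡ-* to -ᴿ‿distribˡ-*)
  open import Algebra.Properties.Ring (CommutativeRing.ring K.commutativeRing) using (-0#≈0#)

  mapOf-J : ∀ n (x : Vecᴷ n) → mapOf (IsMap-J n) x ≋ᴷ x
  mapOf-J (suc n) x zero    = K.refl
  mapOf-J (suc n) x (suc i) = mapOf-J n (tail x) i

  mapOf-absorb : (v : Vec m) (x : Vecᴷ (suc m)) →
                 mapOf (IsMap-absorb v) x ≋ᴷ λ i → x (suc i) K.+ ι (v i) K.* x zero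
  mapOf-absorb {suc m} v x zero    = K.+-comm _ _
  mapOf-absorb {suc m} v x (suc i) = K.trans (mapOf-absorb (tail v) _ i)
    (K.+-congʳ (K.trans (mapOf-J m _ i) (mapOf-J m (tail (tail x)) i)))

  mapOf-mat : ∀ n (A : Fin (suc n) → Vec m) (x : Vecᴷ (suc n)) →
              mapOf (IsMap-mat (suc n) A) x
                ≋ᴷ λ i → mapOf (IsMap-mat n (tail A)) (tail x) i K.+ ι (head A i) K.* head x
  mapOf-mat n A x i = mapOf-absorb (head A) _ i

  mapOf-0 : {t : Term Sig n m} (f : IsMap t) → mapOf f (λ _ → K.0#) ≋ᴷ λ _ → K.0#
  mapOf-0 {t = t} f = ≋ᴷ-sym (⟦map⟧⇒ f (0∈ ⟦ t ⟧))

  -- The first unit vector reads off the first column, whose entries agree in R because `ι` is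
  -- injective; inputs with zero in front reach the other columns.
  mat-faithful : ∀ n (A B : Fin n → Vec m) →
                 (∀ x → mapOf (IsMap-mat n A) x ≋ᴷ mapOf (IsMap-mat n B) x) → mat n A ≈ mat n B
  mat-faithful zero    A B e = ~refl
  mat-faithful (suc n) A B e = ⨾-cong (refl⟩⊕⟨ mat-faithful n (tail A) (tail B) tails)
    (absorb-cong λ i → ι-inj (K.trans (K.sym (column A i)) (K.trans (e (K.1# ∷ᵥ λ _ → K.0#) i) (column B i))))
    where
    column : ∀ (A : Fin (suc n) → Vec _) i →
             mapOf (IsMap-mat (suc n) A) (K.1# ∷ᵥ λ _ → K.0#) i K.≈ ι (head A i)
    column A i = K.trans (mapOf-mat n A (K.1# ∷ᵥ λ _ → K.0#) i)
      (K.trans (K.+-cong (mapOf-0 (IsMap-mat n (tail A)) i) (K.*-identityʳ _)) (K.+-identityˡ _))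
    shift : ∀ (A : Fin (suc n) → Vec _) x i →
            mapOf (IsMap-mat (suc n) A) (K.0# ∷ᵥ x) i K.≈ mapOf (IsMap-mat n (tail A)) x i
    shift A x i = K.trans (mapOf-mat n A (K.0# ∷ᵥ x) i) (K.trans (K.+-congˡ (K.zeroʳ _)) (K.+-identityʳ _))
    tails : ∀ x → mapOf (IsMap-mat n (tail A)) x ≋ᴷ mapOf (IsMap-mat n (tail B)) x
    tails x i = K.trans (K.sym (shift A x i)) (K.trans (e (K.0# ∷ᵥ x) i) (shift B x i))

  -- Completeness of the HA equations inside IH. The `absorb` identities that follow are obtained
  -- from it by computing with vectors instead of rewriting diagrams.
  map-faithful : {t u : Term Sig n m} (f : IsMap t) (g : IsMap u) →
                 (∀ x → mapOf f x ≋ᴷ mapOf g x) → t ≈ u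
  map-faithful {n} f g e with linear≈mat (IsMap⇒Linear f) | linear≈mat (IsMap⇒Linear g)
  ... | A , p | B , q = ~trans p (~trans (mat-faithful n A B λ x →
    ≋ᴷ-trans (≋ᴷ-sym (via f A p x)) (≋ᴷ-trans (e x) (via g B q x))) (~sym q))
    where
    via : ∀ {t} (f : IsMap t) A → t ≈ mat n A → ∀ x → mapOf f x ≋ᴷ mapOf (IsMap-mat n A) x
    via f A p x = ⟦map⟧⇒ (IsMap-mat n A) (⊆ (sound p) (⟦map⟧∋ f x))

  absorb-scale : ∀ x (v : Vec m) → absorb (λ i → x R.* v i) ≈ (s x ⊕ J m) ⨾ absorb v
  absorb-scale {m} x v = map-faithful (IsMap-absorb _) ((gen (scale x) ⊕ IsMap-J m) ⨾ IsMap-absorb v) λ y i →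
    K.trans (mapOf-absorb _ y i) (K.sym (K.trans (mapOf-absorb v _ i)
      (K.+-cong (mapOf-J m _ i) (K.trans
        (solve 3 (λ x v y → v :* (x :* y) := (x :* v) :* y) K.refl (ι x) (ι (v i)) (y zero))
        (K.*-congʳ (K.sym (ι-* _ _)))))))

  absorb-swap : (v w : Vec m) →
                (I ⊕ absorb w) ⨾ absorb v ≈ (σ₁₁ ⊕ J m) ⨾ ((I ⊕ absorb v) ⨾ absorb w)
  absorb-swap {m} v w = map-faithful
    ((id₁ ⊕ IsMap-absorb w) ⨾ IsMap-absorb v)
    ((σ₁₁ ⊕ IsMap-J m) ⨾ ((id₁ ⊕ IsMap-absorb v) ⨾ IsMap-absorb w)) λ y i →
      K.trans (mapOf-absorb v _ i) (K.trans (K.+-congʳ (mapOf-absorb w _ i))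
        (K.sym (K.trans (mapOf-absorb w _ i) (K.trans (K.+-congʳ
          (K.trans (mapOf-absorb v _ i) (K.+-congʳ (mapOf-J m _ i))))
          (solve 3 (λ a b c → (a :+ b) :+ c := (a :+ c) :+ b) K.refl _ _ _)))))

  absorb-shear : ∀ x (v w : Vec m) →
    (I ⊕ absorb w) ⨾ absorb (λ i → v i R.+ x R.* w i) ≈ (shear x ⊕ J m) ⨾ ((I ⊕ absorb w) ⨾ absorb v)
  absorb-shear {m} x v w = map-faithful
    ((id₁ ⊕ IsMap-absorb w) ⨾ IsMap-absorb _)
    ((((gen Δ ⊕ id₁) ⨾ (id₁ ⊕ IsMap-M x)) ⊕ IsMap-J m) ⨾ ((id₁ ⊕ IsMap-absorb w) ⨾ IsMap-absorb v)) λ y i →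
      K.trans (mapOf-absorb _ _ i) (K.trans (K.+-cong (mapOf-absorb w _ i)
        (K.*-congʳ (K.trans (ι-+ _ _) (K.+-congˡ (ι-* _ _)))))
        (K.sym (K.trans (mapOf-absorb v _ i) (K.trans (K.+-congʳ
          (K.trans (mapOf-absorb w _ i) (K.+-congʳ (mapOf-J m _ i))))
          (solve 6 (λ a w x c d v → (a :+ w :* (x :* c :+ d)) :+ v :* c
                                      := (a :+ w :* d) :+ (v :+ x :* w) :* c)
                 K.refl (y (suc (suc i))) (ι (w i)) (ι x) (y zero) (y (suc zero)) (ι (v i)))))))

  absorb-η∘ : (v : Vec m) → (η∘ ⊕ J m) ⨾ absorb v ≈ J m
  absorb-η∘ {m} v = map-faithful ((gen η ⊕ IsMap-J m) ⨾ IsMap-absorb v) (IsMap-J m) λ y i →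
    K.trans (mapOf-absorb v _ i) (K.trans (K.+-congˡ (K.zeroʳ _)) (K.+-identityʳ _))

  absorb-0∷ : (v : Vec m) → absorb (R.0# ∷ᵥ v) ≈ (σ₁₁ ⊕ J m) ⨾ (I ⊕ absorb v)
  absorb-0∷ {m} v = map-faithful (IsMap-absorb (R.0# ∷ᵥ v)) ((σ₁₁ ⊕ IsMap-J m) ⨾ (id₁ ⊕ IsMap-absorb v)) λ y →
    λ { zero    → K.trans (mapOf-absorb (R.0# ∷ᵥ v) y zero)
                    (K.trans (K.+-congˡ (K.trans (K.*-congʳ ι-0) (K.zeroˡ _))) (K.+-identityʳ _))
      ; (suc i) → K.trans (mapOf-absorb (R.0# ∷ᵥ v) y (suc i))
                    (K.sym (K.trans (mapOf-absorb v _ i) (K.+-congʳ (mapOf-J m _ i)))) }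

  absorb-pivot : (v : Vec (suc m)) →
    (I ⊕ (η∘ ⊕ J m)) ⨾ absorb v ≈ (Δ• ⊕ J m) ⨾ (s (head v) ⊕ absorb (tail v))
  absorb-pivot {m} v = map-faithful ((id₁ ⊕ (gen η ⊕ IsMap-J m)) ⨾ IsMap-absorb v)
    ((gen Δ ⊕ IsMap-J m) ⨾ (gen (scale (head v)) ⊕ IsMap-absorb (tail v))) λ y →
    λ { zero    → K.trans (mapOf-absorb v (mapOf (id₁ ⊕ (gen η ⊕ IsMap-J m)) y) zero) (K.+-identityˡ _)
      ; (suc i) → K.trans (mapOf-absorb v (mapOf (id₁ ⊕ (gen η ⊕ IsMap-J m)) y) (suc i))
                    (K.sym (mapOf-absorb (tail v) _ i)) }

  -- Spans of vectors and elementary operations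

  -- Each vector is absorbed with `η•`, a free coefficient, as its control.
  span : List (Vec m) → Term Sig 0 m
  span []      = zeros _
  span (v ∷ L) = (η• ⊕ span L) ⨾ absorb v

  span-∷ : {v w : Vec m} → v ≋ w → ∀ L L′ → span L ≈ span L′ → span (v ∷ L) ≈ span (w ∷ L′)
  span-∷ p L L′ q = ⨾-cong (refl⟩⊕⟨ q) (absorb-cong p)

  span-scale : ∀ {x} → ¬ (x R.≈ R.0#) → (v : Vec m) (L : List (Vec m)) →
               span ((λ i → x R.* v i) ∷ L) ≈ span (v ∷ L)
  span-scale {m} {x} x≉0 v L = begin
    (η• ⊕ span L) ⨾ absorb (λ i → x R.* v i)     ≈⟨ refl⟩⨾⟨ absorb-scale x v ⟩
    (η• ⊕ span L) ⨾ ((s x ⊕ J m) ⨾ absorb v)     ≈⟨ pull (~trans (~sym post-⊕) (η•-s x≉0 ⟩⊕⟨refl)) ⟩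
    (η• ⊕ span L) ⨾ absorb v                     ∎

  span-0 : (L : List (Vec m)) → span ((λ _ → R.0#) ∷ L) ≈ span L
  span-0 {m} L = begin
    (η• ⊕ span L) ⨾ absorb (λ _ → R.0#)    ≈⟨ refl⟩⨾⟨ absorb-0 m ⟩
    (η• ⊕ span L) ⨾ (ε• ⊕ J m)             ≈⟨ ~trans (~sym post-⊕) (η•-ε• ⟩⊕⟨refl) ⟩
    id₀ ⊕ span L                           ≈⟨ ⊕-identityˡ _ ⟩
    span L                                 ∎

  private
    span₂ : (v w : Vec m) (L : List (Vec m)) →
            span (v ∷ w ∷ L) ≈ ((η• ⊕ η•) ⊕ span L) ⨾ ((I ⊕ absorb w) ⨾ absorb v)
    span₂ v w L = ~trans (push ⊕-post) (~sym (⊕-assoc η• η• (span L)) ⟩⨾⟨refl)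

    -- A change of coefficients under which the plane of all pairs is invariant does not affect the
    -- span; the swap and the shears are the instances.
    through : {U : Term Sig 2 2} {f : Term Sig 0 m} {g : Term Sig (2 + m) k} → (η• ⊕ η•) ⨾ U ≈ η• ⊕ η• →
              ((η• ⊕ η•) ⊕ f) ⨾ ((U ⊕ J m) ⨾ g) ≈ ((η• ⊕ η•) ⊕ f) ⨾ g
    through p = pull (~trans (~sym post-⊕) (p ⟩⊕⟨refl))

  span-swap : (v w : Vec m) (L : List (Vec m)) → span (v ∷ w ∷ L) ≈ span (w ∷ v ∷ L)
  span-swap v w L = ~trans (span₂ v w L) (~trans (refl⟩⨾⟨ absorb-swap v w) (~trans
    (through (~trans (refl⟩⨾⟨ ~sym σ₁₁≈) (~trans (σ-natural η• η•) idl))) (~sym (span₂ w v L))))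

  span-shear : ∀ x (v w : Vec m) (L : List (Vec m)) →
               span ((λ i → v i R.+ x R.* w i) ∷ w ∷ L) ≈ span (v ∷ w ∷ L)
  span-shear x v w L = ~trans (span₂ _ w L) (~trans (refl⟩⨾⟨ absorb-shear x v w) (~trans
    (through (η•²-shear x)) (~sym (span₂ v w L))))

  span-↭ : {L L′ : List (Vec m)} → L ↭ L′ → span L ≈ span L′
  span-↭ Perm.refl           = ~refl
  span-↭ (Perm.prep {xs = L} {L′} v p)   = span-∷ {v = v} ≋-refl L L′ (span-↭ p)
  span-↭ (Perm.swap {xs = L} {L′} v w p) = ~trans (span-swap v w L)
    (span-∷ {v = w} ≋-refl (v ∷ L) (v ∷ L′) (span-∷ {v = v} ≋-refl L L′ (span-↭ p)))
  span-↭ (Perm.trans p q)    = ~trans (span-↭ p) (span-↭ q)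

  -- Membership is tested by subtracting multiples of the generators; InSpanᴿ adds them instead,
  -- which only changes the sign of the coefficients.
  InSpan : List (Vec m) → Vecᴷ m → Set (c ⊔ ℓ)
  InSpan []      y = Lift (c ⊔ ℓ) (y ≋ᴷ λ _ → K.0#)
  InSpan (v ∷ L) y = ∃ λ r → InSpan L (λ i → y i K.- ι (v i) K.* r)

  InSpanᴿ : List (Vec m) → Vec m → Set (c ⊔ ℓ)
  InSpanᴿ []      u = Lift (c ⊔ ℓ) (u ≋ λ _ → R.0#)
  InSpanᴿ (v ∷ L) u = ∃ λ r → InSpanᴿ L (λ i → u i R.+ r R.* v i)

  InSpan-resp : ∀ (L : List (Vec m)) {x y} → x ≋ᴷ y → InSpan L x → InSpan L y
  InSpan-resp []      p (lift q) = lift (≋ᴷ-trans (≋ᴷ-sym p) q)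
  InSpan-resp (v ∷ L) p (r , h)  = r , InSpan-resp L (λ i → K.+-congʳ (p i)) h

  InSpan-0 : ∀ (L : List (Vec m)) → InSpan L (λ _ → K.0#)
  InSpan-0 []      = lift ≋ᴷ-refl
  InSpan-0 (v ∷ L) = K.0# , InSpan-resp L
    (λ i → K.sym (K.trans (K.+-congˡ (K.trans (K.-‿cong (K.zeroʳ _)) -0#≈0#)) (K.+-identityʳ _))) (InSpan-0 L)

  InSpan-weaken : ∀ v (L : List (Vec m)) {y} → InSpan L y → InSpan (v ∷ L) y
  InSpan-weaken v L h = K.0# , InSpan-resp L
    (λ i → K.sym (K.trans (K.+-congˡ (K.trans (K.-‿cong (K.zeroʳ _)) -0#≈0#)) (K.+-identityʳ _))) h

  InSpan-head : ∀ v (L : List (Vec m)) → InSpan (v ∷ L) (ι ∘ v)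
  InSpan-head v L = K.1# , InSpan-resp L
    (λ i → K.sym (K.trans (K.+-congˡ (K.-‿cong (K.*-identityʳ _))) (K.-‿inverseʳ _))) (InSpan-0 L)

  InSpan-generators : (L : List (Vec m)) → All (λ v → InSpan L (ι ∘ v)) L
  InSpan-generators []      = []
  InSpan-generators (v ∷ L) = InSpan-head v L ∷ All.map (InSpan-weaken v L) (InSpan-generators L)

  ⟦span⟧⇒ : ∀ (L : List (Vec m)) {x y} → rel ⟦ span L ⟧ x y → InSpan L y
  ⟦span⟧⇒ []      {x} h = lift (≋ᴷ-trans (⟦map⟧⇒ (IsMap-zeros _) h)
    (≋ᴷ-trans (mapOf-cong (IsMap-zeros _) {y = λ _ → K.0#} λ ()) (mapOf-0 (IsMap-zeros _))))
  ⟦span⟧⇒ (v ∷ L) {x} {y} (z , (_ , h) , h′) = z zero , InSpan-resp L eq (⟦span⟧⇒ L h)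
    where
    eq : tail z ≋ᴷ λ i → y i K.- ι (v i) K.* z zero
    eq i = K.sym (K.trans (K.+-congʳ (K.trans (⟦map⟧⇒ (IsMap-absorb v) h′ i) (mapOf-absorb v z i)))
      (K.trans (K.+-assoc _ _ _) (K.trans (K.+-congˡ (K.-‿inverseʳ _)) (K.+-identityʳ _))))

  ⟦span⟧⇐ : ∀ (L : List (Vec m)) {x y} → InSpan L y → rel ⟦ span L ⟧ x y
  ⟦span⟧⇐ []      (lift p) = ⟦map⟧⇐ (IsMap-zeros _) (≋ᴷ-trans p
    (≋ᴷ-sym (≋ᴷ-trans (mapOf-cong (IsMap-zeros _) {y = λ _ → K.0#} λ ()) (mapOf-0 (IsMap-zeros _)))))
  ⟦span⟧⇐ (v ∷ L) {x} {y} (r , h) = z , (lift (λ ()) , ⟦span⟧⇐ L h)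
    , ⟦map⟧⇐ (IsMap-absorb v) (λ i → K.sym (K.trans (mapOf-absorb v z i)
        (K.trans (K.+-assoc _ _ _) (K.trans (K.+-congˡ (K.-‿inverseˡ _)) (K.+-identityʳ _)))))
    where
    z = r ∷ᵥ λ i → y i K.- ι (v i) K.* r

  InSpanᴿ-resp : ∀ (L : List (Vec m)) {u w} → u ≋ w → InSpanᴿ L u → InSpanᴿ L w
  InSpanᴿ-resp []      p (lift q) = lift (≋-trans (≋-sym p) q)
  InSpanᴿ-resp (v ∷ L) p (r , h)  = r , InSpanᴿ-resp L (λ i → R.+-congʳ (p i)) h

  InSpanᴿ-scale : ∀ x (L : List (Vec m)) {u} → InSpanᴿ L u → InSpanᴿ L (λ i → x R.* u i)
  InSpanᴿ-scale x []      (lift p) = lift λ i → R.trans (R.*-congˡ (p i)) (R.zeroʳ x)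
  InSpanᴿ-scale x (v ∷ L) (r , h)  = x R.* r , InSpanᴿ-resp L
    (λ i → R.trans (R.distribˡ _ _ _) (R.+-congˡ (R.sym (R.*-assoc _ _ _)))) (InSpanᴿ-scale x L h)

  *-≉0 : ∀ {x y} → ¬ (x R.≈ R.0#) → ¬ (y R.≈ R.0#) → ¬ (x R.* y R.≈ R.0#)
  *-≉0 x≉0 y≉0 e = [ x≉0 , y≉0 ]′ (noZeroDivisors _ _ e)

  clear-span : ∀ (L : List (Vec m)) {y} → InSpan L y →
    ∃ λ d → ∃ λ u → ¬ (d R.≈ R.0#) × (∀ i → ι (u i) K.≈ ι d K.* y i) × InSpanᴿ L u
  clear-span [] (lift p) = R.1# , (λ _ → R.0#) , 1≉0
    , (λ i → K.trans ι-0 (K.sym (K.trans (K.*-congˡ (p i)) (K.zeroʳ _)))) , lift ≋-refl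
  clear-span (w ∷ L) {y} (r , h) with clear-span L h | clear r
  ... | d , u , d≉0 , ιu , hᴿ | e , n , e≉0 , ιn =
    -- With u = d (y - r w) and e r = n, multiplying by e gives (d e) y = e u + (d n) w. Subtracting
    -- d n times w leaves e u, which is in the span of `L` by `InSpanᴿ-scale`.
    d R.* e , (λ i → e R.* u i R.+ (d R.* n) R.* w i) , *-≉0 d≉0 e≉0 , eq
    , R.- (d R.* n) , InSpanᴿ-resp L
        (λ i → R.sym (R.trans (R.+-assoc _ _ _) (R.trans
          (R.+-congˡ (R.trans (R.+-congˡ (R.sym (-ᴿ‿distribˡ-* _ _))) (R.-‿inverseʳ _))) (R.+-identityʳ _))))
        (InSpanᴿ-scale e L hᴿ)
    where
    eq : ∀ i → ι (e R.* u i R.+ (d R.* n) R.* w i) K.≈ ι (d R.* e) K.* y i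
    eq i = K.trans
      (K.trans (ι-+ _ _) (K.+-cong (ι-* _ _) (K.trans (ι-* _ _) (K.*-congʳ (ι-* _ _)))))
      (K.trans (K.+-cong (K.*-congˡ (ιu i)) (K.*-congʳ (K.*-congˡ (K.sym ιn))))
      (K.trans (solve 6 (λ e d y z w r → e :* (d :* (y :+ z)) :+ (d :* (e :* r)) :* w
                           := (d :* e) :* (y :+ (z :+ w :* r)))
                 K.refl (ι e) (ι d) (y i) (K.- (ι (w i) K.* r)) (ι (w i)) r)
        (K.*-cong (K.sym (ι-* _ _)) (K.trans (K.+-congˡ (K.-‿inverseˡ _)) (K.+-identityʳ _)))))

  redundantᴿ : ∀ (L : List (Vec m)) {u} → InSpanᴿ L u → span (u ∷ L) ≈ span L
  redundantᴿ []      (lift p) = ~trans (span-∷ p [] [] ~refl) (span-0 [])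
  redundantᴿ (w ∷ L) {u} (r , h) = begin
    span (u ∷ w ∷ L)     ≈⟨ span-shear r u w L ⟨
    span (u′ ∷ w ∷ L)    ≈⟨ span-swap u′ w L ⟩
    span (w ∷ u′ ∷ L)    ≈⟨ span-∷ {v = w} ≋-refl (u′ ∷ L) L (redundantᴿ L h) ⟩
    span (w ∷ L)         ∎
    where u′ = λ i → u i R.+ r R.* w i

  redundant : ∀ (L : List (Vec m)) {u} → InSpan L (ι ∘ u) → span (u ∷ L) ≈ span L
  redundant L {u} h with clear-span L h
  ... | d , u′ , d≉0 , ιu′ , hᴿ = begin
    span (u ∷ L)                    ≈⟨ span-scale d≉0 u L ⟨
    span ((λ i → d R.* u i) ∷ L)    ≈⟨ span-∷ (λ i → ι-inj (K.trans (ι-* _ _) (K.sym (ιu′ i)))) L L ~refl ⟩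
    span (u′ ∷ L)                   ≈⟨ redundantᴿ L hᴿ ⟩
    span L                          ∎

  redundant-++ : ∀ (L L′ : List (Vec m)) → All (λ v → InSpan L (ι ∘ v)) L′ → span (L′ List.++ L) ≈ span L
  redundant-++ L []       []       = ~refl
  redundant-++ L (v ∷ L′) (h ∷ hs) =
    ~trans (span-∷ {v = v} ≋-refl (L′ List.++ L) L (redundant-++ L L′ hs)) (redundant L h)

  -- Both lists are compared with their concatenation, in which either one makes the other
  -- redundant.
  span-unique : ∀ (L L′ : List (Vec m)) →
                (∀ {y} → InSpan L y → InSpan L′ y) → (∀ {y} → InSpan L′ y → InSpan L y) →
                span L ≈ span L′
  span-unique L L′ p q = begin
    span L              ≈⟨ redundant-++ L L′ (All.map q (InSpan-generators L′)) ⟨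
    span (L′ List.++ L) ≈⟨ span-↭ (++-comm L′ L) ⟩
    span (L List.++ L′) ≈⟨ redundant-++ L′ L (All.map p (InSpan-generators L)) ⟩
    span L′             ∎

  -- Every state is a span

  Spanned : Term Sig 0 m → Set (c ⊔ ℓ)
  Spanned f = ∃ λ L → f ≈ span L

  Spanned-resp : {f g : Term Sig 0 m} → f ≈ g → Spanned f → Spanned g
  Spanned-resp p (L , q) = L , ~trans (~sym p) q

  -- Stated for arrows with inputs, so that an induction on terms can pass through composites whose
  -- intermediate arities are not zero.
  Good : Term Sig n m → Set (c ⊔ ℓ)
  Good t = ∀ f → Spanned f → Spanned (f ⨾ t)

  Good-resp : {t u : Term Sig n m} → t ≈ u → Good t → Good u
  Good-resp p g f h = Spanned-resp (refl⟩⨾⟨ p) (g f h)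

  Good-⨾ : {t : Term Sig n m} {u : Term Sig m k} → Good t → Good u → Good (t ⨾ u)
  Good-⨾ g g′ f h = Spanned-resp assoc (g′ _ (g f h))

  Good-linear : {t : Term Sig n m} → Linear t → Good t
  Good-linear {t = t} l f (L , p) = List.map (action l) L , ~trans (p ⟩⨾⟨refl) (go L)
    where
    go : ∀ L → span L ⨾ t ≈ span (List.map (action l) L)
    go []      = zero-ax l
    go (v ∷ L) = begin
      ((η• ⊕ span L) ⨾ absorb v) ⨾ t                   ≈⟨ ~trans assoc (refl⟩⨾⟨ natural l v) ⟩
      (η• ⊕ span L) ⨾ ((I ⊕ t) ⨾ absorb (action l v))  ≈⟨ pull (~trans (~sym ⊕-post) (refl⟩⊕⟨ go L)) ⟩
      span (List.map (action l) (v ∷ L))               ∎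

  Good-map : {t : Term Sig n m} → IsMap t → Good t
  Good-map f = Good-linear (IsMap⇒Linear f)

  -- A zero coordinate is first put in front of every vector of `f`; the first unit vector with a
  -- free coefficient then makes the new coordinate independent.
  Good-η• : ∀ k → Good (η• ⊕ J k)
  Good-η• k f h with Good-map (gen η ⊕ IsMap-J k) f h
  ... | L , p = (R.1# ∷ᵥ λ _ → R.0#) ∷ L , (begin
    f ⨾ (η• ⊕ J k)                                             ≈⟨ bottom-first ⟨
    η• ⊕ f                                                     ≈⟨ idr ⟨
    (η• ⊕ f) ⨾ J (suc k)                                       ≈⟨ refl⟩⨾⟨ absorb-unit k ⟨
    (η• ⊕ f) ⨾ ((I ⊕ (η∘ ⊕ J k)) ⨾ absorb (R.1# ∷ᵥ λ _ → R.0#))  ≈⟨ pull (~trans (~sym ⊕-post) (refl⟩⊕⟨ p)) ⟩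
    span ((R.1# ∷ᵥ λ _ → R.0#) ∷ L)                            ∎)

  span-0∷ : ∀ (L : List (Vec m)) → span (List.map (R.0# ∷ᵥ_) L) ≈ η∘ ⊕ span L
  span-0∷ []      = ~refl
  span-0∷ {m} (v ∷ L) = begin
    (η• ⊕ span (List.map (R.0# ∷ᵥ_) L)) ⨾ absorb (R.0# ∷ᵥ v)  ≈⟨ ⨾-cong (refl⟩⊕⟨ span-0∷ L) (absorb-0∷ v) ⟩
    (η• ⊕ (η∘ ⊕ span L)) ⨾ ((σ₁₁ ⊕ J m) ⨾ (I ⊕ absorb v))
      ≈⟨ pull (~trans (~sym (⊕-assoc η• η∘ _) ⟩⨾⟨refl)
           (~trans (~sym post-⊕) (~trans (exchange ⟩⊕⟨refl) (⊕-assoc η∘ η• _)))) ⟩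
    (η∘ ⊕ (η• ⊕ span L)) ⨾ (I ⊕ absorb v)                     ≈⟨ ⊕-post ⟨
    η∘ ⊕ span (v ∷ L)                                         ∎
    where
    exchange : (η• ⊕ η∘) ⨾ σ₁₁ ≈ η∘ ⊕ η•
    exchange = ~trans (refl⟩⨾⟨ ~sym σ₁₁≈) (~trans (σ-natural η• η∘) idl)

  _≟0 : ∀ x → Dec (x R.≈ R.0#)
  x ≟0 with lem (Lift (c ⊔ ℓ) (x R.≈ R.0#))
  ... | yes (lift p) = yes p
  ... | no ¬p        = no (¬p ∘ lift)

  -- Echelon form with respect to the first coordinate only. The factor `η∘` records that all
  -- vectors other than the possible pivot have first entry zero.
  data Reduced (f : Term Sig 0 (suc m)) : Set (c ⊔ ℓ) where
    no-pivot : ∀ L → f ≈ η∘ ⊕ span L → Reduced f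
    pivot    : ∀ v L → ¬ (head v R.≈ R.0#) → f ≈ (η• ⊕ (η∘ ⊕ span L)) ⨾ absorb v → Reduced f

  reduce : (L : List (Vec (suc m))) → Reduced (span L)
  reduce []      = no-pivot [] ~refl
  reduce (v ∷ L) with reduce L | head v ≟0
  ... | no-pivot L₀ p | yes v₀≈0 = no-pivot (tail v ∷ L₀) (~trans
    (span-∷ {v = v} {R.0# ∷ᵥ tail v} (λ { zero → v₀≈0 ; (suc i) → R.refl }) L (List.map (R.0# ∷ᵥ_) L₀)
      (~trans p (~sym (span-0∷ L₀))))
    (span-0∷ (tail v ∷ L₀)))
  ... | no-pivot L₀ p | no v₀≉0 = pivot v L₀ v₀≉0 ((refl⟩⊕⟨ p) ⟩⨾⟨refl)
  -- Fraction-free elimination: `v` is replaced by w₀ v - v₀ w, whose first entry is zero. Scaling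
  -- `v` by w₀ is harmless because w₀ is non-zero.
  ... | pivot w L₀ w₀≉0 p | _ = pivot w (tail u ∷ L₀) w₀≉0 (begin
    span (v ∷ L)
      ≈⟨ span-∷ {v = v} ≋-refl L (w ∷ N) (~trans p ((refl⟩⊕⟨ ~sym (span-0∷ L₀)) ⟩⨾⟨refl)) ⟩
    span (v ∷ w ∷ N)        ≈⟨ span-scale w₀≉0 v (w ∷ N) ⟨
    span (u₁ ∷ w ∷ N)       ≈⟨ span-shear (R.- head v) u₁ w N ⟨
    span (u ∷ w ∷ N)        ≈⟨ span-swap u w N ⟩
    span (w ∷ u ∷ N)        ≈⟨ span-∷ {v = w} ≋-refl (u ∷ N) (List.map (R.0# ∷ᵥ_) (tail u ∷ L₀))
                                 (span-∷ {v = u} {R.0# ∷ᵥ tail u} (λ { zero → u₀≈0 ; (suc i) → R.refl })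
                                   N N ~refl) ⟩
    span (w ∷ List.map (R.0# ∷ᵥ_) (tail u ∷ L₀))        ≈⟨ (refl⟩⊕⟨ span-0∷ (tail u ∷ L₀)) ⟩⨾⟨refl ⟩
    (η• ⊕ (η∘ ⊕ span (tail u ∷ L₀))) ⨾ absorb w         ∎)
    where
    N = List.map (R.0# ∷ᵥ_) L₀
    u₁ = λ i → head w R.* v i
    u = λ i → u₁ i R.+ (R.- head v) R.* w i
    u₀≈0 : head u R.≈ R.0#
    u₀≈0 = R.trans (R.+-cong (R.*-comm _ _) (R.sym (-ᴿ‿distribˡ-* _ _))) (R.-‿inverseʳ _)

  -- Without a pivot the zero test always succeeds. With a pivot the first coordinate is c v₀ for
  -- the coefficient c of `v`; as v₀ is non-zero, the test forces c = 0 and `v` drops out.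
  -- Diagrammatically these are `s-ε∘`, `cup-ε∘` and `absorb-η∘`.
  Good-ε∘ : ∀ k → Good (ε∘ ⊕ J k)
  Good-ε∘ k f (L , q) with reduce L
  ... | no-pivot L₀ p = L₀ , (begin
    f ⨾ (ε∘ ⊕ J k)                  ≈⟨ ~trans q p ⟩⨾⟨refl ⟩
    (η∘ ⊕ span L₀) ⨾ (ε∘ ⊕ J k)     ≈⟨ ~trans (~sym post-⊕) (η∘-ε∘ ⟩⊕⟨refl) ⟩
    id₀ ⊕ span L₀                   ≈⟨ ⊕-identityˡ _ ⟩
    span L₀                         ∎)
  ... | pivot v L₀ v₀≉0 p = L₀ , (begin
    f ⨾ (ε∘ ⊕ J k)
      ≈⟨ ~trans q p ⟩⨾⟨refl ⟩
    ((η• ⊕ (η∘ ⊕ span L₀)) ⨾ absorb v) ⨾ (ε∘ ⊕ J k)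
      ≈⟨ (refl⟩⊕⟨ bottom-first) ⟩⨾⟨refl ⟩⨾⟨refl ⟩
    ((η• ⊕ (span L₀ ⨾ (η∘ ⊕ J k))) ⨾ absorb v) ⨾ (ε∘ ⊕ J k)
      ≈⟨ push (push ⊕-post) ⟩
    (η• ⊕ span L₀) ⨾ (((I ⊕ (η∘ ⊕ J k)) ⨾ absorb v) ⨾ (ε∘ ⊕ J k))
      ≈⟨ refl⟩⨾⟨ push (absorb-pivot v) ⟩
    (η• ⊕ span L₀) ⨾ ((Δ• ⊕ J k) ⨾ ((s (head v) ⊕ absorb (tail v)) ⨾ (ε∘ ⊕ J k)))
      ≈⟨ refl⟩⨾⟨ refl⟩⨾⟨ ~trans (~sym post-⊕) (~trans (s-ε∘ v₀≉0 ⟩⊕⟨refl) top-first) ⟩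
    (η• ⊕ span L₀) ⨾ ((Δ• ⊕ J k) ⨾ ((ε∘ ⊕ J (suc k)) ⨾ absorb (tail v)))
      ≈⟨ refl⟩⨾⟨ pull (~trans (refl⟩⨾⟨ ~sym (⊕-assoc ε∘ I (J k))) (~sym ⊕J-⨾)) ⟩
    (η• ⊕ span L₀) ⨾ (((Δ• ⨾ (ε∘ ⊕ I)) ⊕ J k) ⨾ absorb (tail v))
      ≈⟨ pull (~trans (~sym post-⊕) (~trans (~trans (~sym assoc) cup-ε∘ ⟩⊕⟨refl) bottom-first)) ⟩
    (span L₀ ⨾ (η∘ ⊕ J k)) ⨾ absorb (tail v)
      ≈⟨ ~trans assoc (refl⟩⨾⟨ absorb-η∘ (tail v)) ⟩
    span L₀ ⨾ J k
      ≈⟨ idr ⟩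
    span L₀ ∎)

  -- The quantification over k makes the property inductive with respect to ⊕.
  Stable : Term Sig n m → Set (c ⊔ ℓ)
  Stable t = ∀ k → Good (t ⊕ J k)

  Stable-resp : {t u : Term Sig n m} → t ≈ u → Stable t → Stable u
  Stable-resp p h k = Good-resp (p ⟩⊕⟨refl) (h k)

  Stable-⨾ : {t : Term Sig n m} {u : Term Sig m k} → Stable t → Stable u → Stable (t ⨾ u)
  Stable-⨾ h h′ k = Good-resp (~sym ⊕J-⨾) (Good-⨾ (h k) (h′ k))

  Stable-map : {t : Term Sig n m} → IsMap t → Stable t
  Stable-map f k = Good-linear (IsMap⇒Linear⊕J f k)

  private
    Good-unsubst : ∀ {n n′ m m′} (p : n ≡ n′) (q : m ≡ m′) {t : Term Sig n m} →
                   Good (subst₂ (Term Sig) p q t) → Good t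
    Good-unsubst ≡.refl ≡.refl g = g

    Spanned-subst : ∀ {m m′} (q : m ≡ m′) {t : Term Sig 0 m} →
                    Spanned t → Spanned (subst₂ (Term Sig) ≡.refl q t)
    Spanned-subst ≡.refl g = g

  -- Below other wires, a term is conjugate by symmetries to itself on top.
  Good-W : {t : Term Sig n m} → Stable t → ∀ j k → Good (W j (t ⊕ J k))
  Good-W {n} {m} {t} h j k = Good-resp conj
    (Good-⨾ (Good-map (IsMap-σ j (n + k))) (Good-⨾ on-top (Good-map (IsMap-σ (m + k) j))))
    where
    on-top : Good ((t ⊕ J k) ⊕ J j)
    on-top = Good-unsubst (+-assoc n k j) (+-assoc m k j)
      (Good-resp (~sym (~trans (⊕-assoc t (J k) (J j)) (refl⟩⊕⟨ ⊕-id k j))) (h (k + j)))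
    conj : σₜ j (n + k) ⨾ (((t ⊕ J k) ⊕ J j) ⨾ σₜ (m + k) j) ≈ W j (t ⊕ J k)
    conj = begin
      σₜ j (n + k) ⨾ (((t ⊕ J k) ⊕ J j) ⨾ σₜ (m + k) j)      ≈⟨ swap₂ (~sym (σ-natural (J j) (t ⊕ J k))) ⟩
      (J j ⊕ (t ⊕ J k)) ⨾ (σₜ j (m + k) ⨾ σₜ (m + k) j)      ≈⟨ refl⟩⨾⟨ σ-involutive j (m + k) ⟩
      (J j ⊕ (t ⊕ J k)) ⨾ J (j + (m + k))                    ≈⟨ idr ⟩
      J j ⊕ (t ⊕ J k)                                        ≈⟨ W≈ j ⟩
      W j (t ⊕ J k)                                          ∎

  Stable-⊕ : {t : Term Sig n m} {u : Term Sig a b} → Stable t → Stable u → Stable (t ⊕ u)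
  Stable-⊕ {m = m} {a = a} {t = t} {u} h h′ k =
    tensor-closed Good Good-resp Good-⨾ t u (h (a + k)) (Good-W h′ m k)

  Stable-cup : Stable cup
  Stable-cup = Stable-⨾ Good-η• (Stable-map (gen Δ))

  Stable-cap : Stable cap
  Stable-cap = Stable-resp (~sym cap≈)
    (Stable-⨾ (Stable-map (id₁ ⊕ gen (scale _))) (Stable-⨾ (Stable-map (gen μ)) Good-ε∘))

  Stable-I : Stable I
  Stable-I = Stable-map id₁

  stable : (t : Term Sig n m) → Stable t
  stable (gen (inj₁ g))         = Stable-map (gen g)
  stable (gen (inj₂ Δ))         = Stable-resp (~sym μ•≈)
    (Stable-⨾ (Stable-map (gen Δ ⊕ id₁)) (Stable-⊕ Stable-I Stable-cap))
  stable (gen (inj₂ ε))         = Good-η•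
  stable (gen (inj₂ μ))         = Stable-resp (~sym Δ∘≈)
    (Stable-⨾ (Stable-⊕ (Stable-⨾ Stable-cup (Stable-map (id₁ ⊕ gen (scale _)))) Stable-I)
              (Stable-map (id₁ ⊕ gen μ)))
  stable (gen (inj₂ η))         = Good-ε∘
  stable (gen (inj₂ (scale x))) with x ≟0
  -- I1 and I2 do not apply to zero; the reversed A17 takes `s̄ x` apart instead.
  ... | yes x≈0 = Stable-resp (~sym (~trans (ha-op (s-cong x≈0)) (ha-op A17))) (Stable-⨾ Good-ε∘ Good-η•)
  ... | no x≉0  = Stable-resp (~sym (s̄≈ x≉0))
    (Stable-⨾ (Stable-⊕ Stable-I Stable-cup)
      (Stable-⨾ (Stable-map (id₁ ⊕ (gen (scale x) ⊕ id₁))) (Stable-⊕ Stable-cap Stable-I)))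
  stable id₀     = Stable-map id₀
  stable id₁     = Stable-I
  stable σ₁₁     = Stable-map σ₁₁
  stable (t ⨾ u) = Stable-⨾ (stable t) (stable u)
  stable (t ⊕ u) = Stable-⊕ (stable t) (stable u)

  spanned : (t : Term Sig 0 m) → Spanned t
  spanned {m} t = Spanned-resp (~trans (⊕-identityʳ t) ~refl)
    -- The induction is started at `id₀`, which is the span of the empty list of vectors of length
    -- zero.
    (Spanned-subst (+-identityʳ m) (Spanned-resp idl (stable t 0 id₀ ([] , ~refl))))

  faithful : ∀ n {m} (f g : Term Sig n m) → PROP._≈_ (SV K) ⟦ f ⟧ ⟦ g ⟧ → f ≈ g
  faithful zero    f g e with spanned f | spanned g
  ... | L , p | L′ , q = ~trans p (~trans (span-unique L L′
    (λ h → ⟦span⟧⇒ L′ (⊆ (sound q) (⊆ e (⊇ (sound p) (⟦span⟧⇐ L {x = λ ()} h)))))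
    (λ h → ⟦span⟧⇒ L (⊆ (sound p) (⊇ e (⊇ (sound q) (⟦span⟧⇐ L′ {x = λ ()} h)))))) (~sym q))
  faithful (suc n) f g e = begin
    f                 ≈⟨ unbend-bend f ⟨
    unbend (bend f)   ≈⟨ (refl⟩⊕⟨ faithful n (bend f) (bend g) bent) ⟩⨾⟨refl ⟩
    unbend (bend g)   ≈⟨ unbend-bend g ⟩
    g                 ∎
    where
    bent : PROP._≈_ (SV K) ⟦ bend f ⟧ ⟦ bend g ⟧
    bent = ⨾-congˢ ⟦ cup ⊕ J n ⟧ ⟦ cup ⊕ J n ⟧ ⟦ I ⊕ f ⟧ ⟦ I ⊕ g ⟧ reflˢ
             (⊕-congˢ ⟦ I ⟧ ⟦ I ⟧ ⟦ f ⟧ ⟦ g ⟧ reflˢ e)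

-- Fullness and the isomorphism

module Isomorphism {c ℓ} (R : CommutativeRing c ℓ) (isIntegralDomain : IsIntegralDomain R)
                   (K : Field (c ⊔ ℓ) ℓ) (isFractionField : IsFractionField R K)
                   (lem : (P : Set (c ⊔ ℓ)) → Dec P) where
  open IsIntegralDomain isIntegralDomain
  open Relations R 1≉0 using (Sig; Vec; J; I; _≈_; unbend; cap)
  open Semantics R K isFractionField
  open States R isIntegralDomain K isFractionField lem
  private
    module R = CommutativeRing R
    module K = Field K
    module S = PROP (SV K)
    open module SVEq {n m : ℕ} = IsEquivalence (S.isEquivalence {n} {m})
      using () renaming (sym to symˢ; trans to transˢ)
    variable
      n m : ℕ
  open import Algebra.Properties.Ring (CommutativeRing.ring K.commutativeRing) using (-‿distribʳ-*; -0#≈0#)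

  private
    [x-y]+y≈x : ∀ x y → (x K.- y) K.+ y K.≈ x
    [x-y]+y≈x x y = K.trans (K.+-assoc _ _ _) (K.trans (K.+-congˡ (K.-‿inverseˡ y)) (K.+-identityʳ x))

    x-0r≈x : ∀ x {z} r → z K.≈ K.0# → x K.- z K.* r K.≈ x
    x-0r≈x x r e = K.trans
      (K.+-congˡ (K.trans (K.-‿cong (K.trans (K.*-congʳ e) (K.zeroˡ r))) -0#≈0#)) (K.+-identityʳ x)

  InSpan-0∷⇒ : ∀ (L : List (Vec m)) {y} → InSpan (List.map (R.0# ∷ᵥ_) L) y →
               head y K.≈ K.0# × InSpan L (tail y)
  InSpan-0∷⇒ []      (lift p) = p zero , lift (p ∘ suc)
  InSpan-0∷⇒ (v ∷ L) (r , h) with InSpan-0∷⇒ L h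
  ... | p , h′ = K.trans (K.sym (x-0r≈x _ r ι-0)) p , r , h′

  InSpan-0∷⇐ : ∀ (L : List (Vec m)) {y} → head y K.≈ K.0# → InSpan L (tail y) →
               InSpan (List.map (R.0# ∷ᵥ_) L) y
  InSpan-0∷⇐ []      p (lift q) = lift λ { zero → p ; (suc i) → q i }
  InSpan-0∷⇐ (v ∷ L) p (r , h)  = r , InSpan-0∷⇐ L (K.trans (x-0r≈x _ r ι-0) p) h

  clear-vector : ∀ {m} (y : Vecᴷ m) →
    ∃ λ d → ∃ λ (u : Vec m) → ¬ (d R.≈ R.0#) × (∀ i → ι (u i) K.≈ ι d K.* y i)
  clear-vector {zero}  y = R.1# , (λ ()) , 1≉0 , λ ()
  clear-vector {suc m} y with clear (head y) | clear-vector (tail y)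
  ... | e , n , e≉0 , p | d , u , d≉0 , q = e R.* d , (d R.* n) ∷ᵥ (λ i → e R.* u i) , *-≉0 e≉0 d≉0 , λ
    { zero    → K.trans (ι-* _ _) (K.trans (K.*-congˡ (K.sym p)) (K.trans (K.sym (K.*-assoc _ _ _))
                  (K.*-congʳ (K.trans (K.*-comm _ _) (K.sym (ι-* _ _))))))
    ; (suc i) → K.trans (ι-* _ _) (K.trans (K.*-congˡ (q i)) (K.trans (K.sym (K.*-assoc _ _ _))
                  (K.*-congʳ (K.sym (ι-* _ _))))) }

  kernel : Subspace K 0 (suc m) → Subspace K 0 m
  kernel V = record
    { rel  = λ x y → rel V x (K.0# ∷ᵥ y)
    ; resp = λ p q → resp V p λ { zero → K.refl ; (suc i) → q i }
    ; 0∈   = resp V ≋ᴷ-refl (λ { zero → K.refl ; (suc i) → K.refl }) (0∈ V)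
    ; +∈   = λ h h′ → resp V ≋ᴷ-refl (λ { zero → K.+-identityˡ _ ; (suc i) → K.refl }) (+∈ V h h′)
    ; *∈   = λ r h → resp V ≋ᴷ-refl (λ { zero → K.zeroʳ _ ; (suc i) → K.refl }) (*∈ V r h)
    }

  -- Subspaces are mere predicates, so excluded middle decides whether some member has a non-zero
  -- first coordinate. Such a member, cleared of denominators, is the pivot; subtracting a multiple
  -- of it moves any member into the hyperplane section `kernel V`.
  basis : ∀ m (V : Subspace K 0 m) →
          ∃ λ L → (∀ {y} → rel V []ᵥ y → InSpan L y) × (∀ {y} → InSpan L y → rel V []ᵥ y)
  basis zero    V = [] , (λ _ → lift λ ()) , λ _ → resp V (λ ()) (λ ()) (0∈ V)
  basis (suc m) V with basis m (kernel V) | lem (∃ λ y → rel V []ᵥ y × ¬ (head y K.≈ K.0#))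
  ... | L , into , outof | no ¬p = List.map (R.0# ∷ᵥ_) L
    , (λ {y} h → let y₀≈0 = head≈0 h in InSpan-0∷⇐ L y₀≈0
        (into (resp V ≋ᴷ-refl (λ { zero → y₀≈0 ; (suc i) → K.refl }) h)))
    , λ h → let p , h′ = InSpan-0∷⇒ L h in
        resp V ≋ᴷ-refl (λ { zero → K.sym p ; (suc i) → K.refl }) (outof h′)
    where
    head≈0 : ∀ {y} → rel V []ᵥ y → head y K.≈ K.0#
    head≈0 {y} h with lem (Lift (c ⊔ ℓ) (head y K.≈ K.0#))
    ... | yes (lift p) = p
    ... | no y₀≉0      = contradiction (y , h , y₀≉0 ∘ lift) ¬p
  ... | L , into , outof | yes (y , y∈V , y₀≉0) with clear-vector y
  ...   | d , u , d≉0 , ιu with K.inverse (ι (head u)) ιu₀≉0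
    where
    ιu₀≉0 : ¬ (ι (head u) K.≈ K.0#)
    ιu₀≉0 e = y₀≉0 (cancelˡ (ι≉0 d≉0) (K.trans (K.sym (ιu zero)) (K.trans e (K.sym (K.zeroʳ _)))))
  ...     | j , u₀j≈1 = u ∷ List.map (R.0# ∷ᵥ_) L
    , (λ {z} h → let
          -- The quotient of the first coordinates of z and u, so that z - r u has first coordinate
          -- zero.
          r = j K.* head z
          z₀≈0 = K.trans (K.+-congˡ (K.-‿cong (K.trans (K.sym (K.*-assoc _ _ _))
                   (K.trans (K.*-congʳ u₀j≈1) (K.*-identityˡ _))))) (K.-‿inverseʳ _)
        in r , InSpan-0∷⇐ L z₀≈0 (into (resp V (λ ()) (λ { zero → z₀≈0 ; (suc i) → K.refl })
             (shift (K.- r) (λ i → K.+-congˡ (K.sym (-‿distribʳ-* _ _))) h))))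
    , λ (r , h) → let p , h′ = InSpan-0∷⇒ L h in
        resp V (λ ()) (λ i → [x-y]+y≈x _ _) (shift r (λ i → K.refl)
          (resp V (λ ()) (λ { zero → K.sym p ; (suc i) → K.refl }) (outof h′)))
    where
    u∈V : rel V []ᵥ (ι ∘ u)
    u∈V = resp V (λ ()) (λ i → K.sym (ιu i)) (*∈ V (ι d) y∈V)
    shift : ∀ r {z z′} → (∀ i → z i K.+ ι (u i) K.* r K.≈ z′ i) → rel V []ᵥ z → rel V []ᵥ z′
    shift r e h = resp V (λ ()) (λ i → K.trans (K.+-congˡ (K.*-comm _ _)) (e i)) (+∈ V h (*∈ V r u∈V))

  -- The semantic counterpart of `bend`, with the first input read as the first output instead of a
  -- composition with a cup.
  bendˢ : Subspace K (suc n) m → Subspace K n (suc m)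
  bendˢ V = record
    { rel  = λ x y → rel V (head y ∷ᵥ x) (tail y)
    ; resp = λ p q → resp V (λ { zero → q zero ; (suc i) → p i }) (q ∘ suc)
    ; 0∈   = resp V (λ { zero → K.refl ; (suc i) → K.refl }) ≋ᴷ-refl (0∈ V)
    ; +∈   = λ h h′ → resp V (λ { zero → K.refl ; (suc i) → K.refl }) ≋ᴷ-refl (+∈ V h h′)
    ; *∈   = λ r h → resp V (λ { zero → K.refl ; (suc i) → K.refl }) ≋ᴷ-refl (*∈ V r h)
    }

  full : ∀ n {m} (V : Subspace K n m) → ∃ λ (t : Term Sig n m) → ⟦ t ⟧ S.≈ V
  full zero    {m} V with basis m V
  ... | L , into , outof = span L , record
    { ⊆ = λ h → resp V (λ ()) ≋ᴷ-refl (outof (⟦span⟧⇒ L h))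
    ; ⊇ = λ h → ⟦span⟧⇐ L (into (resp V (λ ()) ≋ᴷ-refl h)) }
  full (suc n) {m} V with full n (bendˢ V)
  ... | t , e = unbend t , record
    { ⊆ = λ { {x} {y} (z , (lift p , h) , ((w , lift q , _) , h′)) →
              resp V (λ { zero    → K.trans (q (suc zero)) (K.trans (K.sym (q zero)) (K.sym (p zero)))
                        ; (suc i) → K.refl }) (lower (⊆ (⟦idₜ⟧ m) h′)) (⊆ e h) }
    ; ⊇ = λ { {x} {y} h → (head x ∷ᵥ head x ∷ᵥ y)
              , (lift (λ { zero → K.refl }) , ⊇ e (resp V (λ { zero → K.refl ; (suc i) → K.refl }) ≋ᴷ-refl h))
              , ( ((λ _ → head x) , lift (λ { zero → K.refl ; (suc zero) → K.refl }) , lift λ ())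
                , ⊇ (⟦idₜ⟧ m) (lift ≋ᴷ-refl)) } }

  to : Morphism (IH R) (SV K)
  to = record
    { ⟦_⟧     = ⟦_⟧
    ; ⟦⟧-cong = sound
    ; ⟦id⟧    = ⟦idₜ⟧
    ; ⟦⨾⟧     = λ f g → reflˢ
    ; ⟦⊕⟧     = λ f g → reflˢ
    ; ⟦σ⟧     = ⟦σₜ⟧
    }

  term : Subspace K n m → Term Sig n m
  term V = proj₁ (full _ V)

  ⟦term⟧ : (V : Subspace K n m) → ⟦ term V ⟧ S.≈ V
  ⟦term⟧ V = proj₂ (full _ V)

  -- By faithfulness any term with the right meaning is the chosen one, which yields all functor
  -- laws of the inverse as well as `from∘to`.
  term-unique : (V : Subspace K n m) (t : Term Sig n m) → V S.≈ ⟦ t ⟧ → term V ≈ t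
  term-unique V t e = faithful _ (term V) t (transˢ (⟦term⟧ V) e)

  IH≅SV : IH R ≅ SV K
  IH≅SV = record
    { to      = to
    ; from    = record
      { ⟦_⟧     = term
      ; ⟦⟧-cong = λ {_} {_} {V} {W} e → term-unique V (term W) (transˢ e (symˢ (⟦term⟧ W)))
      ; ⟦id⟧    = λ n → term-unique _ _ (symˢ (⟦idₜ⟧ n))
      ; ⟦⨾⟧     = λ V W → term-unique _ _ (⨾-congˢ V _ W _ (symˢ (⟦term⟧ V)) (symˢ (⟦term⟧ W)))
      ; ⟦⊕⟧     = λ V W → term-unique _ _ (⊕-congˢ V _ W _ (symˢ (⟦term⟧ V)) (symˢ (⟦term⟧ W)))
      ; ⟦σ⟧     = λ n m → term-unique _ _ (symˢ (⟦σₜ⟧ n m))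
      }
    ; from∘to = λ f → term-unique ⟦ f ⟧ f reflˢ
    ; to∘from = ⟦term⟧
    }

-- The field of fractions, excluded middle and the theorem

fractionField-isFractionField : ∀ {c ℓ} (R : CommutativeRing c ℓ) (d : IsIntegralDomain R) →
                                IsFractionField R (fractionField R d)
fractionField-isFractionField R d = record
  { ι      = λ x → mkFraction x 1# 1≉0
  ; ι-cong = *-congʳ
  ; ι-inj  = λ {x} {y} e → trans (sym (*-identityʳ x)) (trans e (*-identityʳ y))
  ; ι-+    = λ x y → trans (*-congˡ (*-identityʳ 1#)) (*-congʳ (sym (+-cong (*-identityʳ x) (*-identityʳ y))))
  ; ι-*    = λ x y → *-congˡ (*-identityʳ 1#)
  ; ι-0    = refl
  ; ι-1    = refl
  ; clear  = λ (mkFraction n e e≉0) → e , n , e≉0 ,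
      trans (*-identityʳ _) (trans (*-comm e n) (*-congˡ (sym (*-identityˡ e))))
  }
  where
  open CommutativeRing R
  open IsIntegralDomain d

-- A generator of the ideal { x | x ≈ 0 or P } is zero unless P holds.
excluded-middle : ∀ {c ℓ} (R : CommutativeRing c ℓ) → IsPID R → (P : Set (c ⊔ ℓ)) → Dec P
excluded-middle {c} {ℓ} R isPID P = decide (principal I)
  where
  open CommutativeRing R
  open IsPID isPID
  open IsIntegralDomain isIntegralDomain
  open import Algebra.Properties.Semiring.Divisibility semiring using (∣-refl; ∣-respˡ; 0∣x⇒x≈0)
  I : Ideal R
  I = record
    { member = λ x → x ≈ 0# ⊎ P
    ; resp   = λ e → [ (λ p → inj₁ (trans (sym e) p)) , inj₂ ]′
    ; 0∈     = inj₁ refl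
    ; +∈     = λ { (inj₁ p) (inj₁ q) → inj₁ (trans (+-cong p q) (+-identityˡ 0#))
                 ; (inj₂ p) _ → inj₂ p ; (inj₁ _) (inj₂ q) → inj₂ q }
    ; *∈     = λ { r (inj₁ p) → inj₁ (trans (*-congˡ p) (zeroʳ r)) ; r (inj₂ p) → inj₂ p }
    }
  decide : IsPrincipal R I → Dec P
  decide (g , generates) with Equivalence.from (generates g) ∣-refl
  ... | inj₂ p   = yes p
  ... | inj₁ g≈0 = no λ p → 1≉0 (0∣x⇒x≈0 (∣-respˡ g≈0 (Equivalence.to (generates 1#) (inj₂ p))))

theorem6p4 : ∀ {c ℓ} (R : CommutativeRing c ℓ) (isPID : IsPID R) →
    IH R ≅ SV (fractionField R (IsPID.isIntegralDomain isPID))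
theorem6p4 R isPID = Isomorphism.IH≅SV R isIntegralDomain (fractionField R isIntegralDomain)
  (fractionField-isFractionField R isIntegralDomain) (excluded-middle R isPID)
  where open IsPID isPID
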